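{- The seeded tiling problem for the lamplighter group $L$ (with generating set $S=\{a^{\pm1},b^{\pm1}\}$) is unsolvable: there is no algorithm which, given a finite set $A$, a subset $\Pi\subseteq A\times S\times A$ and an element $a_0\in A$, decides whether there exists a map $\phi\colon L\to A$ with $\phi(1)=a_0$ and $(\phi(g),s,\phi(gs))\in\Pi$ for all $g\in L$ and all $s\in S$.
   Context: The lamplighter group is $L=\mathbb Z/2\wr\mathbb Z$. Concretely, its elements are pairs $(s,n)$ with $n\in\mathbb Z$ and $s\colon \mathbb Z+\tfrac12\to\mathbb Z/2$ finitely supported. The product is $(r,m)(s,n)=(t,m+n)$ with $t_i=r_i+s_{i-m}$. The generators are $a=(0,1)$ and $b=(\delta_{1/2},1)$, where $\delta_{1/2}$ is the function equal to $1$ at $1/2$ and $0$ elsewhere. Equivalently, $L=\langle a,b\mid (a^nb^{ -n})^2\ (n\ge1)\rangle$. -}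

module Defs where

open import Data.Nat as ℕ using (ℕ; zero; suc; _+_; _*_; _∸_; _^_; _<_)
open import Data.Integer as ℤ using (ℤ; +_; -[1+_])
open import Data.Bool using (Bool; true; false; not; if_then_else_)
open import Data.Fin using (Fin; toℕ)

open import Data.List using (List; []; _∷_; _++_; map; concatMap; allFin)
open import Data.Vec using (Vec; []; _∷_)
open import Data.Product using (Σ; _×_; _,_)
open import Relation.Nullary using (does; ¬_)
open import Relation.Binary.PropositionalEquality using (_≡_)
open import Function.Bundles using (_⇔_)
import Data.Vec as Vec

-- The lamplighter group L = Z/2 ≀ Z.
-- An element (s , n): the lamp configuration s : Z + 1/2 → Z/2 (finitely
-- supported) is represented by a finite list of positions; the list entry
-- k : ℤ stands for the half-integer position k + 1/2, and the value of the
-- lamp at a position is the parity of the number of occurrences of it in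
-- the list.  Thus every finitely supported configuration is represented,
-- and two representatives denote the same group element iff they are
-- related by _≈_ below.

record Elem : Set where
  constructor ⟨_,_⟩
  field
    lamps : List ℤ
    pos   : ℤ
open Elem public

lamp : List ℤ → ℤ → Bool
lamp []       k = false
lamp (x ∷ xs) k = if does (x ℤ.≟ k) then not (lamp xs k) else lamp xs k

_≈_ : Elem → Elem → Set
g ≈ h = (pos g ≡ pos h) × (∀ k → lamp (lamps g) k ≡ lamp (lamps h) k)

one : Elem
one = ⟨ [] , + 0 ⟩

-- (r , m)(s , n) = (t , m + n) with t_i = r_i + s_{i-m}
_·_ : Elem → Elem → Elem
⟨ r , m ⟩ · ⟨ s , n ⟩ = ⟨ r ++ map (λ i → m ℤ.+ i) s , m ℤ.+ n ⟩

data Gen : Set where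
  a⁺ a⁻ b⁺ b⁻ : Gen

allGen : List Gen
allGen = a⁺ ∷ a⁻ ∷ b⁺ ∷ b⁻ ∷ []

-- a = (0,1), a⁻¹ = (0,-1), b = (δ_{1/2},1), b⁻¹ = (δ_{-1/2},-1)
gen : Gen → Elem
gen a⁺ = ⟨ [] , + 1 ⟩
gen a⁻ = ⟨ [] , -[1+ 0 ] ⟩
gen b⁺ = ⟨ + 0 ∷ [] , + 1 ⟩
gen b⁻ = ⟨ -[1+ 0 ] ∷ [] , -[1+ 0 ] ⟩

record Instance : Set where
  field
    size : ℕ
    Π    : Fin size → Gen → Fin size → Bool
    a₀   : Fin size
open Instance public

Tileable : Instance → Set
Tileable I =
  Σ (Elem → Fin (size I)) λ φ →
    (∀ g h → g ≈ h → φ g ≡ φ h) ×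
    (φ one ≡ a₀ I) ×
    (∀ g s → Π I (φ g) s (φ (g · gen s)) ≡ true)

-- bijective pairing ℕ × ℕ → ℕ
pair : ℕ → ℕ → ℕ
pair x y = 2 ^ x * (2 * y + 1) ∸ 1

bitsToℕ : List Bool → ℕ
bitsToℕ []          = 0
bitsToℕ (false ∷ bs) = 2 * bitsToℕ bs
bitsToℕ (true ∷ bs)  = suc (2 * bitsToℕ bs)

table : (n : ℕ) → (Fin n → Gen → Fin n → Bool) → List Bool
table n P =
  concatMap (λ x → concatMap (λ s → map (λ y → P x s y) (allFin n)) allGen)
            (allFin n)

encode : Instance → ℕ
encode I = pair (size I) (pair (toℕ (a₀ I)) (bitsToℕ (table (size I) (Π I))))

data Code : ℕ → Set where
  zer  : ∀ {k} → Code k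
  succ : Code 1
  proj : ∀ {k} → Fin k → Code k
  comp : ∀ {m k} → Code m → Vec (Code k) m → Code k
  prec : ∀ {k} → Code k → Code (suc (suc k)) → Code (suc k)
  mu   : ∀ {k} → Code (suc k) → Code k

mutual
  data Eval : ∀ {k} → Code k → Vec ℕ k → ℕ → Set where
    ev-zer  : ∀ {k} {xs : Vec ℕ k} → Eval zer xs 0
    ev-succ : ∀ {x} → Eval succ (x ∷ []) (suc x)
    ev-proj : ∀ {k} {i : Fin k} {xs} → Eval (proj i) xs (Vec.lookup xs i)
    ev-comp : ∀ {m k} {f : Code m} {gs : Vec (Code k) m} {xs ys z} →
              EvalAll gs xs ys → Eval f ys z → Eval (comp f gs) xs z
    ev-prec-zero : ∀ {k} {f : Code k} {g} {xs z} →
              Eval f xs z → Eval (prec f g) (0 ∷ xs) z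
    ev-prec-suc  : ∀ {k} {f : Code k} {g} {xs y w z} →
              Eval (prec f g) (y ∷ xs) w →
              Eval g (y ∷ w ∷ xs) z → Eval (prec f g) (suc y ∷ xs) z
    ev-mu   : ∀ {k} {f : Code (suc k)} {xs y} →
              Eval f (y ∷ xs) 0 →
              (∀ z → z < y → Σ ℕ λ w → Eval f (z ∷ xs) (suc w)) →
              Eval (mu f) xs y

  data EvalAll : ∀ {m k} → Vec (Code k) m → Vec ℕ k → Vec ℕ m → Set where
    []  : ∀ {k} {xs : Vec ℕ k} → EvalAll [] xs []
    _∷_ : ∀ {m k} {g : Code k} {gs : Vec (Code k) m} {xs y ys} →
          Eval g xs y → EvalAll gs xs ys → EvalAll (g ∷ gs) xs (y ∷ ys)

DecidesSeededTiling : Code 1 → Set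
DecidesSeededTiling c =
  ∀ (I : Instance) → Σ ℕ λ b → Eval c (encode I ∷ []) b × (Tileable I ⇔ (b ≡ 1))

{-# OPTIONS --safe #-}

-- An element of L is a binary tape (the lamps) with a head, and the generators move the head while keeping or
-- flipping the lamp it crosses, so the run of a machine on this tape is a walk in L. A tile carries the set of
-- machine states that visit its element and the lamp about to be crossed. That lamp can be forced locally: let q
-- count modulo 3 the lit lamps below the head. The two upper neighbours of g carry q(g) and q(g) + 1 in the order given
-- by the lamp, and since the pair {q, q + 1} determines q, induction on the distance shows that q(g) does not change
-- when a lamp above the head is flipped. With the symmetric count from above, the label read at g can depend
-- only on the crossed lamp, and the rays a^n from the seed, where it must be off, fix its value.
--
-- A counter on b^0, b^1, … , b^D writes the input D in unary, and D itself codes the table of base tiles; so the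
-- code of the D-th instance is a primitive recursive function of D alone. Given a decision procedure c, take the
-- machine that applies c to the code of the D-th instance, stops (which no tile allows) if the answer is 1
-- and otherwise moves back and forth forever, and let D code its own tiles. If the answer is 1, a tiling
-- would follow the walk to its forbidden end; otherwise the walk visits finitely many elements, which
-- yields a tiling. No universal machine is needed.

module Submission where

open import Defs
open import Data.Nat as ℕ using (ℕ; zero; suc; pred; _+_; _*_; _∸_; _^_; _≤_; _<_; z≤n; s≤s; _<ᵇ_; _≡ᵇ_; NonZero)
open import Data.Nat.DivMod using (_/_; _%_; m≡m%n+[m/n]*n; m%n<n; [m+kn]%n≡m%n; m<n⇒m%n≡m; +-distrib-/-∣ʳ; m<n⇒m/n≡0; m*n/n≡m)
open import Data.Integer as ℤ using (ℤ; +_; -[1+_])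
open import Data.Bool using (Bool; true; false; not; if_then_else_; _xor_; _∧_)
open import Data.Fin as Fin using (Fin; zero; suc; toℕ; fromℕ<; _↑ˡ_; _↑ʳ_; splitAt)
open import Data.List as List using (List; []; _∷_; _++_; map; concatMap; allFin; tabulate)
open import Data.Vec as Vec using (Vec; []; _∷_)
open import Data.Maybe as Maybe using (Maybe; just; nothing)
open import Data.Product using (Σ; ∃; _×_; _,_; proj₁; proj₂)
open import Data.Sum using (_⊎_; inj₁; inj₂)
open import Data.Empty using (⊥; ⊥-elim)
open import Data.Unit using (⊤; tt)
open import Relation.Nullary using (Dec; yes; no; does; ¬_)
open import Relation.Nullary.Decidable using (_×-dec_; _→-dec_; dec-true; dec-false; does-⇔)
open import Relation.Binary.PropositionalEquality using (_≡_; _≢_; refl; sym; trans; cong; cong₂; subst; subst₂; module ≡-Reasoning)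
open import Function using (_∘_; id; case_of_)
open import Function.Bundles using (_⇔_; mk⇔; module Equivalence)
import Data.Nat.Properties as ℕₚ
import Data.Integer.Properties as ℤₚ
import Data.Bool.Properties as Boolₚ
import Data.Fin.Properties as Finₚ
import Data.List.Properties as Listₚ
open import Data.List.Relation.Unary.All as All using (All; all?; []; _∷_)
open import Data.List.Relation.Unary.Any as Any using (Any; here; there)
open import Data.List.Relation.Unary.Any.Properties using (++⁺ʳ; ++⁻)
open import Data.List.Membership.DecPropositional ℤ._≟_ using (_∈?_)
open import Data.List.Membership.Propositional.Properties using (∈-++⁺ˡ; ∈-++⁺ʳ)
open import Data.List.Membership.Propositional using (_∈_)
open import Relation.Binary.Definitions using (tri<; tri≈; tri>)
import Data.Nat.Divisibility as ℕ∣
open import Data.Nat.Tactic.RingSolver using (solve-∀)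
open import Data.Vec.Properties using (tabulate∘lookup)
open import Algebra.Bundles using (AbelianGroup)
open import Algebra.Properties.Group (AbelianGroup.group ℤₚ.+-0-abelianGroup) using (∙-cancelˡ)

-- The walk may visit one element in several states, so a tile stores a set of states. The rules
-- only ask that each state lead to its successor. A tiling may thus contain more states than the
-- walk, which is harmless: the forbidden halt has to follow only from the state forced at b^D.
-- Conversely, a tiling must be an explicit function respecting equality in L, so it must be
-- decidable whether an element is visited in a given state. This is why the walk that does not halt
-- ends by shuttling between two elements: its visits then form a finite list. Self-reference costs
-- nothing because the walker is built from the decision procedure alone and meets D only as input.
-- Its table is known before D is chosen as a number with this table in its bits. The seed must be
-- computable from D without inspecting the table, so it is base tile 0, which carries no state. The
-- walk therefore has to avoid the identity, and this is ensured by keeping some lamp lit at every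
-- moment.

at : Elem → Bool
at g = lamp (lamps g) (pos g)

flipAt : ℤ → Elem → Elem
flipAt k g = ⟨ k ∷ lamps g , pos g ⟩

infixl 7 _▸_
_▸_ : Elem → Gen → Elem
g ▸ s = g · gen s

toggleIf : Bool → Bool → Bool
toggleIf d b = if d then not b else b

-- Lamps, equality in L and the action of the generators

lamp-∷-≡ : ∀ k xs → lamp (k ∷ xs) k ≡ not (lamp xs k)
lamp-∷-≡ k xs rewrite dec-true (k ℤ.≟ k) refl = refl

lamp-∷-≢ : ∀ {x k} xs → x ≢ k → lamp (x ∷ xs) k ≡ lamp xs k
lamp-∷-≢ {x} {k} xs x≢k rewrite dec-false (x ℤ.≟ k) x≢k = refl

toggleIf-xor : ∀ d b c → toggleIf d (b xor c) ≡ toggleIf d b xor c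
toggleIf-xor true true c = Boolₚ.not-involutive c
toggleIf-xor true false c = refl
toggleIf-xor false b c = refl

lamp-++ : ∀ xs ys k → lamp (xs ++ ys) k ≡ lamp xs k xor lamp ys k
lamp-++ [] ys k = refl
lamp-++ (x ∷ xs) ys k =
  trans (cong (toggleIf (does (x ℤ.≟ k))) (lamp-++ xs ys k))
        (toggleIf-xor (does (x ℤ.≟ k)) (lamp xs k) (lamp ys k))

lamp-∷ʳ : ∀ xs x k → lamp (xs ++ x ∷ []) k ≡ lamp (x ∷ xs) k
lamp-∷ʳ xs x k = trans (lamp-++ xs (x ∷ []) k) (helper (does (x ℤ.≟ k)))
  where
  helper : ∀ d → lamp xs k xor toggleIf d false ≡ toggleIf d (lamp xs k)
  helper true = Boolₚ.xor-comm (lamp xs k) true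
  helper false = Boolₚ.xor-identityʳ _

lamp-∷-∷ : ∀ x xs k → lamp (x ∷ x ∷ xs) k ≡ lamp xs k
lamp-∷-∷ x xs k with does (x ℤ.≟ k)
... | true  = Boolₚ.not-involutive _
... | false = refl

lamp-∷-cong : ∀ x {xs ys} → (∀ k → lamp xs k ≡ lamp ys k) → ∀ k → lamp (x ∷ xs) k ≡ lamp (x ∷ ys) k
lamp-∷-cong x eq k = cong (toggleIf (does (x ℤ.≟ k))) (eq k)

infix 4 _≋_
-- A record copy of _≈_, from which Agda can infer the two elements.
record _≋_ (g h : Elem) : Set where
  constructor _&_
  field
    pos≡  : pos g ≡ pos h
    lamp≡ : ∀ k → lamp (lamps g) k ≡ lamp (lamps h) k
open _≋_ public

≋⇒≈ : ∀ {g h} → g ≋ h → g ≈ h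
≋⇒≈ (p & l) = p , l

≋-refl : ∀ {g} → g ≋ g
≋-refl = refl & λ _ → refl

≋-sym : ∀ {g h} → g ≋ h → h ≋ g
≋-sym (p & l) = sym p & λ k → sym (l k)

≋-trans : ∀ {g h i} → g ≋ h → h ≋ i → g ≋ i
≋-trans (p & l) (p′ & l′) = trans p p′ & λ k → trans (l k) (l′ k)

up down : ℤ → ℤ
up n = n ℤ.+ + 1
down n = n ℤ.+ -[1+ 0 ]

down-up : ∀ n → down (up n) ≡ n
down-up n = trans (ℤₚ.+-assoc n (+ 1) -[1+ 0 ]) (ℤₚ.+-identityʳ n)

up-down : ∀ n → up (down n) ≡ n
up-down n = trans (ℤₚ.+-assoc n -[1+ 0 ] (+ 1)) (ℤₚ.+-identityʳ n)

cancel-middle : ∀ n x → x ℤ.+ (n ℤ.- x) ≡ n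
cancel-middle n x = trans (ℤₚ.+-comm x (n ℤ.- x))
  (trans (ℤₚ.+-assoc n (ℤ.- x) x) (trans (cong (λ z → n ℤ.+ z) (ℤₚ.+-inverseˡ x)) (ℤₚ.+-identityʳ n)))

a⁺≋ : ∀ g → g ▸ a⁺ ≋ ⟨ lamps g , up (pos g) ⟩
a⁺≋ g = refl & λ k → cong (λ xs → lamp xs k) (Listₚ.++-identityʳ (lamps g))

a⁻≋ : ∀ g → g ▸ a⁻ ≋ ⟨ lamps g , down (pos g) ⟩
a⁻≋ g = refl & λ k → cong (λ xs → lamp xs k) (Listₚ.++-identityʳ (lamps g))

b⁺≋ : ∀ g → g ▸ b⁺ ≋ ⟨ pos g ∷ lamps g , up (pos g) ⟩
b⁺≋ g = refl & λ k →
  trans (cong (λ m → lamp (lamps g ++ m ∷ []) k) (ℤₚ.+-identityʳ (pos g))) (lamp-∷ʳ (lamps g) (pos g) k)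

b⁻≋ : ∀ g → g ▸ b⁻ ≋ ⟨ down (pos g) ∷ lamps g , down (pos g) ⟩
b⁻≋ g = refl & λ k → lamp-∷ʳ (lamps g) (down (pos g)) k

▸-cong : ∀ s {g h} → g ≋ h → g ▸ s ≋ h ▸ s
▸-cong a⁺ {g} {h} (p & l) = ≋-trans (a⁺≋ g) (≋-trans (cong up p & l) (≋-sym (a⁺≋ h)))
▸-cong a⁻ {g} {h} (p & l) = ≋-trans (a⁻≋ g) (≋-trans (cong down p & l) (≋-sym (a⁻≋ h)))
▸-cong b⁺ {g@(⟨ xs , n ⟩)} {h@(⟨ ys , .n ⟩)} (refl & l) =
  ≋-trans (b⁺≋ g) (≋-trans (refl & lamp-∷-cong n {xs} {ys} l) (≋-sym (b⁺≋ h)))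
▸-cong b⁻ {g@(⟨ xs , n ⟩)} {h@(⟨ ys , .n ⟩)} (refl & l) =
  ≋-trans (b⁻≋ g) (≋-trans (refl & lamp-∷-cong (down n) {xs} {ys} l) (≋-sym (b⁻≋ h)))

at-cong : ∀ {g h} → g ≋ h → at g ≡ at h
at-cong {⟨ xs , n ⟩} {⟨ ys , .n ⟩} (refl & l) = l n

a⁺a⁻ : ∀ g → g ▸ a⁺ ▸ a⁻ ≋ g
a⁺a⁻ g = ≋-trans (▸-cong a⁻ {g ▸ a⁺} (a⁺≋ g)) (≋-trans (a⁻≋ ⟨ lamps g , up (pos g) ⟩) (down-up (pos g) & λ _ → refl))

a⁻a⁺ : ∀ g → g ▸ a⁻ ▸ a⁺ ≋ g
a⁻a⁺ g = ≋-trans (▸-cong a⁺ {g ▸ a⁻} (a⁻≋ g)) (≋-trans (a⁺≋ ⟨ lamps g , down (pos g) ⟩) (up-down (pos g) & λ _ → refl))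

b⁻b⁺ : ∀ g → g ▸ b⁻ ▸ b⁺ ≋ g
b⁻b⁺ g = ≋-trans (▸-cong b⁺ {g ▸ b⁻} (b⁻≋ g))
  (≋-trans (b⁺≋ ⟨ down (pos g) ∷ lamps g , down (pos g) ⟩) (up-down (pos g) & lamp-∷-∷ (down (pos g)) (lamps g)))

flip-a⁺ : ∀ g → flipAt (pos g) g ▸ a⁺ ≋ g ▸ b⁺
flip-a⁺ g = ≋-trans (a⁺≋ (flipAt (pos g) g)) (≋-sym (b⁺≋ g))

flip-b⁺ : ∀ g → flipAt (pos g) g ▸ b⁺ ≋ g ▸ a⁺
flip-b⁺ g = ≋-trans (b⁺≋ (flipAt (pos g) g)) (≋-trans (refl & lamp-∷-∷ (pos g) (lamps g)) (≋-sym (a⁺≋ g)))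

flip-a⁻ : ∀ g → flipAt (down (pos g)) g ▸ a⁻ ≋ g ▸ b⁻
flip-a⁻ g = ≋-trans (a⁻≋ (flipAt (down (pos g)) g)) (≋-sym (b⁻≋ g))

flip-b⁻ : ∀ g → flipAt (down (pos g)) g ▸ b⁻ ≋ g ▸ a⁻
flip-b⁻ g = ≋-trans (b⁻≋ (flipAt (down (pos g)) g)) (≋-trans (refl & lamp-∷-∷ (down (pos g)) (lamps g)) (≋-sym (a⁻≋ g)))

-- Local rules that force the label of the crossed lamp

next : Fin 3 → Fin 3
next zero = suc zero
next (suc zero) = suc (suc zero)
next (suc (suc zero)) = zero

infixl 6 _⊕_
_⊕_ : Fin 3 → Bool → Fin 3
q ⊕ b = if b then next q else q

next-next-≢ : ∀ {x} → x ≢ next (next x)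
next-next-≢ {suc (suc zero)} ()

-- The unordered pair {q, q + 1} determines q modulo 3.
⊕-injective : ∀ {q q′} r r′ → q ⊕ r ≡ q′ ⊕ r′ → q ⊕ not r ≡ q′ ⊕ not r′ → q ≡ q′ × r ≡ r′
⊕-injective false false e e′ = e , refl
⊕-injective true true e e′ = e′ , refl
⊕-injective {q} {q′} false true e e′ = ⊥-elim (next-next-≢ (trans (sym e′) (cong next e)))
⊕-injective {q} {q′} true false e e′ = ⊥-elim (next-next-≢ (trans e′ (cong next (sym e))))

-- Here `q` stands for the count below the head, `p` for the count above it and `r` for the crossed
-- lamp. Crossing along b leaves the flipped lamp below, whence `not (r g)` in `qb`. In `pb` the
-- lamp is counted at `g`, before the flip, whence `r g` itself.
module Reading
  (q p : Elem → Fin 3) (r : Elem → Bool)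
  (q-cong : ∀ {g h} → g ≋ h → q g ≡ q h)
  (p-cong : ∀ {g h} → g ≋ h → p g ≡ p h)
  (r-cong : ∀ {g h} → g ≋ h → r g ≡ r h)
  (qa : ∀ g → q (g ▸ a⁺) ≡ q g ⊕ r g)
  (qb : ∀ g → q (g ▸ b⁺) ≡ q g ⊕ not (r g))
  (pa : ∀ g → p g ≡ p (g ▸ a⁺) ⊕ r g)
  (pb : ∀ g → p g ≡ p (g ▸ b⁺) ⊕ r g)
  where

  -- Flipping the crossed lamp exchanges the two upper neighbours and so keeps the unordered pair of
  -- their `q`-values.
  flip-here : ∀ g → q (flipAt (pos g) g) ≡ q g × r (flipAt (pos g) g) ≡ not (r g)
  flip-here g = ⊕-injective (r g′) (not (r g))
      (trans (sym (qa g′)) (trans (q-cong (flip-a⁺ g)) (qb g)))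
      (trans (sym (qb g′)) (trans (q-cong (flip-b⁺ g)) (trans (qa g) (cong (q g ⊕_) (sym (Boolₚ.not-involutive (r g)))))))
    where g′ = flipAt (pos g) g

  -- Both upper neighbours are one step closer to the flipped lamp. If `q` is unchanged at both of
  -- them, so is the ordered pair, which fixes `q` and `r` at `g`.
  flip-above-q : ∀ d g k → k ≡ pos g ℤ.+ + d → q (flipAt k g) ≡ q g
  flip-above : ∀ d g k → k ≡ pos g ℤ.+ + suc d → q (flipAt k g) ≡ q g × r (flipAt k g) ≡ r g
  flip-above-q zero g k e rewrite trans e (ℤₚ.+-identityʳ (pos g)) = proj₁ (flip-here g)
  flip-above-q (suc d) g k e = proj₁ (flip-above d g k e)
  flip-above d g k e = ⊕-injective (r (flipAt k g)) (r g)
      (trans (sym (qa (flipAt k g))) (trans (flip-above-q d (g ▸ a⁺) k e′) (qa g)))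
      (trans (sym (qb (flipAt k g))) (trans (flip-above-q d (g ▸ b⁺) k e′) (qb g)))
    where e′ = trans e (sym (ℤₚ.+-assoc (pos g) (+ 1) (+ d)))

  pa⁻ : ∀ h → p (h ▸ a⁻) ≡ p h ⊕ r (h ▸ a⁻)
  pa⁻ h = trans (pa (h ▸ a⁻)) (cong (_⊕ r (h ▸ a⁻)) (p-cong (a⁻a⁺ h)))

  -- The rules for `p` on the two edges below `h` involve `r` at two different elements. This
  -- expresses both through the single label at `h ▸ a⁻`, so that the argument for `q` can be
  -- mirrored.
  sibling : ∀ h → r (h ▸ b⁻) ≡ not (r (h ▸ a⁻))
  sibling h = trans (r-cong {h ▸ b⁻} (≋-trans (b⁻≋ h) (refl & lamp-∷-cong (down (pos h)) {lamps h} {lamps (h ▸ a⁻)} (λ k → sym (lamp≡ (a⁻≋ h) k)))))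
                    (proj₂ (flip-here (h ▸ a⁻)))

  pb⁻ : ∀ h → p (h ▸ b⁻) ≡ p h ⊕ not (r (h ▸ a⁻))
  pb⁻ h = trans (pb (h ▸ b⁻)) (cong₂ _⊕_ (p-cong (b⁻b⁺ h)) (sibling h))

  flip-below-p : ∀ d h k → pos h ≡ k ℤ.+ + suc d → p (flipAt k h) ≡ p h
  flip-below : ∀ d h k → pos h ≡ k ℤ.+ + suc (suc d) →
               p (flipAt k h) ≡ p h × r (flipAt k h ▸ a⁻) ≡ r (h ▸ a⁻)
  flip-below-p zero h k e = proj₁ (⊕-injective (r (h′ ▸ a⁻)) (not (r (h ▸ a⁻)))
      (trans (sym (pa⁻ h′)) (trans (p-cong left) (pb⁻ h)))
      (trans (sym (pb⁻ h′)) (trans (p-cong right)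
        (trans (pa⁻ h) (cong (p h ⊕_) (sym (Boolₚ.not-involutive (r (h ▸ a⁻)))))))))
    where
    h′ = flipAt k h
    k≡ : down (pos h) ≡ k
    k≡ = trans (cong down e) (down-up k)
    left : h′ ▸ a⁻ ≋ h ▸ b⁻
    left = subst (λ j → flipAt j h ▸ a⁻ ≋ h ▸ b⁻) k≡ (flip-a⁻ h)
    right : h′ ▸ b⁻ ≋ h ▸ a⁻
    right = subst (λ j → flipAt j h ▸ b⁻ ≋ h ▸ a⁻) k≡ (flip-b⁻ h)
  flip-below-p (suc d) h k e = proj₁ (flip-below d h k e)
  flip-below d h k e = ⊕-injective (r (h′ ▸ a⁻)) (r (h ▸ a⁻))
      (trans (sym (pa⁻ h′)) (trans (flip-below-p d (h ▸ a⁻) k e′) (pa⁻ h)))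
      (trans (sym (pb⁻ h′)) (trans (flip-below-p d (h ▸ b⁻) k e′) (pb⁻ h)))
    where
    h′ = flipAt k h
    e′ : down (pos h) ≡ k ℤ.+ + suc d
    e′ = trans (cong down e) (ℤₚ.+-assoc k (+ suc (suc d)) -[1+ 0 ])

  private
    trichotomy : ∀ k n → (k ≡ n) ⊎ (∃ λ d → k ≡ n ℤ.+ + suc d) ⊎ (∃ λ d → n ≡ k ℤ.+ + suc d)
    trichotomy k n = go (k ℤ.- n) refl
      where
      go : ∀ z → k ℤ.- n ≡ z → (k ≡ n) ⊎ (∃ λ d → k ≡ n ℤ.+ + suc d) ⊎ (∃ λ d → n ≡ k ℤ.+ + suc d)
      go (+ zero) e = inj₁ (trans (sym (cancel-middle k n)) (trans (cong (λ z → n ℤ.+ z) e) (ℤₚ.+-identityʳ n)))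
      go (+ suc d) e = inj₂ (inj₁ (d , trans (sym (cancel-middle k n)) (cong (λ z → n ℤ.+ z) e)))
      go -[1+ d ] e = inj₂ (inj₂ (d , trans (sym (cancel-middle n k)) (cong (λ z → k ℤ.+ z)
        (trans (sym (ℤₚ.neg-involutive (n ℤ.- k))) (cong ℤ.-_ (trans (neg-flip n k) e))))))
        where
        neg-flip : ∀ i j → ℤ.- (i ℤ.- j) ≡ j ℤ.- i
        neg-flip i j = trans (ℤₚ.neg-distrib-+ i (ℤ.- j))
          (trans (cong (λ z → ℤ.- i ℤ.+ z) (ℤₚ.neg-involutive j)) (ℤₚ.+-comm (ℤ.- i) j))

    i<i+suc : ∀ i d → i ≢ i ℤ.+ + suc d
    i<i+suc i d e with trans (sym (ℤₚ.+-inverseʳ i)) (trans (cong (λ z → z ℤ.- i) e)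
        (trans (cong (λ z → z ℤ.- i) (ℤₚ.+-comm i (+ suc d))) (trans (ℤₚ.+-assoc (+ suc d) i (ℤ.- i))
          (trans (cong (λ z → + suc d ℤ.+ z) (ℤₚ.+-inverseʳ i)) (ℤₚ.+-identityʳ (+ suc d))))))
    ... | ()

  r-flip : ∀ k g → r (flipAt k g) ≡ toggleIf (does (k ℤ.≟ pos g)) (r g)
  r-flip k g with trichotomy k (pos g)
  ... | inj₁ refl rewrite dec-true (pos g ℤ.≟ pos g) refl = proj₂ (flip-here g)
  ... | inj₂ (inj₁ (d , e))
    rewrite dec-false (k ℤ.≟ pos g) (λ k≡ → i<i+suc (pos g) d (trans (sym k≡) e)) = proj₂ (flip-above d g k e)
  ... | inj₂ (inj₂ (d , e))
    rewrite dec-false (k ℤ.≟ pos g) (λ k≡ → i<i+suc k d (trans k≡ e)) =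
      -- `flip-below` speaks of `r` one step below its element, so it is applied to `g ▸ a⁺`, at a
      -- distance larger by one.
      trans (sym (r-cong (a⁺a⁻ (flipAt k g)))) (trans (proj₂ (flip-below d (g ▸ a⁺) k e′)) (r-cong (a⁺a⁻ g)))
    where
    e′ : up (pos g) ≡ k ℤ.+ + suc (suc d)
    e′ = trans (cong up e) (trans (ℤₚ.+-assoc k (+ suc d) (+ 1)) (cong (λ m → k ℤ.+ + m) (ℕₚ.+-comm (suc d) 1)))

  -- Every representative arises from a power of a, where the label is known, by flipping the listed
  -- lamps one at a time.
  reading : (∀ n → r ⟨ [] , n ⟩ ≡ false) → ∀ xs n → r ⟨ xs , n ⟩ ≡ lamp xs n
  reading base [] n = base n
  reading base (x ∷ xs) n = trans (r-flip x ⟨ xs , n ⟩) (cong (toggleIf (does (x ℤ.≟ n))) (reading base xs n))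

-- Actual counts of lit lamps satisfy the local rules

signed : Bool → Fin 3 → Fin 3
signed b q = if b then next (next q) else next q

-- Counts the lit lamps below n modulo 3: an entry that switches a lamp off again counts as −1.
below : ℤ → List ℤ → Fin 3
below n [] = zero
below n (x ∷ xs) = if does (x ℤ.<? n) then signed (lamp xs x) (below n xs) else below n xs

above : ℤ → List ℤ → Fin 3
above n [] = zero
above n (x ∷ xs) = if does (x ℤ.<? n) then above n xs else signed (lamp xs x) (above n xs)

next³ : ∀ q → next (next (next q)) ≡ q
next³ zero = refl
next³ (suc zero) = refl
next³ (suc (suc zero)) = refl

signed-⊕ : ∀ b c q → signed b (q ⊕ c) ≡ signed b q ⊕ c
signed-⊕ false false q = refl
signed-⊕ false true q = refl
signed-⊕ true false q = refl
signed-⊕ true true q = refl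

-- The case of a new list entry at the crossed position: it turns the lamp from `b` into `not b`. If
-- the lamp was lit, the counts are q + 1 - 1, which is three applications of `next`.
signed-⊕-self : ∀ b q → signed b (q ⊕ b) ≡ q ⊕ not b
signed-⊕-self false q = refl
signed-⊕-self true q = next³ q

n<up-n : ∀ n → n ℤ.< up n
n<up-n n = subst (ℤ._< up n) (ℤₚ.+-identityʳ n) (ℤₚ.+-monoʳ-< n (ℤ.+<+ (s≤s z≤n)))

<up⇒≤ : ∀ {x n} → x ℤ.< up n → x ℤ.≤ n
<up⇒≤ {x} {n} lt = subst₂ ℤ._≤_ (ℤₚ.pred-suc x) (trans (cong ℤ.pred (ℤₚ.+-comm n (+ 1))) (ℤₚ.pred-suc n)) (ℤₚ.pred-mono (ℤₚ.i<j⇒suc[i]≤j lt))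

below-up : ∀ n xs → below (up n) xs ≡ below n xs ⊕ lamp xs n
below-up n [] = refl
below-up n (x ∷ xs) with ℤₚ.<-cmp x n
... | tri< x<n x≢n _
  rewrite dec-true (x ℤ.<? n) x<n | dec-true (x ℤ.<? up n) (ℤₚ.<-trans x<n (n<up-n n)) | dec-false (x ℤ.≟ n) x≢n
  = trans (cong (signed (lamp xs x)) (below-up n xs)) (signed-⊕ (lamp xs x) (lamp xs n) (below n xs))
... | tri≈ n≮n refl _
  rewrite dec-false (x ℤ.<? x) n≮n | dec-true (x ℤ.<? up x) (n<up-n x) | dec-true (x ℤ.≟ x) refl
  = trans (cong (signed (lamp xs x)) (below-up x xs)) (signed-⊕-self (lamp xs x) (below x xs))
... | tri> x≮n x≢n n<x
  rewrite dec-false (x ℤ.<? n) x≮n | dec-false (x ℤ.<? up n) (λ lt → ℤₚ.<⇒≱ n<x (<up⇒≤ lt)) | dec-false (x ℤ.≟ n) x≢n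
  = below-up n xs

above-up : ∀ n xs → above n xs ≡ above (up n) xs ⊕ lamp xs n
above-up n [] = refl
above-up n (x ∷ xs) with ℤₚ.<-cmp x n
... | tri< x<n x≢n _
  rewrite dec-true (x ℤ.<? n) x<n | dec-true (x ℤ.<? up n) (ℤₚ.<-trans x<n (n<up-n n)) | dec-false (x ℤ.≟ n) x≢n
  = above-up n xs
... | tri≈ n≮n refl _
  rewrite dec-false (x ℤ.<? x) n≮n | dec-true (x ℤ.<? up x) (n<up-n x) | dec-true (x ℤ.≟ x) refl
  = trans (cong (signed (lamp xs x)) (above-up x xs)) (signed-⊕-self (lamp xs x) (above (up x) xs))
... | tri> x≮n x≢n n<x
  rewrite dec-false (x ℤ.<? n) x≮n | dec-false (x ℤ.<? up n) (λ lt → ℤₚ.<⇒≱ n<x (<up⇒≤ lt)) | dec-false (x ℤ.≟ n) x≢n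
  = trans (cong (signed (lamp xs x)) (above-up n xs)) (signed-⊕ (lamp xs x) (lamp xs n) (above (up n) xs))

i≤+∣i∣ : ∀ i → i ℤ.≤ + ℤ.∣ i ∣
i≤+∣i∣ (+ n) = ℤₚ.≤-refl
i≤+∣i∣ -[1+ n ] = ℤ.-≤+

step-down : ∀ n i → n ℤ.- + suc i ≡ down (n ℤ.- + i)
step-down n i = trans (cong (λ z → n ℤ.+ z) (trans (cong (λ m → ℤ.- (+ m)) (ℕₚ.+-comm 1 i)) (ℤₚ.neg-distrib-+ (+ i) (+ 1))))
  (sym (ℤₚ.+-assoc n (ℤ.- + i) -[1+ 0 ]))

step-up : ∀ n i → n ℤ.+ + suc i ≡ up (n ℤ.+ + i)
step-up n i = trans (cong (λ m → n ℤ.+ + m) (ℕₚ.+-comm 1 i)) (sym (ℤₚ.+-assoc n (+ i) (+ 1)))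

below-far : ∀ n xs → ∃ λ B → ∀ i → B ≤ i → below (n ℤ.- + i) xs ≡ zero
below-far n [] = 0 , λ _ _ → refl
below-far n (x ∷ xs) = ℤ.∣ n ℤ.- x ∣ + B , λ i le → trans
    (cong (λ b → if b then signed (lamp xs x) (below (n ℤ.- + i) xs) else below (n ℤ.- + i) xs)
      (dec-false (x ℤ.<? (n ℤ.- + i)) (ℤₚ.≤⇒≯ (far i (ℕₚ.≤-trans (ℕₚ.m≤m+n _ B) le)))))
    (eq i (ℕₚ.≤-trans (ℕₚ.m≤n+m B _) le))
  where
  B = proj₁ (below-far n xs)
  eq = proj₂ (below-far n xs)
  far : ∀ i → ℤ.∣ n ℤ.- x ∣ ≤ i → n ℤ.- + i ℤ.≤ x
  far i le = subst₂ ℤ._≤_ (cong (ℤ._- + i) (cancel-middle n x))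
      (trans (ℤₚ.+-assoc x (+ i) (ℤ.- + i)) (trans (cong (λ z → x ℤ.+ z) (ℤₚ.+-inverseʳ (+ i))) (ℤₚ.+-identityʳ x)))
      (ℤₚ.+-monoˡ-≤ (ℤ.- + i) (ℤₚ.+-monoʳ-≤ x (ℤₚ.≤-trans (i≤+∣i∣ (n ℤ.- x)) (ℤ.+≤+ le))))

above-far : ∀ n xs → ∃ λ B → ∀ i → B ≤ i → above (n ℤ.+ + i) xs ≡ zero
above-far n [] = 0 , λ _ _ → refl
above-far n (x ∷ xs) = suc ℤ.∣ x ℤ.- n ∣ + B , λ i le → trans
    (cong (λ b → if b then above (n ℤ.+ + i) xs else signed (lamp xs x) (above (n ℤ.+ + i) xs))
      (dec-true (x ℤ.<? (n ℤ.+ + i)) (far i (ℕₚ.≤-trans (ℕₚ.m≤m+n _ B) le))))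
    (eq i (ℕₚ.≤-trans (ℕₚ.m≤n+m B _) le))
  where
  B = proj₁ (above-far n xs)
  eq = proj₂ (above-far n xs)
  far : ∀ i → suc ℤ.∣ x ℤ.- n ∣ ≤ i → x ℤ.< n ℤ.+ + i
  far i le = subst (ℤ._< n ℤ.+ + i) (cancel-middle x n)
      (ℤₚ.+-monoʳ-< n (ℤₚ.≤-<-trans (i≤+∣i∣ (x ℤ.- n)) (ℤ.+<+ le)))

-- The recursion on the list does not show that only the lamps matter. Far enough to the left both
-- counts vanish, and `below-up` carries their equality up to `n` by means of the lamps alone.
below-cong : ∀ n {xs ys} → (∀ k → lamp xs k ≡ lamp ys k) → below n xs ≡ below n ys
below-cong n {xs} {ys} eq = subst (λ m → below m xs ≡ below m ys) (ℤₚ.+-identityʳ n) (climb (B + B′) 0 (ℕₚ.+-identityʳ (B + B′)))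
  where
  B = proj₁ (below-far n xs)
  B′ = proj₁ (below-far n ys)
  climb : ∀ d i → d + i ≡ B + B′ → below (n ℤ.- + i) xs ≡ below (n ℤ.- + i) ys
  climb zero i refl = trans (proj₂ (below-far n xs) i (ℕₚ.m≤m+n B B′)) (sym (proj₂ (below-far n ys) i (ℕₚ.m≤n+m B′ B)))
  climb (suc d) i e = subst (λ m → below m xs ≡ below m ys) (trans (cong up (step-down n i)) (up-down _))
    (trans (below-up _ xs) (trans (cong₂ _⊕_ (climb d (suc i) (trans (ℕₚ.+-suc d i) e)) (eq _)) (sym (below-up _ ys))))

above-cong : ∀ n {xs ys} → (∀ k → lamp xs k ≡ lamp ys k) → above n xs ≡ above n ys
above-cong n {xs} {ys} eq = subst (λ m → above m xs ≡ above m ys) (ℤₚ.+-identityʳ n) (descend (B + B′) 0 (ℕₚ.+-identityʳ (B + B′)))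
  where
  B = proj₁ (above-far n xs)
  B′ = proj₁ (above-far n ys)
  descend : ∀ d i → d + i ≡ B + B′ → above (n ℤ.+ + i) xs ≡ above (n ℤ.+ + i) ys
  descend zero i refl = trans (proj₂ (above-far n xs) i (ℕₚ.m≤m+n B B′)) (sym (proj₂ (above-far n ys) i (ℕₚ.m≤n+m B′ B)))
  descend (suc d) i e = trans (above-up _ xs) (trans (cong₂ _⊕_
      (subst (λ m → above m xs ≡ above m ys) (step-up n i) (descend d (suc i) (trans (ℕₚ.+-suc d i) e))) (eq _))
    (sym (above-up _ ys)))

-- Decidable equality of group elements

lamp-support : ∀ xs k → (∀ x → x ∈ xs → x ≢ k) → lamp xs k ≡ false
lamp-support [] k _ = refl
lamp-support (x ∷ xs) k away = trans (lamp-∷-≢ xs (away x (here refl))) (lamp-support xs k (λ y y∈ → away y (there y∈)))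

infix 4 _≋?_
-- Outside the listed positions both configurations are dark, so finitely many comparisons suffice.
_≋?_ : ∀ g h → Dec (g ≋ h)
⟨ xs , m ⟩ ≋? ⟨ ys , n ⟩ with m ℤ.≟ n | all? (λ k → lamp xs k Boolₚ.≟ lamp ys k) (xs ++ ys)
... | no m≢n | _ = no λ e → m≢n (pos≡ e)
... | yes _ | no ¬all = no λ e → ¬all (All.universal (lamp≡ e) (xs ++ ys))
... | yes m≡n | yes agree = yes (m≡n & λ k → agree-everywhere k)
  where
  agree-everywhere : ∀ k → lamp xs k ≡ lamp ys k
  agree-everywhere k with k ∈? (xs ++ ys)
  ... | yes k∈ = All.lookup agree k∈
  ... | no k∉ = trans (lamp-support xs k (λ { x x∈ refl → k∉ (∈-++⁺ˡ x∈) }))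
                      (sym (lamp-support ys k (λ { x x∈ refl → k∉ (∈-++⁺ʳ xs x∈) })))

-- Walkers on the lamplighter group

infixr 5 _⨾_
data Walker : Set where
  right left flipRight spin : Walker
  _⨾_   : Walker → Walker → Walker
  while : Walker → Walker

-- Every transition moves the walker, so a test needs a detour: `while` steps up and comes back in
-- one of two states that remember the lamp. These make up the 3.
size′ : Walker → ℕ
size′ right = 1
size′ left = 1
size′ flipRight = 1
size′ spin = 2
size′ (v ⨾ w) = size′ v + size′ w
size′ (while w) = 3 + size′ w

entry : ∀ w → Fin (size′ w)
entry right = zero
entry left = zero
entry flipRight = zero
entry spin = zero
entry (v ⨾ w) = entry v ↑ˡ size′ w
entry (while w) = zero

-- The Boolean is the lamp just above the walker; the target nothing means that the walker has finished.
move : ∀ w → Fin (size′ w) → Bool → Gen × Maybe (Fin (size′ w))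
move right _ _ = a⁺ , nothing
move left _ _ = a⁻ , nothing
move flipRight _ _ = b⁺ , nothing
move spin zero _ = a⁺ , just (suc zero)
move spin (suc zero) _ = a⁻ , just zero
move (v ⨾ w) i b with splitAt (size′ v) i
... | inj₁ j = proj₁ (move v j b) , just (Maybe.maybe′ (_↑ˡ size′ w) (size′ v ↑ʳ entry w) (proj₂ (move v j b)))
... | inj₂ j = proj₁ (move w j b) , Maybe.map (size′ v ↑ʳ_) (proj₂ (move w j b))
move (while w) zero b = a⁺ , just (if b then suc zero else suc (suc zero))
move (while w) (suc zero) b = a⁻ , just (3 ↑ʳ entry w)
move (while w) (suc (suc zero)) b = a⁻ , nothing
move (while w) (suc (suc (suc j))) b =
  proj₁ (move w j b) , just (Maybe.maybe′ (3 ↑ʳ_) zero (proj₂ (move w j b)))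

Lit : Elem → Set
Lit g = ∃ λ k → lamp (lamps g) k ≡ true

-- The walks we need never pass a configuration without lit lamps, so they avoid the seed of the tiling.
data Path (w : Walker) : Fin (size′ w) → Elem → Maybe (Fin (size′ w)) → Elem → Set where
  stop : ∀ {i g} → Path w i g (just i) g
  exit : ∀ {i g s} → Lit g → move w i (at g) ≡ (s , nothing) → Path w i g nothing (g ▸ s)
  step : ∀ {i g s j t h} → Lit g → move w i (at g) ≡ (s , just j) → Path w j (g ▸ s) t h → Path w i g t h

infixr 5 _▹▹_
_▹▹_ : ∀ {w i g j h t k} → Path w i g (just j) h → Path w j h t k → Path w i g t k
stop ▹▹ q = q
step l e p ▹▹ q = step l e (p ▹▹ q)

move-⨾ˡ : ∀ v w i b → move (v ⨾ w) (i ↑ˡ size′ w) b ≡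
  (proj₁ (move v i b) , just (Maybe.maybe′ (_↑ˡ size′ w) (size′ v ↑ʳ entry w) (proj₂ (move v i b))))
move-⨾ˡ v w i b rewrite Finₚ.splitAt-↑ˡ (size′ v) i (size′ w) = refl

move-⨾ʳ : ∀ v w i b → move (v ⨾ w) (size′ v ↑ʳ i) b ≡
  (proj₁ (move w i b) , Maybe.map (size′ v ↑ʳ_) (proj₂ (move w i b)))
move-⨾ʳ v w i b rewrite Finₚ.splitAt-↑ʳ (size′ v) (size′ w) i = refl

path-⨾ˡ : ∀ v w {i g t h} → Path v i g t h →
  Path (v ⨾ w) (i ↑ˡ size′ w) g (just (Maybe.maybe′ (_↑ˡ size′ w) (size′ v ↑ʳ entry w) t)) h
path-⨾ˡ v w stop = stop
path-⨾ˡ v w {i} {g} (exit l e) = step l (trans (move-⨾ˡ v w i (at g)) (cong (λ m → proj₁ m , just (Maybe.maybe′ (_↑ˡ size′ w) (size′ v ↑ʳ entry w) (proj₂ m))) e)) stop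
path-⨾ˡ v w {i} {g} (step l e p) = step l (trans (move-⨾ˡ v w i (at g)) (cong (λ m → proj₁ m , just (Maybe.maybe′ (_↑ˡ size′ w) (size′ v ↑ʳ entry w) (proj₂ m))) e)) (path-⨾ˡ v w p)

path-⨾ʳ : ∀ v w {i g t h} → Path w i g t h → Path (v ⨾ w) (size′ v ↑ʳ i) g (Maybe.map (size′ v ↑ʳ_) t) h
path-⨾ʳ v w stop = stop
path-⨾ʳ v w {i} {g} (exit l e) = exit l (trans (move-⨾ʳ v w i (at g)) (cong (λ m → proj₁ m , Maybe.map (size′ v ↑ʳ_) (proj₂ m)) e))
path-⨾ʳ v w {i} {g} (step l e p) = step l (trans (move-⨾ʳ v w i (at g)) (cong (λ m → proj₁ m , Maybe.map (size′ v ↑ʳ_) (proj₂ m)) e)) (path-⨾ʳ v w p)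

path-while : ∀ w {i g t h} → Path w i g t h → Path (while w) (3 ↑ʳ i) g (just (Maybe.maybe′ (3 ↑ʳ_) zero t)) h
path-while w stop = stop
path-while w (exit l e) = step l (cong (λ m → proj₁ m , just (Maybe.maybe′ (3 ↑ʳ_) zero (proj₂ m))) e) stop
path-while w (step l e p) = step l (cong (λ m → proj₁ m , just (Maybe.maybe′ (3 ↑ʳ_) zero (proj₂ m))) e) (path-while w p)

-- Correctness triples for walkers on a tape of lamps

cell : ℤ → ℕ → ℤ
cell o u = o ℤ.+ + u

cell-up : ∀ o u → up (cell o u) ≡ cell o (suc u)
cell-up o u = sym (step-up o u)

cell-down : ∀ o u → down (cell o (suc u)) ≡ cell o u
cell-down o u = trans (cong down (sym (cell-up o u))) (down-up (cell o u))

cell-injective : ∀ o {u v} → cell o u ≡ cell o v → u ≡ v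
cell-injective o e = ℤₚ.+-injective (∙-cancelˡ o _ _ e)

Tape : Set
Tape = ℕ → Bool

toggle : ℕ → Tape → Tape
toggle u T v = toggleIf (does (u ℕ.≟ v)) (T v)

-- No walker can stand still, so the empty repetition is a step and its inverse.
repeat : ℕ → Walker → Walker
repeat zero w = right ⨾ left
repeat (suc n) w = w ⨾ repeat n w

-- The tape cells 0, 1, 2, … are the lamps at o, o + 1, o + 2, …; the lamp at κ stays lit.
module Runs (κ o : ℤ) where

  record Holds (g : Elem) (T : Tape) (u : ℕ) : Set where
    constructor holds
    field
      mark  : lamp (lamps g) κ ≡ true
      head  : pos g ≡ cell o u
      cells : ∀ v → lamp (lamps g) (cell o v) ≡ T v
  open Holds public

  holds-≋ : ∀ {g h T u} → g ≋ h → Holds h T u → Holds g T u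
  holds-≋ (p & l) (holds m e c) = holds (trans (l κ) m) (trans p e) (λ v → trans (l (cell o v)) (c v))

  holds-lit : ∀ {g T u} → Holds g T u → Lit g
  holds-lit h = κ , mark h

  holds-at : ∀ {g T u} → Holds g T u → at g ≡ T u
  holds-at {g} {T} {u} (holds m e c) = trans (cong (lamp (lamps g)) e) (c u)

  infix 3 _,_⟪_⟫_,_
  -- A Hoare triple for total correctness. It leaves the lamps to the left of the tape arbitrary,
  -- apart from the mark.
  record _,_⟪_⟫_,_ (T : Tape) (u : ℕ) (w : Walker) (T′ : Tape) (u′ : ℕ) : Set where
    constructor triple
    field
      run : ∀ {g} → Holds g T u → ∃ λ h → Path w (entry w) g nothing h × Holds h T′ u′
  open _,_⟪_⟫_,_ public

  move-right : ∀ {T g u} → Holds g T u → Holds (g ▸ a⁺) T (suc u)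
  move-right {g = g} {u} (holds m e c) = holds-≋ (a⁺≋ g) (holds m (trans (cong up e) (cell-up o u)) c)

  move-left : ∀ {T g u} → Holds g T (suc u) → Holds (g ▸ a⁻) T u
  move-left {g = g} {u} (holds m e c) = holds-≋ (a⁻≋ g) (holds m (trans (cong down e) (cell-down o u)) c)

  -- This does not mention the mark, because it also describes how the powers of b light the input,
  -- starting from a dark tape.
  flip-cells : ∀ {T g u} → pos g ≡ cell o u → (∀ v → lamp (lamps g) (cell o v) ≡ T v) →
    ∀ v → lamp (lamps (g ▸ b⁺)) (cell o v) ≡ toggle u T v
  flip-cells {T} {g} {u} e c v = trans (lamp≡ (b⁺≋ g) (cell o v))
    (trans (cong (λ n → lamp (n ∷ lamps g) (cell o v)) e) toggled)
    where
    toggled : lamp (cell o u ∷ lamps g) (cell o v) ≡ toggle u T v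
    toggled with u ℕ.≟ v
    ... | yes refl rewrite dec-true (cell o u ℤ.≟ cell o u) refl | dec-true (u ℕ.≟ u) refl = cong not (c u)
    ... | no u≢v rewrite dec-false (cell o u ℤ.≟ cell o v) (λ e → u≢v (cell-injective o e)) | dec-false (u ℕ.≟ v) u≢v = c v

  move-flip : ∀ {T g u} → κ ≢ cell o u → Holds g T u → Holds (g ▸ b⁺) (toggle u T) (suc u)
  move-flip {T} {g} {u} κ≢u (holds m e c) = holds
    (trans (lamp≡ (b⁺≋ g) κ) (trans (lamp-∷-≢ (lamps g) (λ p≡κ → κ≢u (trans (sym p≡κ) e))) m))
    (trans (cong up e) (cell-up o u)) (flip-cells {g = g} e c)

  right-triple : ∀ {T u} → T , u ⟪ right ⟫ T , suc u
  right-triple = triple λ h → _ , exit (holds-lit h) refl , move-right h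

  left-triple : ∀ {T u} → T , suc u ⟪ left ⟫ T , u
  left-triple = triple λ h → _ , exit (holds-lit h) refl , move-left h

  flip-triple : ∀ {T u} → κ ≢ cell o u → T , u ⟪ flipRight ⟫ toggle u T , suc u
  flip-triple κ≢u = triple λ h → _ , exit (holds-lit h) refl , move-flip κ≢u h

  infixr 5 _⨾ₜ_
  _⨾ₜ_ : ∀ {v w T u T′ u′ T″ u″} → T , u ⟪ v ⟫ T′ , u′ → T′ , u′ ⟪ w ⟫ T″ , u″ → T , u ⟪ v ⨾ w ⟫ T″ , u″
  _⨾ₜ_ {v} {w} s t = triple λ h₁ → case run s h₁ of λ where
    (_ , p , h₂) → case run t h₂ of λ where
      (_ , q , h₃) → _ , (path-⨾ˡ v w p ▹▹ path-⨾ʳ v w q) , h₃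

  weaken : ∀ {w T u T′ T″ u′} → (∀ v → T′ v ≡ T″ v) → T , u ⟪ w ⟫ T′ , u′ → T , u ⟪ w ⟫ T″ , u′
  weaken eq s = triple λ h₁ → case run s h₁ of λ where
    (g , p , holds m e c) → g , p , holds m e (λ v → trans (c v) (eq v))

  while-exit : ∀ {w T u} → T u ≡ false → T , u ⟪ while w ⟫ T , u
  while-exit {w} {T} {u} off = triple λ {g} h →
    _ , step (holds-lit h) (cong (λ b → a⁺ , just (if b then suc zero else suc (suc zero))) (trans (holds-at h) off)) (exit (holds-lit (move-right h)) refl)
      , holds-≋ (a⁺a⁻ g) h

  while-enter : ∀ w {T u g} → T u ≡ true → Holds g T u →
    ∃ λ h → Path (while w) zero g (just (3 ↑ʳ entry w)) h × Holds h T u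
  while-enter w {g = g} on h =
    _ , step (holds-lit h) (cong (λ b → a⁺ , just (if b then suc zero else suc (suc zero))) (trans (holds-at h) on)) (step (holds-lit (move-right h)) refl stop)
      , holds-≋ (a⁺a⁻ g) h

  while-step : ∀ {w T u T′ u′ T″ u″} → T u ≡ true →
    T , u ⟪ w ⟫ T′ , u′ → T′ , u′ ⟪ while w ⟫ T″ , u″ → T , u ⟪ while w ⟫ T″ , u″
  while-step {w} on s t = triple λ h₀ → case while-enter w on h₀ of λ where
    (_ , p₁ , h₁) → case run s h₁ of λ where
      (_ , p₂ , h₂) → case run t h₂ of λ where
        (_ , p₃ , h₃) → _ , (p₁ ▹▹ path-while w p₂ ▹▹ p₃) , h₃

  scan-left : ∀ {T} n v → (∀ i → i < n → T (suc i + v) ≡ true) → T v ≡ false → T , n + v ⟪ while left ⟫ T , v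
  scan-left zero v on off = while-exit off
  scan-left (suc n) v on off = while-step (on n ℕₚ.≤-refl) left-triple (scan-left n v (λ i lt → on i (ℕₚ.m<n⇒m<1+n lt)) off)

  scan-right : ∀ {T} n v → (∀ i → i < n → T (i + v) ≡ true) → T (n + v) ≡ false → T , v ⟪ while right ⟫ T , n + v
  scan-right zero v on off = while-exit off
  scan-right {T} (suc n) v on off = while-step (on 0 (s≤s z≤n)) right-triple
    (subst (λ u → T , suc v ⟪ while right ⟫ T , u) (ℕₚ.+-suc n v)
      (scan-right n (suc v) (λ i lt → trans (cong T (ℕₚ.+-suc i v)) (on (suc i) (s≤s lt))) (trans (cong T (ℕₚ.+-suc n v)) off)))

  repeat-right : ∀ n {T u} → T , u ⟪ repeat n right ⟫ T , n + u
  repeat-right zero = right-triple ⨾ₜ left-triple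
  repeat-right (suc n) {T} {u} = right-triple ⨾ₜ subst (λ v → T , suc u ⟪ repeat n right ⟫ T , v) (ℕₚ.+-suc n u) (repeat-right n)

  repeat-left : ∀ n {T u} → T , n + u ⟪ repeat n left ⟫ T , u
  repeat-left zero = right-triple ⨾ₜ left-triple
  repeat-left (suc n) = left-triple ⨾ₜ repeat-left n

-- The mark lies just left of the tape, so no flip on the tape can put it out.
off-tape : ∀ u → -[1+ 1 ] ≢ cell -[1+ 0 ] u
off-tape zero ()
off-tape (suc u) ()

-- Registers in unary

open Runs -[1+ 1 ] -[1+ 0 ]

State : Set
State = ℕ → ℕ

infix 9 _[_↦_]
_[_↦_] : State → ℕ → ℕ → State
(σ [ j ↦ x ]) l = if j ≡ᵇ l then x else σ l

infix 4 _≗_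
record _≗_ (σ τ : State) : Set where
  constructor pointwise
  field
    at-register : ∀ l → σ l ≡ τ l
open _≗_ public

lookup-≡ : ∀ σ j x → (σ [ j ↦ x ]) j ≡ x
-- `does (j ℕ.≟ j)` unfolds to `j ≡ᵇ j`; the decision lemmas are used in this way throughout to
-- evaluate Boolean tests.
lookup-≡ σ j x rewrite dec-true (j ℕ.≟ j) refl = refl

lookup-≢ : ∀ σ {j l} x → j ≢ l → (σ [ j ↦ x ]) l ≡ σ l
lookup-≢ σ {j} {l} x j≢l rewrite dec-false (j ℕ.≟ l) j≢l = refl

module Registers (k : ℕ) {{_ : NonZero k}} where

  inc dec : ℕ → Walker
  inc j = repeat j right ⨾ repeat k right ⨾ while (repeat k right) ⨾ flipRight ⨾ left ⨾ while (repeat k left) ⨾ repeat j left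
  dec j = repeat j right ⨾ repeat k right ⨾ while (repeat k right) ⨾ repeat k left ⨾ flipRight ⨾ left ⨾
          repeat k left ⨾ while (repeat k left) ⨾ repeat j left

  loop-body loop : ℕ → Walker → Walker
  loop-body j w = repeat k left ⨾ repeat j left ⨾ dec j ⨾ w ⨾ repeat j right ⨾ repeat k right
  loop j w = repeat j right ⨾ repeat k right ⨾ while (loop-body j w) ⨾ repeat k left ⨾ repeat j left

-- Register j is kept in unary in the cells j + i k + H with i ≥ 1; the row i = 0 stays dark and marks the way back.
module RegisterTriples (k : ℕ) {{_ : NonZero k}} (H : ℕ) where
  open Registers k

  lit : ℕ → ℕ → Bool
  lit zero x = false
  lit (suc i) x = i <ᵇ x

  addr : ℕ → ℕ → ℕ
  addr j i = i * k + (j + H)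

  tracks : Tape → State → Tape
  tracks B σ v = if v <ᵇ H then B v else lit ((v ∸ H) / k) (σ ((v ∸ H) % k))

  data Position : ℕ → Set where
    left-of : ∀ {v} → v < H → Position v
    at-addr : ∀ {j} i → j < k → Position (addr j i)

  position : ∀ v → Position v
  position v with v ℕ.<? H
  ... | yes v<H = left-of v<H
  ... | no v≮H = subst Position eq (at-addr ((v ∸ H) / k) (m%n<n (v ∸ H) k))
    where
    w = v ∸ H
    eq : (w / k) * k + (w % k + H) ≡ v
    eq = trans (sym (ℕₚ.+-assoc ((w / k) * k) (w % k) H))
      (trans (cong (_+ H) (trans (ℕₚ.+-comm ((w / k) * k) (w % k)) (sym (m≡m%n+[m/n]*n w k))))
        (ℕₚ.m∸n+n≡m (ℕₚ.≮⇒≥ v≮H)))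

  tracks-left : ∀ B σ {v} → v < H → tracks B σ v ≡ B v
  tracks-left B σ {v} v<H rewrite dec-true (v ℕ.<? H) v<H = refl

  addr≮H : ∀ j i → ¬ (addr j i < H)
  addr≮H j i lt = ℕₚ.<⇒≱ lt (ℕₚ.≤-trans (ℕₚ.m≤n+m H j) (ℕₚ.m≤n+m (j + H) (i * k)))

  addr∸H : ∀ j i → addr j i ∸ H ≡ j + i * k
  addr∸H j i = trans (cong (_∸ H) (sym (ℕₚ.+-assoc (i * k) j H))) (trans (ℕₚ.m+n∸n≡m (i * k + j) H) (ℕₚ.+-comm (i * k) j))

  addr-col : ∀ {j} i → j < k → (addr j i ∸ H) % k ≡ j
  addr-col {j} i j<k = trans (cong (_% k) (addr∸H j i)) (trans ([m+kn]%n≡m%n j i k) (m<n⇒m%n≡m j<k))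

  addr-row : ∀ {j} i → j < k → (addr j i ∸ H) / k ≡ i
  addr-row {j} i j<k = trans (cong (_/ k) (addr∸H j i)) (trans (+-distrib-/-∣ʳ j (ℕ∣.divides i refl))
    (trans (cong (_+ (i * k) / k) (m<n⇒m/n≡0 j<k)) (m*n/n≡m i k)))

  tracks-addr : ∀ B σ {j} i → j < k → tracks B σ (addr j i) ≡ lit i (σ j)
  tracks-addr B σ {j} i j<k rewrite dec-false (addr j i ℕ.<? H) (addr≮H j i) | addr-row i j<k | addr-col i j<k = refl

  tracks-cong : ∀ B {σ τ} → σ ≗ τ → ∀ v → tracks B σ v ≡ tracks B τ v
  tracks-cong B eq v = cong (λ x → if v <ᵇ H then B v else lit ((v ∸ H) / k) x) (at-register eq _)

  -- An address determines its column and its row, so the flip concerns register `j` alone and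
  -- reduces to the hypothesis `row` on a single column.
  toggle-tracks : ∀ B σ τ {j} i → j < k → (∀ l → j ≢ l → σ l ≡ τ l) →
    (∀ i′ → toggleIf (i ≡ᵇ i′) (lit i′ (σ j)) ≡ lit i′ (τ j)) →
    ∀ v → toggle (addr j i) (tracks B σ) v ≡ tracks B τ v
  toggle-tracks B σ τ {j} i j<k others row v with position v
  ... | left-of v<H rewrite dec-false (addr j i ℕ.≟ v) (λ { refl → addr≮H j i v<H }) =
        trans (tracks-left B σ v<H) (sym (tracks-left B τ v<H))
  ... | at-addr {l} i′ l<k with j ℕ.≟ l
  ...   | no j≢l rewrite dec-false (addr j i ℕ.≟ addr l i′)
            (λ e → j≢l (trans (sym (addr-col i j<k)) (trans (cong (λ v → (v ∸ H) % k) e) (addr-col i′ l<k)))) =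
        trans (tracks-addr B σ i′ l<k) (trans (cong (lit i′) (others l j≢l)) (sym (tracks-addr B τ i′ l<k)))
  ...   | yes refl = trans (cong₂ toggleIf same (tracks-addr B σ i′ l<k)) (trans (row i′) (sym (tracks-addr B τ i′ l<k)))
    where
    same : (addr j i ≡ᵇ addr j i′) ≡ (i ≡ᵇ i′)
    same with i ℕ.≟ i′
    ... | yes refl = trans (dec-true (addr j i ℕ.≟ addr j i) refl) (sym (dec-true (i ℕ.≟ i) refl))
    ... | no i≢i′ = trans (dec-false (addr j i ℕ.≟ addr j i′)
            (λ e → i≢i′ (trans (sym (addr-row i j<k)) (trans (cong (λ v → (v ∸ H) / k) e) (addr-row i′ j<k)))))
            (sym (dec-false (i ℕ.≟ i′) i≢i′))

  lit-suc : ∀ x i → toggleIf (suc x ≡ᵇ i) (lit i x) ≡ lit i (suc x)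
  lit-suc x zero = refl
  lit-suc zero (suc zero) = refl
  lit-suc zero (suc (suc i)) = refl
  lit-suc (suc x) (suc zero) = refl
  lit-suc (suc x) (suc (suc i)) = lit-suc x (suc i)

  lit-pred : ∀ x i → toggleIf (suc x ≡ᵇ i) (lit i (suc x)) ≡ lit i x
  lit-pred x i = trans (cong (toggleIf (suc x ≡ᵇ i)) (sym (lit-suc x i))) (twice (suc x ≡ᵇ i) (lit i x))
    where
    twice : ∀ d b → toggleIf d (toggleIf d b) ≡ b
    twice true b = Boolₚ.not-involutive b
    twice false b = refl

  lit-true : ∀ {i x} → i < x → lit (suc i) x ≡ true
  lit-true {i} {x} i<x = dec-true (i ℕ.<? x) i<x

  lit-false : ∀ x → lit (suc x) x ≡ false
  lit-false x = dec-false (x ℕ.<? x) (ℕₚ.<-irrefl refl)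

  addr-suc : ∀ j i → addr j (suc i) ≡ k + addr j i
  addr-suc j i = ℕₚ.+-assoc k (i * k) (j + H)

  row-up : ∀ {T} j i → T , addr j i ⟪ repeat k right ⟫ T , addr j (suc i)
  row-up {T} j i = subst (λ u → T , addr j i ⟪ repeat k right ⟫ T , u) (sym (addr-suc j i)) (repeat-right k)

  row-down : ∀ {T} j i → T , addr j (suc i) ⟪ repeat k left ⟫ T , addr j i
  row-down {T} j i = subst (λ u → T , u ⟪ repeat k left ⟫ T , addr j i) (sym (addr-suc j i)) (repeat-left k)

  scan-up : ∀ {T} j d i → (∀ d′ → d′ < d → T (addr j (d′ + i)) ≡ true) → T (addr j (d + i)) ≡ false →
    T , addr j i ⟪ while (repeat k right) ⟫ T , addr j (d + i)
  scan-up j zero i on off = while-exit off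
  scan-up {T} j (suc d) i on off = while-step (on 0 (s≤s z≤n)) (row-up j i)
    (subst (λ n → T , addr j (suc i) ⟪ while (repeat k right) ⟫ T , addr j n) (ℕₚ.+-suc d i)
      (scan-up j d (suc i)
        (λ d′ lt → trans (cong (T ∘ addr j) (ℕₚ.+-suc d′ i)) (on (suc d′) (s≤s lt)))
        (trans (cong (T ∘ addr j) (ℕₚ.+-suc d i)) off)))

  scan-down : ∀ {T} j i → (∀ i′ → i′ < i → T (addr j (suc i′)) ≡ true) → T (addr j 0) ≡ false →
    T , addr j i ⟪ while (repeat k left) ⟫ T , addr j 0
  scan-down j zero on off = while-exit off
  scan-down j (suc i) on off = while-step (on i ℕₚ.≤-refl) (row-down j i)
    (scan-down j i (λ i′ lt → on i′ (ℕₚ.m<n⇒m<1+n lt)) off)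

  infix 3 _⟦_⟧_
  -- Quantifying over `B` says that the tape to the left of the registers is left as it was found.
  record _⟦_⟧_ (σ : State) (w : Walker) (τ : State) : Set where
    constructor regs
    field
      exec : ∀ B → tracks B σ , H ⟪ w ⟫ tracks B τ , H
  open _⟦_⟧_ public

  infixr 5 _⨾ᵣ_
  _⨾ᵣ_ : ∀ {v w σ τ υ} → σ ⟦ v ⟧ τ → τ ⟦ w ⟧ υ → σ ⟦ v ⨾ w ⟧ υ
  s ⨾ᵣ t = regs λ B → exec s B ⨾ₜ exec t B

  weakenᵣ : ∀ {w σ τ υ} → τ ≗ υ → σ ⟦ w ⟧ τ → σ ⟦ w ⟧ υ
  weakenᵣ eq s = regs λ B → weaken (tracks-cong B eq) (exec s B)

  scan-track : ∀ B σ {j} → j < k → tracks B σ , addr j 1 ⟪ while (repeat k right) ⟫ tracks B σ , addr j (suc (σ j))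
  scan-track B σ {j} j<k = subst (λ n → tracks B σ , addr j 1 ⟪ while (repeat k right) ⟫ tracks B σ , addr j n)
    (ℕₚ.+-comm (σ j) 1)
    (scan-up j (σ j) 1
      (λ d lt → trans (cong (tracks B σ ∘ addr j) (ℕₚ.+-comm d 1)) (trans (tracks-addr B σ (suc d) j<k) (lit-true lt)))
      (trans (cong (tracks B σ ∘ addr j) (ℕₚ.+-comm (σ j) 1)) (trans (tracks-addr B σ (suc (σ j)) j<k) (lit-false (σ j)))))

  scan-back : ∀ B σ {j} i → j < k → i ≤ σ j → tracks B σ , addr j i ⟪ while (repeat k left) ⟫ tracks B σ , addr j 0
  scan-back B σ {j} i j<k i≤ = scan-down j i
    (λ i′ lt → trans (tracks-addr B σ (suc i′) j<k) (lit-true (ℕₚ.<-≤-trans lt i≤)))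
    (tracks-addr B σ 0 j<k)

  inc-triple : ∀ {σ j} → j < k → σ ⟦ inc j ⟧ σ [ j ↦ suc (σ j) ]
  inc-triple {σ} {j} j<k = regs λ B →
    repeat-right j ⨾ₜ row-up j 0 ⨾ₜ scan-track B σ j<k ⨾ₜ
    weaken (toggle-tracks B σ τ (suc (σ j)) j<k (λ l j≢l → sym (lookup-≢ σ (suc (σ j)) j≢l))
      (λ i → trans (lit-suc (σ j) i) (cong (lit i) (sym τj)))) (flip-triple (off-tape (addr j (suc (σ j))))) ⨾ₜ
    left-triple ⨾ₜ
    scan-back B τ (suc (σ j)) j<k (ℕₚ.≤-reflexive (sym τj)) ⨾ₜ
    repeat-left j
    where
    τ = σ [ j ↦ suc (σ j) ]
    τj : τ j ≡ suc (σ j)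
    τj = lookup-≡ σ j (suc (σ j))

  dec-triple : ∀ {σ j x} → j < k → σ j ≡ suc x → σ ⟦ dec j ⟧ σ [ j ↦ x ]
  dec-triple {σ} {j} {x} j<k e = regs λ B →
    repeat-right j ⨾ₜ row-up j 0 ⨾ₜ
    subst (λ n → tracks B σ , addr j 1 ⟪ while (repeat k right) ⟫ tracks B σ , addr j (suc n)) e (scan-track B σ j<k) ⨾ₜ
    row-down j (suc x) ⨾ₜ
    weaken (toggle-tracks B σ τ (suc x) j<k (λ l j≢l → sym (lookup-≢ σ x j≢l))
      (λ i → trans (cong (λ n → toggleIf (suc x ≡ᵇ i) (lit i n)) e) (trans (lit-pred x i) (cong (lit i) (sym τj))))) (flip-triple (off-tape (addr j (suc x)))) ⨾ₜ
    left-triple ⨾ₜ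
    -- The cell just put out is dark and would end the scan at once, so one row is descended before
    -- scanning.
    row-down j x ⨾ₜ
    scan-back B τ x j<k (ℕₚ.≤-reflexive (sym τj)) ⨾ₜ
    repeat-left j
    where
    τ = σ [ j ↦ x ]
    τj : τ j ≡ x
    τj = lookup-≡ σ j x

  -- A terminating execution of a counting loop, round by round. The register is lowered before the
  -- body runs, so the body may raise or clear it; the search in `mu` relies on this.
  data Loop (j : ℕ) (w : Walker) : State → State → Set where
    done : ∀ {σ τ} → σ j ≡ 0 → σ ≗ τ → Loop j w σ τ
    more : ∀ {σ τ υ x} → σ j ≡ suc x → σ [ j ↦ x ] ⟦ w ⟧ τ → Loop j w τ υ → Loop j w σ υ

  while-triple : ∀ {j w σ τ} → j < k → Loop j w σ τ → ∀ B →
    tracks B σ , addr j 1 ⟪ while (loop-body j w) ⟫ tracks B τ , addr j 1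
  while-triple {σ = σ} j<k (done e eq) B = weaken (tracks-cong B eq)
    (while-exit (trans (tracks-addr B σ 1 j<k) (cong (lit 1) e)))
  while-triple {j} {σ = σ} j<k (more e t rest) B = while-step (trans (tracks-addr B σ 1 j<k) (cong (lit 1) e))
    (row-down j 0 ⨾ₜ repeat-left j ⨾ₜ exec (dec-triple j<k e) B ⨾ₜ exec t B ⨾ₜ repeat-right j ⨾ₜ row-up j 0)
    (while-triple j<k rest B)

  loop-triple : ∀ {j w σ τ} → j < k → Loop j w σ τ → σ ⟦ loop j w ⟧ τ
  loop-triple {j} j<k l = regs λ B →
    repeat-right j ⨾ₜ row-up j 0 ⨾ₜ while-triple j<k l B ⨾ₜ row-down j 0 ⨾ₜ repeat-left j

-- Compiling recursive functions to walkers

nop : Walker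
nop = right ⨾ left

interval : ℕ → ∀ m → Vec ℕ m
interval b zero = []
interval b (suc m) = b ∷ interval (suc b) m

-- Registers above b serve as scratch space: they are 0 before and after, except that b receives the result.
module Compile (k : ℕ) {{_ : NonZero k}} where
  open Registers k

  clear : ℕ → Walker
  clear j = loop j nop

  transfer : ℕ → ℕ → Walker
  transfer i j = loop i (inc j)

  -- A loop consumes its register. Two copies are made, and the second is spent on restoring the
  -- source.
  copy : ℕ → ℕ → Walker
  copy i b = loop i (inc b ⨾ inc (suc b)) ⨾ transfer (suc b) i

  clearAll : ℕ → ℕ → Walker
  clearAll zero b = nop
  clearAll (suc m) b = clear b ⨾ clearAll m (suc b)

  mutual
    compile : ∀ {m} → Code m → Vec ℕ m → ℕ → Walker
    compile zer ins b = nop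
    compile succ (i ∷ []) b = copy i b ⨾ inc b
    compile (proj i) ins b = copy (Vec.lookup ins i) b
    compile (comp {m} f gs) ins b =
      compileAll gs ins (suc b) ⨾ compile f (interval (suc b) m) (suc m + b) ⨾
      clearAll m (suc b) ⨾ transfer (suc m + b) b
    compile (prec f g) (i ∷ ins) b =
      compile f ins b ⨾ copy i (2 + b) ⨾ loop (2 + b) (prec-body g ins b) ⨾ clear (suc b)
    compile (mu f) ins b = inc (suc b) ⨾ loop (suc b) (mu-body f ins b)

    -- Register `b` holds the value reached, `suc b` the argument reached, `2 + b` the rounds that
    -- remain, and `3 + b` receives the next value.
    prec-body : ∀ {m} → Code (suc (suc m)) → Vec ℕ m → ℕ → Walker
    prec-body g ins b = compile g (suc b ∷ b ∷ ins) (3 + b) ⨾ clear b ⨾ transfer (3 + b) b ⨾ inc (suc b)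

    -- Register `suc b` is a flag that keeps the search going. Each round uses it up, and a nonzero
    -- value of `f` sets it again after advancing the candidate in `b`. The inner loop clears its
    -- own counter first, so it acts as a conditional.
    mu-body : ∀ {m} → Code (suc m) → Vec ℕ m → ℕ → Walker
    mu-body f ins b = compile f (b ∷ ins) (2 + b) ⨾ loop (2 + b) (clear (2 + b) ⨾ inc b ⨾ inc (suc b))

    compileAll : ∀ {l m} → Vec (Code m) l → Vec ℕ m → ℕ → Walker
    compileAll [] ins b = nop
    compileAll (g ∷ gs) ins b = compile g ins b ⨾ compileAll gs ins (suc b)

mutual
  -- A generous bound on the registers used from the base upwards. Sums in place of maxima turn all
  -- later bounds into ring identities with explicit slack.
  scratch : ∀ {m} → Code m → ℕ
  scratch zer = 2
  scratch succ = 2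
  scratch (proj i) = 2
  scratch (comp {m} f gs) = 2 + m + (scratchAll gs + scratch f)
  scratch (prec f g) = 4 + (scratch f + scratch g)
  scratch (mu f) = 3 + scratch f

  scratchAll : ∀ {l m} → Vec (Code m) l → ℕ
  scratchAll [] = 0
  scratchAll (g ∷ gs) = suc (scratch g + scratchAll gs)

-- Register states described by a list above a base

nth : ℕ → List ℕ → ℕ
nth i [] = 0
nth zero (v ∷ vs) = v
nth (suc i) (v ∷ vs) = nth i vs

put : ℕ → ℕ → List ℕ → List ℕ
put zero x [] = x ∷ []
put (suc j) x [] = 0 ∷ put j x []
put zero x (v ∷ vs) = x ∷ vs
put (suc j) x (v ∷ vs) = v ∷ put j x vs

nth-put : ∀ j x vs i → nth i (put j x vs) ≡ (if j ≡ᵇ i then x else nth i vs)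
nth-put zero x [] zero = refl
nth-put zero x [] (suc i) = refl
nth-put (suc j) x [] zero = refl
nth-put (suc j) x [] (suc i) = nth-put j x [] i
nth-put zero x (v ∷ vs) zero = refl
nth-put zero x (v ∷ vs) (suc i) = refl
nth-put (suc j) x (v ∷ vs) zero = refl
nth-put (suc j) x (v ∷ vs) (suc i) = nth-put j x vs i

opaque
  -- As `nth` is 0 past the end of the list, this also records that all further registers are clear.
  -- Being opaque, it is used only through `ext-<` and `ext-≥`.
  ext : ℕ → State → List ℕ → State
  ext b σ vs r = if r <ᵇ b then σ r else nth (r ∸ b) vs

  ext-< : ∀ {b r} σ vs → r < b → ext b σ vs r ≡ σ r
  ext-< {b} {r} σ vs r<b rewrite dec-true (r ℕ.<? b) r<b = refl

  ext-≥ : ∀ {b r} σ vs → b ≤ r → ext b σ vs r ≡ nth (r ∸ b) vs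
  ext-≥ {b} {r} σ vs b≤r rewrite dec-false (r ℕ.<? b) (ℕₚ.≤⇒≯ b≤r) = refl

ext-+ : ∀ b σ vs j → ext b σ vs (j + b) ≡ nth j vs
ext-+ b σ vs j = trans (ext-≥ σ vs (ℕₚ.m≤n+m b j)) (cong (λ i → nth i vs) (ℕₚ.m+n∸n≡m j b))

data Side (b : ℕ) : ℕ → Set where
  low  : ∀ {r} → r < b → Side b r
  high : ∀ j → Side b (j + b)

side : ∀ b r → Side b r
side b r with r ℕ.<? b
... | yes r<b = low r<b
... | no r≮b = subst (Side b) (ℕₚ.m∸n+n≡m (ℕₚ.≮⇒≥ r≮b)) (high (r ∸ b))

≡-ext : ∀ {b τ σ vs} → (∀ r → r < b → τ r ≡ σ r) → (∀ j → τ (j + b) ≡ nth j vs) → τ ≗ ext b σ vs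
≡-ext {b} {τ} {σ} {vs} lo hi = pointwise λ r → agree (side b r)
  where
  agree : ∀ {r} → Side b r → τ r ≡ ext b σ vs r
  agree (low r<b) = trans (lo _ r<b) (sym (ext-< σ vs r<b))
  agree (high j) = trans (hi j) (sym (ext-+ b σ vs j))

ext-cong : ∀ {b σ τ vs ws} → (∀ r → r < b → σ r ≡ τ r) → (∀ j → nth j vs ≡ nth j ws) → ext b σ vs ≗ ext b τ ws
ext-cong {b} {σ} {τ} {vs} {ws} lo hi = ≡-ext (λ r r<b → trans (ext-< σ vs r<b) (lo r r<b)) (λ j → trans (ext-+ b σ vs j) (hi j))

nth-cong⇒ext : ∀ {b σ vs ws} → (∀ j → nth j vs ≡ nth j ws) → ext b σ vs ≗ ext b σ ws
nth-cong⇒ext = ext-cong (λ _ _ → refl)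

nth-++ : ∀ vs ws j → nth (j + List.length vs) (vs ++ ws) ≡ nth j ws
nth-++ [] ws j = cong (λ i → nth i ws) (ℕₚ.+-identityʳ j)
nth-++ (v ∷ vs) ws j rewrite ℕₚ.+-suc j (List.length vs) = nth-++ vs ws j

nth-++-< : ∀ vs ws {j} → j < List.length vs → nth j (vs ++ ws) ≡ nth j vs
nth-++-< (v ∷ vs) ws {zero} _ = refl
nth-++-< (v ∷ vs) ws {suc j} (s≤s lt) = nth-++-< vs ws lt

ext-++ : ∀ b σ vs ws → ext b σ (vs ++ ws) ≗ ext (List.length vs + b) (ext b σ vs) ws
ext-++ b σ vs ws = ≡-ext lo hi
  where
  n = List.length vs
  lo : ∀ r → r < n + b → ext b σ (vs ++ ws) r ≡ ext b σ vs r
  lo r lt with side b r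
  ... | low r<b = trans (ext-< σ (vs ++ ws) r<b) (sym (ext-< σ vs r<b))
  ... | high j = trans (ext-+ b σ (vs ++ ws) j) (trans (nth-++-< vs ws (ℕₚ.+-cancelʳ-< b j n lt)) (sym (ext-+ b σ vs j)))
  hi : ∀ j → ext b σ (vs ++ ws) (j + (n + b)) ≡ nth j ws
  hi j = trans (cong (ext b σ (vs ++ ws)) (sym (ℕₚ.+-assoc j n b))) (trans (ext-+ b σ (vs ++ ws) (j + n)) (nth-++ vs ws j))

ext-put : ∀ b σ vs j x → ext b σ vs [ j + b ↦ x ] ≗ ext b σ (put j x vs)
ext-put b σ vs j x = ≡-ext lo hi
  where
  lo : ∀ r → r < b → (ext b σ vs [ j + b ↦ x ]) r ≡ σ r
  lo r r<b = trans (lookup-≢ (ext b σ vs) {j + b} {r} x λ { refl → ℕₚ.<⇒≱ r<b (ℕₚ.m≤n+m b j) }) (ext-< σ vs r<b)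
  hi : ∀ i → (ext b σ vs [ j + b ↦ x ]) (i + b) ≡ nth i (put j x vs)
  hi i = trans (cong₂ (λ d y → if d then x else y) same (ext-+ b σ vs i)) (sym (nth-put j x vs i))
    where
    same : (j + b ≡ᵇ i + b) ≡ (j ≡ᵇ i)
    same with j ℕ.≟ i
    ... | yes refl = trans (dec-true (j + b ℕ.≟ j + b) refl) (sym (dec-true (j ℕ.≟ j) refl))
    ... | no j≢i = trans (dec-false (j + b ℕ.≟ i + b) (λ e → j≢i (ℕₚ.+-cancelʳ-≡ b j i e))) (sym (dec-false (j ℕ.≟ i) j≢i))

ext-low : ∀ b σ vs {r} x → r < b → ext b σ vs [ r ↦ x ] ≗ ext b (σ [ r ↦ x ]) vs
ext-low b σ vs {r} x r<b = ≡-ext lo hi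
  where
  lo : ∀ l → l < b → (ext b σ vs [ r ↦ x ]) l ≡ (σ [ r ↦ x ]) l
  lo l l<b = cong (λ y → if r ≡ᵇ l then x else y) (ext-< σ vs l<b)
  hi : ∀ j → (ext b σ vs [ r ↦ x ]) (j + b) ≡ nth j vs
  hi j = trans (lookup-≢ (ext b σ vs) {r} {j + b} x λ { refl → ℕₚ.<⇒≱ r<b (ℕₚ.m≤n+m b j) }) (ext-+ b σ vs j)

≗-sym : ∀ {σ τ} → σ ≗ τ → τ ≗ σ
≗-sym (pointwise e) = pointwise λ l → sym (e l)

≗-trans : ∀ {σ τ υ} → σ ≗ τ → τ ≗ υ → σ ≗ υ
≗-trans (pointwise e) (pointwise f) = pointwise λ l → trans (e l) (f l)

module CompileCorrect (k : ℕ) {{_ : NonZero k}} (H : ℕ) where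
  open Registers k
  open RegisterTriples k H
  open Compile k

  strengthen : ∀ {w σ τ υ} → σ ≗ τ → τ ⟦ w ⟧ υ → σ ⟦ w ⟧ υ
  strengthen {σ = σ} {τ} eq s = regs λ B → triple λ { (holds m e c) → run (exec s B) (holds m e λ v → trans (c v) (tracks-cong B eq v)) }

  loop-pre : ∀ {j w σ τ υ} → σ ≗ τ → Loop j w τ υ → Loop j w σ υ
  loop-pre {j} e (done z eq) = done (trans (at-register e j) z) (≗-trans e eq)
  loop-pre {j} e (more {x = x} s t l) = more (trans (at-register e j) s) (strengthen (pointwise λ i → cong (λ y → if j ≡ᵇ i then x else y) (at-register e i)) t) l

  loop-post : ∀ {j w σ τ υ} → τ ≗ υ → Loop j w σ τ → Loop j w σ υ
  loop-post e (done z eq) = done z (≗-trans eq e)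
  loop-post e (more s t l) = more s t (loop-post e l)

  nop-triple : ∀ {σ} → σ ⟦ nop ⟧ σ
  nop-triple = regs λ B → right-triple ⨾ₜ left-triple

  ext-more : ∀ {b σ vs τ υ w} j {x} → nth j vs ≡ suc x → ext b σ (put j x vs) ⟦ w ⟧ τ → Loop (j + b) w τ υ →
    Loop (j + b) w (ext b σ vs) υ
  ext-more {b} {σ} {vs} j {x} e t l = more (trans (ext-+ b σ vs j) e) (strengthen (ext-put b σ vs j x) t) l

  ext-done : ∀ {b σ vs ws w} j → nth j vs ≡ 0 → (∀ i → nth i vs ≡ nth i ws) → Loop (j + b) w (ext b σ vs) (ext b σ ws)
  ext-done {b} {σ} {vs} j e eq = done (trans (ext-+ b σ vs j) e) (nth-cong⇒ext eq)

  ext-inc : ∀ {b σ vs} j → j + b < k → ext b σ vs ⟦ inc (j + b) ⟧ ext b σ (put j (suc (nth j vs)) vs)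
  ext-inc {b} {σ} {vs} j lt = weakenᵣ (≗-trans (ext-put b σ vs j _) (nth-cong⇒ext λ i → cong (λ x → nth i (put j (suc x) vs)) (ext-+ b σ vs j)))
    (inc-triple {ext b σ vs} lt)

  put-put : ∀ j x y vs i → nth i (put j x (put j y vs)) ≡ nth i (put j x vs)
  put-put j x y vs i rewrite nth-put j x (put j y vs) i | nth-put j y vs i | nth-put j x vs i with j ≡ᵇ i
  ... | true = refl
  ... | false = refl

  nth-put-self : ∀ j x vs → nth j (put j x vs) ≡ x
  nth-put-self j x vs = trans (nth-put j x vs j) (cong (λ d → if d then x else nth j vs) (dec-true (j ℕ.≟ j) refl))

  nth-put-other : ∀ {j i} x vs → j ≢ i → nth i (put j x vs) ≡ nth i vs
  nth-put-other {j} {i} x vs j≢i = trans (nth-put j x vs i) (cong (λ d → if d then x else nth i vs) (dec-false (j ℕ.≟ i) j≢i))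

  put-same : ∀ j vs {x} → nth j vs ≡ x → ∀ i → nth i vs ≡ nth i (put j x vs)
  put-same j vs {x} e i with j ℕ.≟ i
  ... | yes refl = trans e (sym (nth-put-self j x vs))
  ... | no j≢i = sym (nth-put-other x vs j≢i)

  ext-clear : ∀ {b σ} vs j → j + b < k → ext b σ vs ⟦ clear (j + b) ⟧ ext b σ (put j 0 vs)
  ext-clear {b} {σ} vs j lt = loop-triple lt (go (nth j vs) vs refl)
    where
    go : ∀ x vs → nth j vs ≡ x → Loop (j + b) nop (ext b σ vs) (ext b σ (put j 0 vs))
    go zero vs e = ext-done j e (put-same j vs e)
    go (suc x) vs e = ext-more j e nop-triple
      (loop-post (nth-cong⇒ext (put-put j 0 x vs)) (go x (put j x vs) (nth-put-self j x vs)))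

  put-comm : ∀ {j l} x y vs → j ≢ l → ∀ i → nth i (put j x (put l y vs)) ≡ nth i (put l y (put j x vs))
  put-comm {j} {l} x y vs j≢l i
    rewrite nth-put j x (put l y vs) i | nth-put l y vs i | nth-put l y (put j x vs) i | nth-put j x vs i
    with j ℕ.≟ i | l ℕ.≟ i
  ... | yes refl | yes refl = ⊥-elim (j≢l refl)
  ... | yes refl | no l≢j rewrite dec-true (j ℕ.≟ j) refl | dec-false (l ℕ.≟ j) l≢j = refl
  ... | no j≢i | _ rewrite dec-false (j ℕ.≟ i) j≢i = refl

  ext-transfer : ∀ {b σ} vs i j → i ≢ j → i + b < k → j + b < k →
    ext b σ vs ⟦ transfer (i + b) (j + b) ⟧ ext b σ (put i 0 (put j (nth i vs + nth j vs) vs))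
  ext-transfer {b} {σ} vs i j i≢j i<k j<k = loop-triple i<k (go (nth i vs) vs refl)
    where
    go : ∀ x vs → nth i vs ≡ x →
      Loop (i + b) (inc (j + b)) (ext b σ vs) (ext b σ (put i 0 (put j (x + nth j vs) vs)))
    go zero vs e = ext-done i e λ l →
      trans (put-same i vs e l) (trans (nth-put i 0 vs l)
        (trans (cong (λ y → if i ≡ᵇ l then 0 else y) (put-same j vs refl l)) (sym (nth-put i 0 (put j (nth j vs) vs) l))))
    go (suc x) vs e = ext-more i e (ext-inc j j<k)
      (loop-post (nth-cong⇒ext result) (go x vs′ (trans (nth-put-other _ ws (i≢j ∘ sym)) (nth-put-self i x vs))))
      where
      ws = put i x vs
      vs′ = put j (suc (nth j ws)) ws
      result : ∀ l → nth l (put i 0 (put j (x + nth j vs′) vs′)) ≡ nth l (put i 0 (put j (suc x + nth j vs) vs))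
      result l = begin
        nth l (put i 0 (put j (x + nth j vs′) vs′)) ≡⟨ nth-put i 0 _ l ⟩
        under-i (nth l (put j (x + nth j vs′) vs′)) ≡⟨ cong under-i (put-put j _ _ ws l) ⟩
        under-i (nth l (put j (x + nth j vs′) ws)) ≡⟨ cong (λ y → under-i (nth l (put j y ws))) total ⟩
        under-i (nth l (put j (suc x + nth j vs) ws)) ≡⟨ cong under-i (put-comm _ x vs (i≢j ∘ sym) l) ⟩
        under-i (nth l (put i x us)) ≡⟨ nth-put i 0 (put i x us) l ⟨
        nth l (put i 0 (put i x us)) ≡⟨ put-put i 0 x us l ⟩
        nth l (put i 0 us) ∎
        where
        open ≡-Reasoning
        us = put j (suc x + nth j vs) vs
        under-i : ℕ → ℕ
        under-i y = if i ≡ᵇ l then 0 else y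
        total : x + nth j vs′ ≡ suc x + nth j vs
        total = trans (cong (λ y → x + y) (trans (nth-put-self j _ ws) (cong suc (nth-put-other x vs i≢j)))) (ℕₚ.+-suc x (nth j vs))

-- The slack `r` is named explicitly, so that the ring solver can prove the bound as an equation.
fits : ∀ {t k x} r → x + r ≡ t → t ≤ k → x ≤ k
fits {x = x} r refl = ℕₚ.≤-trans (ℕₚ.m≤m+n x r)

Inputs : ∀ {m} → ℕ → State → Vec ℕ m → Vec ℕ m → Set
Inputs b σ ins xs = ∀ i → Vec.lookup ins i < b × σ (Vec.lookup ins i) ≡ Vec.lookup xs i

inputs-ext : ∀ {m b σ} {ins xs : Vec ℕ m} n vs → Inputs b σ ins xs → Inputs (n + b) (ext b σ vs) ins xs
inputs-ext {b = b} {σ} n vs ok i =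
  ℕₚ.≤-trans (proj₁ (ok i)) (ℕₚ.m≤n+m b n) , trans (ext-< σ vs (proj₁ (ok i))) (proj₂ (ok i))

lookup-interval : ∀ b {m} (i : Fin m) → Vec.lookup (interval b m) i ≡ toℕ i + b
lookup-interval b zero = refl
lookup-interval b (suc i) = trans (lookup-interval (suc b) i) (ℕₚ.+-suc (toℕ i) b)

nth-toList : ∀ {m} (ys : Vec ℕ m) i → nth (toℕ i) (Vec.toList ys) ≡ Vec.lookup ys i
nth-toList (y ∷ ys) zero = refl
nth-toList (y ∷ ys) (suc i) = nth-toList ys i

nth-replicate-last : ∀ m z → nth m (List.replicate m 0 ++ z ∷ []) ≡ z
nth-replicate-last zero z = refl
nth-replicate-last (suc m) z = nth-replicate-last m z

nth-put-last : ∀ m z j → nth j (put m 0 (List.replicate m 0 ++ z ∷ [])) ≡ 0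
nth-put-last zero z zero = refl
nth-put-last zero z (suc j) = refl
nth-put-last (suc m) z zero = refl
nth-put-last (suc m) z (suc j) = nth-put-last m z j

module CompileEval (k : ℕ) {{_ : NonZero k}} (H : ℕ) where
  open Registers k
  open RegisterTriples k H
  open Compile k
  open CompileCorrect k H

  -- A frame rule: results already present become part of the fixed state below a higher base.
  rebase : ∀ {b σ w ws ws′} vs n → List.length vs ≡ n →
    ext (n + b) (ext b σ vs) ws ⟦ w ⟧ ext (n + b) (ext b σ vs) ws′ → ext b σ (vs ++ ws) ⟦ w ⟧ ext b σ (vs ++ ws′)
  rebase {b} {σ} {ws = ws} {ws′} vs n refl t = strengthen (ext-++ b σ vs ws) (weakenᵣ (≗-sym (ext-++ b σ vs ws′)) t)

  ext-copy : ∀ {b σ r} → r < b → suc b < k → ext b σ [] ⟦ copy r b ⟧ ext b σ (σ r ∷ [])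
  ext-copy {b} {σ} {r} r<b b<k =
    strengthen (nth-cong⇒ext λ { zero → refl ; (suc zero) → refl ; (suc (suc _)) → refl })
      (loop-triple r<k (out (σ r) 0 σ refl)) ⨾ᵣ
    weakenᵣ (ext-cong restored (λ { zero → ℕₚ.+-identityʳ (σ r) ; (suc zero) → refl ; (suc (suc _)) → refl }))
      (loop-triple b<k (back (σ r + 0) (σ r + 0) (σ [ r ↦ 0 ])))
    where
    r<k : r < k
    r<k = ℕₚ.<-trans r<b (ℕₚ.<-trans (ℕₚ.n<1+n b) b<k)
    overwrite : ∀ τ x y → (τ [ r ↦ x ]) [ r ↦ y ] ≗ τ [ r ↦ y ]
    overwrite τ x y = pointwise λ l → collapse (r ≡ᵇ l) (τ l)
      where
      collapse : ∀ d u → (if d then y else (if d then x else u)) ≡ (if d then y else u)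
      collapse true u = refl
      collapse false u = refl
    out : ∀ y x τ → τ r ≡ y → Loop r (inc b ⨾ inc (suc b)) (ext b τ (x ∷ x ∷ [])) (ext b (τ [ r ↦ 0 ]) (y + x ∷ y + x ∷ []))
    out zero x τ e = done (trans (ext-< τ _ r<b) e) (ext-cong unchanged (λ _ → refl))
      where
      unchanged : ∀ l → l < b → τ l ≡ (τ [ r ↦ 0 ]) l
      unchanged l _ with r ℕ.≟ l
      ... | yes refl = trans e (sym (lookup-≡ τ r 0))
      ... | no r≢l = sym (lookup-≢ τ 0 r≢l)
    out (suc y) x τ e = more (trans (ext-< τ _ r<b) e)
      (strengthen (ext-low b τ _ y r<b) (ext-inc 0 (ℕₚ.<-trans (ℕₚ.n<1+n b) b<k) ⨾ᵣ ext-inc 1 b<k))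
      (loop-post (ext-cong (λ l _ → at-register (overwrite τ y 0) l)
          (λ j → cong (λ n → nth j (n ∷ n ∷ [])) (ℕₚ.+-suc y x)))
        (out y (suc x) (τ [ r ↦ y ]) (lookup-≡ τ r y)))
    back : ∀ x y τ → Loop (suc b) (inc r) (ext b τ (x ∷ y ∷ [])) (ext b (τ [ r ↦ y + τ r ]) (x ∷ 0 ∷ []))
    back x zero τ = done (ext-+ b τ _ 1) (ext-cong unchanged (λ _ → refl))
      where
      unchanged : ∀ l → l < b → τ l ≡ (τ [ r ↦ τ r ]) l
      unchanged l _ with r ℕ.≟ l
      ... | yes refl = sym (lookup-≡ τ r (τ r))
      ... | no r≢l = sym (lookup-≢ τ (τ r) r≢l)
    back x (suc y) τ = ext-more 1 refl
      (weakenᵣ (≗-trans (ext-low b τ (x ∷ y ∷ []) _ r<b)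
          (ext-cong (λ l _ → cong (λ n → (τ [ r ↦ suc n ]) l) (ext-< τ (x ∷ y ∷ []) r<b)) (λ _ → refl)))
        (inc-triple {ext b τ (x ∷ y ∷ [])} r<k))
      (loop-post (ext-cong (λ l _ → trans (at-register (overwrite τ (suc (τ r)) _) l)
            (cong (λ n → (τ [ r ↦ n ]) l) (trans (cong (λ n → y + n) (lookup-≡ τ r (suc (τ r)))) (ℕₚ.+-suc y (τ r)))))
          (λ _ → refl))
        (back x y (τ [ r ↦ suc (τ r) ])))
    restored : ∀ l → l < b → ((σ [ r ↦ 0 ]) [ r ↦ σ r + 0 + (σ [ r ↦ 0 ]) r ]) l ≡ σ l
    restored l _ = trans (at-register (overwrite σ 0 _) l) (equal (r ℕ.≟ l))
      where
      total : σ r + 0 + (σ [ r ↦ 0 ]) r ≡ σ r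
      total = trans (cong (λ n → σ r + 0 + n) (lookup-≡ σ r 0)) (trans (ℕₚ.+-identityʳ (σ r + 0)) (ℕₚ.+-identityʳ (σ r)))
      equal : Dec (r ≡ l) → (σ [ r ↦ σ r + 0 + (σ [ r ↦ 0 ]) r ]) l ≡ σ l
      equal (yes refl) = trans (lookup-≡ σ r _) total
      equal (no r≢l) = lookup-≢ σ _ r≢l

  clearAll-triple : ∀ {m} (ys : Vec ℕ m) ws b σ → m + b ≤ k →
    ext b σ (Vec.toList ys ++ ws) ⟦ clearAll m b ⟧ ext b σ (List.replicate m 0 ++ ws)
  clearAll-triple [] ws b σ le = nop-triple
  clearAll-triple (y ∷ ys) ws b σ le =
    ext-clear (y ∷ Vec.toList ys ++ ws) 0 (ℕₚ.≤-trans (s≤s (ℕₚ.m≤n+m b _)) le) ⨾ᵣ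
    rebase (0 ∷ []) 1 refl (clearAll-triple ys ws (suc b) _ (ℕₚ.≤-trans (ℕₚ.≤-reflexive (ℕₚ.+-suc _ b)) le))

  mutual
    -- Induction on the evaluation, with the base and the lower registers arbitrary so that
    -- subprograms can run above intermediate results.
    compile-correct : ∀ {m} {c : Code m} {xs z} → Eval c xs z → ∀ b σ ins → Inputs b σ ins xs → scratch c + b ≤ k →
      ext b σ [] ⟦ compile c ins b ⟧ ext b σ (z ∷ [])
    compile-correct ev-zer b σ ins ok le = weakenᵣ (nth-cong⇒ext λ { zero → refl ; (suc _) → refl }) nop-triple
    compile-correct ev-succ b σ (i ∷ []) ok le =
      ext-copy (proj₁ (ok zero)) le ⨾ᵣ
      weakenᵣ (nth-cong⇒ext λ { zero → cong suc (proj₂ (ok zero)) ; (suc _) → refl }) (ext-inc 0 (ℕₚ.<-trans (ℕₚ.n<1+n b) le))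
    compile-correct (ev-proj {i = i}) b σ ins ok le =
      weakenᵣ (nth-cong⇒ext λ { zero → proj₂ (ok i) ; (suc _) → refl }) (ext-copy (proj₁ (ok i)) le)
    compile-correct {z = z} (ev-comp {m} {f = f} {gs} {xs} {ys} es e) b σ ins ok le =
      strengthen (nth-cong⇒ext λ { zero → refl ; (suc _) → refl })
        (rebase {σ = σ} (0 ∷ []) 1 refl
          (compileAll-correct es (suc b) (ext b σ (0 ∷ [])) ins (inputs-ext {σ = σ} {ins} {xs} 1 (0 ∷ []) ok)
            (fits (suc m + scratch f) (bound₁ m (scratchAll gs) (scratch f) b) le))) ⨾ᵣ
      strengthen (nth-cong⇒ext λ j → cong (λ vs → nth j vs) (sym (Listₚ.++-identityʳ args)))
        (rebase {σ = σ} args (suc m) args-length (compile-correct e (suc m + b) (ext b σ args) (interval (suc b) m) inputs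
          (fits (suc (scratchAll gs)) (bound₂ m (scratchAll gs) (scratch f) b) le))) ⨾ᵣ
      rebase {σ = σ} (0 ∷ []) 1 refl (clearAll-triple ys (z ∷ []) (suc b) (ext b σ (0 ∷ []))
        (fits (suc (scratchAll gs + scratch f)) (bound₃ m (scratchAll gs) (scratch f) b) le)) ⨾ᵣ
      weakenᵣ (nth-cong⇒ext λ { zero → trans (ℕₚ.+-identityʳ _) (nth-replicate-last m z) ; (suc j) → nth-put-last m z j })
        (ext-transfer (0 ∷ List.replicate m 0 ++ z ∷ []) (suc m) 0 (λ ())
          (fits (scratchAll gs + scratch f) (bound₄ m (scratchAll gs) (scratch f) b) le)
          (fits (suc m + (scratchAll gs + scratch f)) (bound₅ m (scratchAll gs) (scratch f) b) le))
      where
      args : List ℕ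
      args = 0 ∷ Vec.toList ys
      args-length : List.length args ≡ suc m
      args-length = cong suc (length-toList ys)
        where
        length-toList : ∀ {l} (vs : Vec ℕ l) → List.length (Vec.toList vs) ≡ l
        length-toList [] = refl
        length-toList (v ∷ vs) = cong suc (length-toList vs)
      inputs : Inputs (suc m + b) (ext b σ args) (interval (suc b) m) ys
      inputs i rewrite lookup-interval (suc b) i | ℕₚ.+-suc (toℕ i) b =
        s≤s (ℕₚ.+-monoˡ-< b (Finₚ.toℕ<n i)) , trans (ext-+ b σ args (suc (toℕ i))) (nth-toList ys i)
      bound₁ : ∀ m s t b → (s + suc b) + (suc m + t) ≡ 2 + m + (s + t) + b
      bound₁ = solve-∀
      bound₂ : ∀ m s t b → (t + (suc m + b)) + suc s ≡ 2 + m + (s + t) + b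
      bound₂ = solve-∀
      bound₃ : ∀ m s t b → (m + suc b) + suc (s + t) ≡ 2 + m + (s + t) + b
      bound₃ = solve-∀
      bound₄ : ∀ m s t b → suc (suc m + b) + (s + t) ≡ 2 + m + (s + t) + b
      bound₄ = solve-∀
      bound₅ : ∀ m s t b → suc b + (suc m + (s + t)) ≡ 2 + m + (s + t) + b
      bound₅ = solve-∀
    compile-correct (ev-prec-zero {f = f} {g} e) b σ (i ∷ ins) ok le = prec-correct (ev-prec-zero e) b σ i ins ok le
    compile-correct (ev-prec-suc {f = f} {g} e e′) b σ (i ∷ ins) ok le = prec-correct (ev-prec-suc e e′) b σ i ins ok le
    compile-correct (ev-mu {f = f} {xs} {y} e es) b σ ins ok le =
      ext-inc 1 1+b<k ⨾ᵣ loop-triple 1+b<k (search y 0 (ℕₚ.+-identityʳ y))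
      where
      1+b<k : suc b < k
      1+b<k = fits (suc (scratch f)) (bound (scratch f) b) le
        where
        bound : ∀ s b → suc (suc b) + suc s ≡ 3 + s + b
        bound = solve-∀
      2+b<k : suc (suc b) < k
      2+b<k = fits (scratch f) (bound (scratch f) b) le
        where
        bound : ∀ s b → suc (suc (suc b)) + s ≡ 3 + s + b
        bound = solve-∀
      b<k : b < k
      b<k = ℕₚ.<-trans (ℕₚ.n<1+n b) 1+b<k
      inputs : ∀ z → Inputs (2 + b) (ext b σ (z ∷ 0 ∷ [])) (b ∷ ins) (z ∷ xs)
      inputs z zero = s≤s (ℕₚ.n≤1+n b) , ext-+ b σ (z ∷ 0 ∷ []) 0
      inputs z (suc i) = inputs-ext {σ = σ} {ins} {xs} 2 (z ∷ 0 ∷ []) ok i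
      room : scratch f + (2 + b) ≤ k
      room = fits 1 (bound (scratch f) b) le
        where
        bound : ∀ s b → (s + (2 + b)) + 1 ≡ 3 + s + b
        bound = solve-∀
      search : ∀ d z → d + z ≡ y → Loop (suc b) (mu-body f ins b) (ext b σ (z ∷ 1 ∷ [])) (ext b σ (y ∷ []))
      search zero z refl = ext-more 1 refl
        (rebase {σ = σ} (z ∷ 0 ∷ []) 2 refl (compile-correct e (2 + b) (ext b σ (z ∷ 0 ∷ [])) (b ∷ ins) (inputs z) room) ⨾ᵣ
         loop-triple 2+b<k (ext-done {vs = z ∷ 0 ∷ 0 ∷ []} {ws = z ∷ 0 ∷ 0 ∷ []} 2 refl λ _ → refl))
        (ext-done 1 refl λ { zero → refl ; (suc zero) → refl ; (suc (suc zero)) → refl ; (suc (suc (suc _))) → refl })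
      search (suc d) z eq = ext-more 1 refl
        (rebase {σ = σ} (z ∷ 0 ∷ []) 2 refl
          (compile-correct (proj₂ (es z z<y)) (2 + b) (ext b σ (z ∷ 0 ∷ [])) (b ∷ ins) (inputs z) room) ⨾ᵣ
         loop-triple 2+b<k (ext-more 2 refl
           (ext-clear (z ∷ 0 ∷ _ ∷ []) 2 2+b<k ⨾ᵣ ext-inc 0 b<k ⨾ᵣ ext-inc 1 1+b<k)
           (ext-done {ws = suc z ∷ 1 ∷ []} 2 refl
             λ { zero → refl ; (suc zero) → refl ; (suc (suc zero)) → refl ; (suc (suc (suc _))) → refl })))
        (search d (suc z) (trans (ℕₚ.+-suc d z) eq))
        where
        z<y : z < y
        z<y = subst (z <_) eq (s≤s (ℕₚ.m≤n+m z d))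

    prec-correct : ∀ {m} {f : Code m} {g n xs w} → Eval (prec f g) (n ∷ xs) w → ∀ b σ i ins → Inputs b σ (i ∷ ins) (n ∷ xs) →
      4 + (scratch f + scratch g) + b ≤ k → ext b σ [] ⟦ compile (prec f g) (i ∷ ins) b ⟧ ext b σ (w ∷ [])
    prec-correct {f = f} {g} {n} {w = w} e b σ i ins ok le with prec-loop e b σ ins (λ j → ok (suc j)) le
    ... | w₀ , base , iterate =
      base ⨾ᵣ
      strengthen (nth-cong⇒ext λ { zero → refl ; (suc zero) → refl ; (suc (suc _)) → refl })
        (rebase {σ = σ} (w₀ ∷ 0 ∷ []) 2 refl (ext-copy {2 + b} (ℕₚ.≤-trans (proj₁ (ok zero)) (ℕₚ.m≤n+m b 2))
          (fits (scratch f + scratch g) (bound₁ (scratch f) (scratch g) b) le))) ⨾ᵣ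
      strengthen (nth-cong⇒ext λ { zero → refl ; (suc zero) → refl ; (suc (suc zero)) → count ; (suc (suc (suc _))) → refl })
        (loop-triple (fits (suc (scratch f + scratch g)) (bound₂ (scratch f) (scratch g) b) le)
          (iterate 0 (ext b σ (w ∷ n ∷ [])) (ext-done 2 refl
            λ { zero → refl ; (suc zero) → refl ; (suc (suc zero)) → refl ; (suc (suc (suc _))) → refl }))) ⨾ᵣ
      weakenᵣ (nth-cong⇒ext λ { zero → refl ; (suc zero) → refl ; (suc (suc _)) → refl })
        (ext-clear (w ∷ n ∷ []) 1 (fits (2 + (scratch f + scratch g)) (bound₃ (scratch f) (scratch g) b) le))
      where
      count : ext b σ (w₀ ∷ 0 ∷ []) i ≡ n + 0
      count = trans (ext-< σ _ (proj₁ (ok zero))) (trans (proj₂ (ok zero)) (sym (ℕₚ.+-identityʳ n)))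
      bound₁ : ∀ s t b → suc (suc (2 + b)) + (s + t) ≡ 4 + (s + t) + b
      bound₁ = solve-∀
      bound₂ : ∀ s t b → suc (2 + b) + suc (s + t) ≡ 4 + (s + t) + b
      bound₂ = solve-∀
      bound₃ : ∀ s t b → suc (1 + b) + (2 + (s + t)) ≡ 4 + (s + t) + b
      bound₃ = solve-∀

    -- The derivation for `prec` has the last round outermost, whereas `Loop` begins with the first.
    -- Hence the rounds are prepended to an arbitrary remaining execution, in which `r` rounds are
    -- still to come.
    prec-loop : ∀ {m} {f : Code m} {g n xs w} → Eval (prec f g) (n ∷ xs) w → ∀ b σ ins → Inputs b σ ins xs →
      4 + (scratch f + scratch g) + b ≤ k →
      ∃ λ w₀ → ext b σ [] ⟦ compile f ins b ⟧ ext b σ (w₀ ∷ []) ×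
        (∀ r υ → Loop (2 + b) (prec-body g ins b) (ext b σ (w ∷ n ∷ r ∷ [])) υ →
                 Loop (2 + b) (prec-body g ins b) (ext b σ (w₀ ∷ 0 ∷ n + r ∷ [])) υ)
    prec-loop {f = f} {g} (ev-prec-zero e) b σ ins ok le =
      _ , compile-correct e b σ ins ok (fits (4 + scratch g) (bound (scratch f) (scratch g) b) le) , λ r υ l → l
      where
      bound : ∀ s t b → (s + b) + (4 + t) ≡ 4 + (s + t) + b
      bound = solve-∀
    prec-loop {f = f} {g} {xs = xs} (ev-prec-suc {y = y} {w} {z} e e′) b σ ins ok le with prec-loop e b σ ins ok le
    ... | w₀ , base , iterate = w₀ , base , λ r υ l →
      subst (λ n → Loop (2 + b) (prec-body g ins b) (ext b σ (w₀ ∷ 0 ∷ n ∷ [])) υ) (ℕₚ.+-suc y r)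
        (iterate (suc r) υ (ext-more 2 refl
          (rebase {σ = σ} (w ∷ y ∷ r ∷ []) 3 refl
             (compile-correct e′ (3 + b) (ext b σ (w ∷ y ∷ r ∷ [])) (suc b ∷ b ∷ ins) (inputs r)
               (fits (suc (scratch f)) (bound₁ (scratch f) (scratch g) b) le)) ⨾ᵣ
           ext-clear (w ∷ y ∷ r ∷ z ∷ []) 0 (fits (3 + (scratch f + scratch g)) (bound₂ (scratch f) (scratch g) b) le) ⨾ᵣ
           ext-transfer (0 ∷ y ∷ r ∷ z ∷ []) 3 0 (λ ())
             (fits (scratch f + scratch g) (bound₃ (scratch f) (scratch g) b) le)
             (fits (3 + (scratch f + scratch g)) (bound₂ (scratch f) (scratch g) b) le) ⨾ᵣ
           ext-inc 1 (fits (2 + (scratch f + scratch g)) (bound₄ (scratch f) (scratch g) b) le))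
          (loop-pre (nth-cong⇒ext λ { zero → ℕₚ.+-identityʳ z ; (suc zero) → refl ; (suc (suc zero)) → refl
                                    ; (suc (suc (suc zero))) → refl ; (suc (suc (suc (suc _)))) → refl }) l)))
      where
      inputs : ∀ r → Inputs (3 + b) (ext b σ (w ∷ y ∷ r ∷ [])) (suc b ∷ b ∷ ins) (y ∷ w ∷ xs)
      inputs r zero = s≤s (s≤s (ℕₚ.n≤1+n b)) , ext-+ b σ (w ∷ y ∷ r ∷ []) 1
      inputs r (suc zero) = s≤s (ℕₚ.m≤n+m b 2) , ext-+ b σ (w ∷ y ∷ r ∷ []) 0
      inputs r (suc (suc i)) = inputs-ext {σ = σ} {ins} {xs} 3 (w ∷ y ∷ r ∷ []) ok i
      bound₁ : ∀ s t b → (t + (3 + b)) + suc s ≡ 4 + (s + t) + b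
      bound₁ = solve-∀
      bound₂ : ∀ s t b → suc b + (3 + (s + t)) ≡ 4 + (s + t) + b
      bound₂ = solve-∀
      bound₃ : ∀ s t b → suc (3 + b) + (s + t) ≡ 4 + (s + t) + b
      bound₃ = solve-∀
      bound₄ : ∀ s t b → suc (1 + b) + (2 + (s + t)) ≡ 4 + (s + t) + b
      bound₄ = solve-∀

    compileAll-correct : ∀ {l m} {gs : Vec (Code m) l} {xs ys} → EvalAll gs xs ys → ∀ b σ ins → Inputs b σ ins xs →
      scratchAll gs + b ≤ k → ext b σ [] ⟦ compileAll gs ins b ⟧ ext b σ (Vec.toList ys)
    compileAll-correct [] b σ ins ok le = nop-triple
    compileAll-correct (_∷_ {g = g} {gs} {xs} {y} e es) b σ ins ok le =
      compile-correct e b σ ins ok (fits (suc (scratchAll gs)) (bound₁ (scratch g) (scratchAll gs) b) le) ⨾ᵣ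
      rebase {σ = σ} (y ∷ []) 1 refl (compileAll-correct es (suc b) (ext b σ (y ∷ [])) ins
        (inputs-ext {σ = σ} {ins} {xs} 1 (y ∷ []) ok)
        (fits (scratch g) (bound₂ (scratch g) (scratchAll gs) b) le))
      where
      bound₁ : ∀ s t b → (s + b) + suc t ≡ suc (s + t) + b
      bound₁ = solve-∀
      bound₂ : ∀ s t b → (t + suc b) + s ≡ suc (s + t) + b
      bound₂ = solve-∀

-- Loading the input and reporting the result

chain : ℕ → Elem
chain zero = one
chain (suc i) = chain i ▸ b⁺

pos-chain : ∀ i → pos (chain i) ≡ + i
pos-chain zero = refl
pos-chain (suc i) = trans (cong up (pos-chain i)) (cong +_ (ℕₚ.+-comm i 1))

init-body : (k : ℕ) {{_ : NonZero k}} → Walker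
init-body k = while left ⨾ right ⨾ flipRight ⨾ while right ⨾ Registers.inc k 0 ⨾ left

-- Removes the input block 1 … D to the left of the registers one cell at a time, counting into register 0.
initialise : (k : ℕ) {{_ : NonZero k}} → Walker
initialise k = left ⨾ while (init-body k) ⨾ right

-- Lights the lamp at −2, to the left of the input block, as a permanent mark.
mark-left : Walker
mark-left = left ⨾ while left ⨾ left ⨾ flipRight ⨾ right ⨾ while right

opaque
  setup : (k : ℕ) {{_ : NonZero k}} → Code 1 → Walker
  setup k c = mark-left ⨾ initialise k ⨾ Compile.compile k c (0 ∷ []) 1 ⨾ repeat 1 right ⨾ repeat k right

program : (k : ℕ) {{_ : NonZero k}} → Code 1 → Walker
program k c = setup k c ⨾ while spin

<ᵇ-toggle : ∀ y v → toggleIf (suc y ≡ᵇ v) (y <ᵇ v) ≡ (suc y <ᵇ v)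
<ᵇ-toggle zero zero = refl
<ᵇ-toggle zero (suc zero) = refl
<ᵇ-toggle zero (suc (suc v)) = refl
<ᵇ-toggle (suc y) zero = refl
<ᵇ-toggle (suc y) (suc v) = <ᵇ-toggle y v

module Program (k : ℕ) {{_ : NonZero k}} (c : Code 1) (D : ℕ) (0<D : 0 < D) (fit : scratch c + 1 ≤ k) where
  H = suc D
  open Registers k
  open RegisterTriples k H
  open Compile k
  open CompileCorrect k H
  open CompileEval k H

  0<k : 0 < k
  0<k = ℕₚ.≤-trans (ℕₚ.m≤n+m 1 (scratch c)) fit

  1<k : 1 < k
  1<k = ℕₚ.≤-trans (ℕₚ.+-monoˡ-≤ 1 (0<scratch c)) fit
    where
    0<scratch : ∀ {m} (c : Code m) → 0 < scratch c
    0<scratch zer = s≤s z≤n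
    0<scratch succ = s≤s z≤n
    0<scratch (proj i) = s≤s z≤n
    0<scratch (comp f gs) = s≤s z≤n
    0<scratch (prec f g) = s≤s z≤n
    0<scratch (mu f) = s≤s z≤n

  counter : ℕ → State
  counter y = (λ _ → 0) [ 0 ↦ y ]

  -- Invariant: `y` input cells have been put out, from the left, and counted. What remains is one
  -- block ending just before the registers, so both of its ends can be found by scanning.
  init-loop : ∀ x y → x + y ≡ D →
    tracks (y <ᵇ_) (counter y) , D ⟪ while (init-body k) ⟫ tracks (D <ᵇ_) (counter D) , D
  init-loop zero y refl = while-exit (trans (tracks-left (y <ᵇ_) (counter y) (ℕₚ.n<1+n y)) (dec-false (y ℕ.<? y) (ℕₚ.<-irrefl refl)))
  init-loop (suc x) y refl = while-step
    (trans (tracks-left (y <ᵇ_) (counter y) (ℕₚ.n<1+n _)) (dec-true (y ℕ.<? suc x + y) (s≤s (ℕₚ.m≤n+m y x))))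
    (scan-left (suc x) y
       (λ i lt → trans (tracks-left (y <ᵇ_) (counter y) (s≤s (ℕₚ.+-monoˡ-≤ y lt))) (dec-true (y ℕ.<? suc i + y) (s≤s (ℕₚ.m≤n+m y i))))
       (trans (tracks-left (y <ᵇ_) (counter y) (s≤s (ℕₚ.m≤n+m y (suc x)))) (dec-false (y ℕ.<? y) (ℕₚ.<-irrefl refl))) ⨾ₜ
     right-triple ⨾ₜ
     weaken shorten (flip-triple (off-tape (suc y))) ⨾ₜ
     subst (λ u → rest , suc (suc y) ⟪ while right ⟫ rest , u) to-H
       (scan-right x (suc (suc y))
         (λ i lt → trans (tracks-left (suc y <ᵇ_) (counter y) (subst (_< H) (sym (shift i y)) (s≤s (s≤s (ℕₚ.+-monoˡ-≤ y lt)))))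
            (dec-true (suc y ℕ.<? i + suc (suc y)) (ℕₚ.m≤n+m (suc (suc y)) i)))
         -- Cell `H` is row 0 of register 0 and always dark; it ends the scan to the right.
         (trans (cong rest to-H) (tracks-addr (suc y <ᵇ_) (counter y) 0 0<k))) ⨾ₜ
     exec (weakenᵣ {τ = counter y [ 0 ↦ suc y ]} {counter (suc y)} (pointwise λ { zero → refl ; (suc _) → refl }) (inc-triple {counter y} {0} 0<k)) (suc y <ᵇ_) ⨾ₜ
     left-triple)
    (init-loop x (suc y) (ℕₚ.+-suc x y))
    where
    rest : Tape
    rest = tracks (suc y <ᵇ_) (counter y)
    shift : ∀ i y → i + suc (suc y) ≡ suc (suc (i + y))
    shift i y = trans (ℕₚ.+-suc i (suc y)) (cong suc (ℕₚ.+-suc i y))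
    to-H : x + suc (suc y) ≡ H
    to-H = shift x y
    shorten : ∀ v → toggle (suc y) (tracks (y <ᵇ_) (counter y)) v ≡ rest v
    shorten v with position v
    ... | left-of v<H = trans (cong (toggleIf (suc y ≡ᵇ v)) (tracks-left (y <ᵇ_) (counter y) v<H))
                          (trans (<ᵇ-toggle y v) (sym (tracks-left (suc y <ᵇ_) (counter y) v<H)))
    ... | at-addr {j} i j<k rewrite dec-false (suc y ℕ.≟ addr j i)
            (λ e → addr≮H j i (subst (_< H) e (s≤s (s≤s (ℕₚ.m≤n+m y x))))) =
          trans (tracks-addr (y <ᵇ_) (counter y) i j<k) (sym (tracks-addr (suc y <ᵇ_) (counter y) i j<k))

  -- Before the mark is lit, the first input lamp, at 0, is the one that stays lit. The tape begins
  -- one lamp further left, so that lighting the mark is a flip of cell 0.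
  module Before = Runs (+ 0) -[1+ 1 ]

  block-tape : ℕ → Tape
  block-tape i v = (1 <ᵇ v) ∧ (v <ᵇ suc (suc i))

  cells-chain : ∀ i v → lamp (lamps (chain i)) (cell -[1+ 1 ] v) ≡ block-tape i v
  cells-chain zero zero = refl
  cells-chain zero (suc zero) = refl
  cells-chain zero (suc (suc v)) = refl
  cells-chain (suc i) v = trans (Before.flip-cells {g = chain i} {suc (suc i)} (pos-chain i) (cells-chain i) v) (extend v)
    where
    grow : ∀ i v → toggleIf (i ≡ᵇ v) (v <ᵇ i) ≡ (v <ᵇ suc i)
    grow zero zero = refl
    grow zero (suc v) = refl
    grow (suc i) zero = refl
    grow (suc i) (suc v) = grow i v
    extend : ∀ v → toggle (suc (suc i)) (block-tape i) v ≡ block-tape (suc i) v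
    extend zero = refl
    extend (suc zero) = refl
    extend (suc (suc v)) = grow i v

  mark-triple : block-tape D Before., suc (suc D) ⟪ mark-left ⟫ toggle 0 (block-tape D) , suc (suc D)
  mark-triple =
    Before.left-triple Before.⨾ₜ
    subst (λ u → block-tape D Before., u ⟪ while left ⟫ block-tape D , 1) (ℕₚ.+-comm D 1) (Before.scan-left D 1 lit-left refl) Before.⨾ₜ
    Before.left-triple Before.⨾ₜ Before.flip-triple (λ ()) Before.⨾ₜ Before.right-triple Before.⨾ₜ
    subst (λ u → toggle 0 (block-tape D) Before., 2 ⟪ while right ⟫ toggle 0 (block-tape D) , u) (ℕₚ.+-comm D 2)
      (Before.scan-right D 2 lit-right (trans (cong (toggle 0 (block-tape D)) (ℕₚ.+-comm D 2)) (dec-false (D ℕ.<? D) (ℕₚ.<-irrefl refl))))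
    where
    lit-left : ∀ i → i < D → block-tape D (suc i + 1) ≡ true
    lit-left i i<D rewrite ℕₚ.+-comm i 1 = dec-true (i ℕ.<? D) i<D
    lit-right : ∀ i → i < D → toggle 0 (block-tape D) (i + 2) ≡ true
    lit-right i i<D rewrite ℕₚ.+-comm i 2 = dec-true (i ℕ.<? D) i<D

  start-before : Before.Holds (chain D) (block-tape D) (suc (suc D))
  start-before = Before.holds (trans (cells-chain D 2) (dec-true (0 ℕ.<? D) 0<D)) (pos-chain D) (cells-chain D)

  cell-shift : ∀ v → cell -[1+ 1 ] (suc v) ≡ cell -[1+ 0 ] v
  cell-shift zero = refl
  cell-shift (suc v) = refl

  start : ∃ λ g → Path mark-left (entry mark-left) (chain D) nothing g × Holds g (tracks (0 <ᵇ_) (counter 0)) H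
  start = case Before.run mark-triple start-before of λ where
      (g , p , Before.holds _ e c) → g , p , holds (c 0) (trans e (cell-shift H))
        λ v → trans (cong (lamp (lamps g)) (sym (cell-shift v))) (trans (c (suc v)) (agree v))
    where
    dark : ∀ i l → lit i (counter 0 l) ≡ false
    dark zero l = refl
    dark (suc i) zero = refl
    dark (suc i) (suc l) = refl
    agree : ∀ v → (0 <ᵇ v) ∧ (v <ᵇ H) ≡ tracks (0 <ᵇ_) (counter 0) v
    agree v with position v
    ... | left-of v<H = trans (cong ((0 <ᵇ v) ∧_) (dec-true (v ℕ.<? H) v<H))
                          (trans (Boolₚ.∧-identityʳ (0 <ᵇ v)) (sym (tracks-left (0 <ᵇ_) (counter 0) v<H)))
    ... | at-addr {j} i j<k = trans (trans (cong ((0 <ᵇ addr j i) ∧_) (dec-false (addr j i ℕ.<? H) (addr≮H j i)))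
                          (Boolₚ.∧-zeroʳ (0 <ᵇ addr j i))) (sym (trans (tracks-addr (0 <ᵇ_) (counter 0) i j<k) (dark i j)))

  compute : Walker
  compute = initialise k ⨾ compile c (0 ∷ []) 1 ⨾ repeat 1 right ⨾ repeat k right

  compute-triple : ∀ {z} → Eval c (D ∷ []) z →
    tracks (0 <ᵇ_) (counter 0) , H ⟪ compute ⟫ tracks (D <ᵇ_) (ext 1 (counter D) (z ∷ [])) , addr 1 1
  compute-triple e = (left-triple ⨾ₜ init-loop D 0 (ℕₚ.+-identityʳ D) ⨾ₜ right-triple) ⨾ₜ
    exec (strengthen (≡-ext (λ _ _ → refl) (λ j → cong (counter D) (ℕₚ.+-comm j 1)))
      (compile-correct e 1 (counter D) (0 ∷ []) (λ { zero → s≤s z≤n , refl }) fit)) (D <ᵇ_) ⨾ₜ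
    repeat-right 1 ⨾ₜ row-up 1 0

  -- In unary the first cell tells zero from nonzero, so this one lamp decides whether the final
  -- `while spin` is left or entered.
  result : ∀ z → tracks (D <ᵇ_) (ext 1 (counter D) (z ∷ [])) (addr 1 1) ≡ (0 <ᵇ z)
  result z = trans (tracks-addr (D <ᵇ_) (ext 1 (counter D) (z ∷ [])) 1 1<k) (cong (0 <ᵇ_) (ext-+ 1 (counter D) (z ∷ []) 0))

  opaque
    unfolding setup
    set-up : ∀ {z} → Eval c (D ∷ []) z → ∃ λ g → Path (setup k c) (entry (setup k c)) (chain D) nothing g ×
      Holds g (tracks (D <ᵇ_) (ext 1 (counter D) (z ∷ []))) (addr 1 1)
    set-up e = case start of λ where
      (_ , p , h₁) → case run (compute-triple e) h₁ of λ where
        (_ , q , h₂) → _ , (path-⨾ˡ mark-left compute p ▹▹ path-⨾ʳ mark-left compute q) , h₂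

  exits : Eval c (D ∷ []) 0 → ∃ λ h → Path (program k c) (entry (program k c)) (chain D) nothing h
  exits e = case set-up e of λ where
    (_ , p , h₁) → case run (while-exit {spin} (result 0)) h₁ of λ where
      (h , q , _) → h , (path-⨾ˡ (setup k c) (while spin) p ▹▹ path-⨾ʳ (setup k c) (while spin) q)

  spins : ∀ {z} → Eval c (D ∷ []) (suc z) → ∃ λ h →
    Path (program k c) (entry (program k c)) (chain D) (just (size′ (setup k c) ↑ʳ (3 ↑ʳ zero))) h × Lit h
  spins {z} e = case set-up e of λ where
    (_ , p , h₁) → case while-enter spin (result (suc z)) h₁ of λ where
      (h , q , h₂) → h , (path-⨾ˡ (setup k c) (while spin) p ▹▹ path-⨾ʳ (setup k c) (while spin) q) , holds-lit h₂

-- Computing the code of an instance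

-- A function together with a code and its correctness. With such combinators the program computing
-- `encoding` is written as plain arithmetic.
record Exp {k} (e : Vec ℕ k → ℕ) : Set where
  constructor expr
  field
    codeₑ : Code k
    evₑ   : ∀ xs → Eval codeₑ xs (e xs)
open Exp

record Fun₁ (f : ℕ → ℕ) : Set where
  constructor fun₁
  field
    code₁ : Code 1
    ev₁   : ∀ x → Eval code₁ (x ∷ []) (f x)
open Fun₁ public

record Fun₂ (f : ℕ → ℕ → ℕ) : Set where
  constructor fun₂
  field
    code₂ : Code 2
    ev₂   : ∀ x y → Eval code₂ (x ∷ y ∷ []) (f x y)
open Fun₂

record Fun₄ (f : ℕ → ℕ → ℕ → ℕ → ℕ) : Set where
  constructor fun₄
  field
    code₄ : Code 4
    ev₄   : ∀ x y z w → Eval code₄ (x ∷ y ∷ z ∷ w ∷ []) (f x y z w)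
open Fun₄

var : ∀ {k} (i : Fin k) → Exp (λ xs → Vec.lookup xs i)
var i = expr (proj i) (λ xs → ev-proj)

infixl 6 _$₁_
_$₁_ : ∀ {f k} {e : Vec ℕ k → ℕ} → Fun₁ f → Exp e → Exp (λ xs → f (e xs))
fun₁ c v $₁ expr d w = expr (comp c (d ∷ [])) (λ xs → ev-comp (w xs ∷ []) (v _))

call₂ : ∀ {f k} {e e′ : Vec ℕ k → ℕ} → Fun₂ f → Exp e → Exp e′ → Exp (λ xs → f (e xs) (e′ xs))
call₂ (fun₂ c v) (expr d w) (expr d′ w′) = expr (comp c (d ∷ d′ ∷ [])) (λ xs → ev-comp (w xs ∷ w′ xs ∷ []) (v _ _))

call₄ : ∀ {f k} {e₁ e₂ e₃ e₄ : Vec ℕ k → ℕ} → Fun₄ f → Exp e₁ → Exp e₂ → Exp e₃ → Exp e₄ →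
  Exp (λ xs → f (e₁ xs) (e₂ xs) (e₃ xs) (e₄ xs))
call₄ (fun₄ c v) (expr d₁ w₁) (expr d₂ w₂) (expr d₃ w₃) (expr d₄ w₄) =
  expr (comp c (d₁ ∷ d₂ ∷ d₃ ∷ d₄ ∷ [])) (λ xs → ev-comp (w₁ xs ∷ w₂ xs ∷ w₃ xs ∷ w₄ xs ∷ []) (v _ _ _ _))

toFun₁ : ∀ {e} → Exp {1} e → Fun₁ (λ x → e (x ∷ []))
toFun₁ (expr c v) = fun₁ c (λ x → v _)

toFun₂ : ∀ {e} → Exp {2} e → Fun₂ (λ x y → e (x ∷ y ∷ []))
toFun₂ (expr c v) = fun₂ c (λ x y → v _)

toFun₄ : ∀ {e} → Exp {4} e → Fun₄ (λ x y z w → e (x ∷ y ∷ z ∷ w ∷ []))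
toFun₄ (expr c v) = fun₄ c (λ x y z w → v _)

sucF : Fun₁ suc
sucF = fun₁ succ (λ x → ev-succ)

lit : ∀ {k} n → Exp {k} (λ _ → n)
lit zero = expr zer (λ _ → ev-zer)
lit (suc n) = sucF $₁ lit n

-- The function is given first and the code is checked against its two recursion equations, so the
-- functions below keep their natural definitions.
recursion : ∀ {k z s} (f : ℕ → Vec ℕ k → ℕ) → Exp z → Exp s →
  (∀ xs → z xs ≡ f 0 xs) → (∀ n xs → s (n ∷ f n xs ∷ xs) ≡ f (suc n) xs) →
  Exp {suc k} (λ xs → f (Vec.head xs) (Vec.tail xs))
recursion {k} f (expr c v) (expr d w) z≡ s≡ = expr (prec c d) (λ { (n ∷ xs) → go n xs })
  where
  go : ∀ n xs → Eval (prec c d) (n ∷ xs) (f n xs)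
  go zero xs = subst (Eval _ _) (z≡ xs) (ev-prec-zero (v xs))
  go (suc n) xs = subst (Eval _ _) (s≡ n xs) (ev-prec-suc (go n xs) (w _))

v₀ : ∀ {k} → Exp {suc k} (λ xs → Vec.lookup xs zero)
v₀ = var zero
v₁ : ∀ {k} → Exp {suc (suc k)} (λ xs → Vec.lookup xs (suc zero))
v₁ = var (suc zero)
v₂ : ∀ {k} → Exp {suc (suc (suc k))} (λ xs → Vec.lookup xs (suc (suc zero)))
v₂ = var (suc (suc zero))
v₃ : ∀ {k} → Exp {suc (suc (suc (suc k)))} (λ xs → Vec.lookup xs (suc (suc (suc zero))))
v₃ = var (suc (suc (suc zero)))

iterate₁ : ∀ {s} (f : ℕ → ℕ) → Exp {2} s → (∀ n → s (n ∷ f n ∷ []) ≡ f (suc n)) → Fun₁ f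
iterate₁ f e s≡ = toFun₁ (recursion (λ n _ → f n) (lit (f 0)) e (λ _ → refl) (λ { n [] → s≡ n }))

iterate₂ : ∀ {z s} (f : ℕ → ℕ → ℕ) → Exp {1} z → Exp {3} s →
  (∀ x → z (x ∷ []) ≡ f 0 x) → (∀ n x → s (n ∷ f n x ∷ x ∷ []) ≡ f (suc n) x) → Fun₂ f
iterate₂ f z e z≡ s≡ = toFun₂ (recursion (λ n xs → f n (Vec.head xs)) z e (λ { (x ∷ []) → z≡ x }) (λ { n (x ∷ []) → s≡ n x }))

swap₂ : ∀ {f} → Fun₂ f → Fun₂ (λ x y → f y x)
swap₂ f = toFun₂ (call₂ f v₁ v₀)

plusF : Fun₂ _+_
plusF = iterate₂ _+_ v₀ (sucF $₁ v₁) (λ _ → refl) (λ _ _ → refl)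

infixl 6 _+ₑ_ _∸ₑ_
infixl 7 _*ₑ_

_+ₑ_ : ∀ {k} {e e′ : Vec ℕ k → ℕ} → Exp e → Exp e′ → Exp (λ xs → e xs + e′ xs)
_+ₑ_ = call₂ plusF

_*ₑ_ : ∀ {k} {e e′ : Vec ℕ k → ℕ} → Exp e → Exp e′ → Exp (λ xs → e xs * e′ xs)
_*ₑ_ = call₂ (iterate₂ _*_ (lit 0) (v₂ +ₑ v₁) (λ _ → refl) (λ _ _ → refl))

predF : Fun₁ pred
predF = iterate₁ pred v₀ (λ _ → refl)

_∸ₑ_ : ∀ {k} {e e′ : Vec ℕ k → ℕ} → Exp e → Exp e′ → Exp (λ xs → e xs ∸ e′ xs)
_∸ₑ_ = call₂ (swap₂ (iterate₂ (λ y x → x ∸ y) v₀ (predF $₁ v₁) (λ _ → refl) (λ y x → ℕₚ.pred[m∸n]≡m∸[1+n] x y)))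

2^F : Fun₁ (2 ^_)
2^F = iterate₁ (2 ^_) (lit 2 *ₑ v₁) (λ _ → refl)

dist eqN : ℕ → ℕ → ℕ
dist x y = (x ∸ y) + (y ∸ x)
eqN x y = 1 ∸ dist x y

distF : Fun₂ dist
distF = toFun₂ ((v₀ ∸ₑ v₁) +ₑ (v₁ ∸ₑ v₀))

eqF : Fun₂ eqN
eqF = toFun₂ (lit 1 ∸ₑ call₂ distF v₀ v₁)

parity half : ℕ → ℕ
parity zero = 0
parity (suc n) = 1 ∸ parity n
half zero = 0
half (suc n) = half n + parity n

parityF : Fun₁ parity
parityF = iterate₁ parity (lit 1 ∸ₑ v₁) (λ _ → refl)

halfF : Fun₁ half
halfF = iterate₁ half (v₁ +ₑ (parityF $₁ v₀)) (λ _ → refl)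

shift : ℕ → ℕ → ℕ
shift zero D = D
shift (suc j) D = half (shift j D)

bit : ℕ → ℕ → ℕ
bit j D = parity (shift j D)

bitF : Fun₂ bit
bitF = toFun₂ (parityF $₁ call₂ (iterate₂ shift v₀ (halfF $₁ v₁) (λ _ → refl) (λ _ _ → refl)) v₀ v₁)

-- Remainder and quotient by `D`, as a counter that wraps around at `D` and the number of its wraps;
-- this form is primitive recursive in the dividend.
rem quo : ℕ → ℕ → ℕ
rem zero D = 0
rem (suc x) D = suc (rem x D) * (1 ∸ eqN (suc (rem x D)) D)
quo zero D = 0
quo (suc x) D = quo x D + eqN (suc (rem x D)) D

remF : Fun₂ rem
remF = iterate₂ rem (lit 0) ((sucF $₁ v₁) *ₑ (lit 1 ∸ₑ call₂ eqF (sucF $₁ v₁) v₂)) (λ _ → refl) (λ _ _ → refl)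

quoF : Fun₂ quo
quoF = iterate₂ quo (lit 0) (v₁ +ₑ call₂ eqF (sucF $₁ call₂ remF v₀ v₂) v₂) (λ _ → refl) (λ _ _ → refl)

-- Pairing without the final subtraction: as the address of a bit it has to be injective, not
-- surjective.
index : ℕ → ℕ → ℕ
index x y = 2 ^ x * (2 * y + 1)

indexF : Fun₂ index
indexF = toFun₂ ((2^F $₁ v₀) *ₑ (lit 2 *ₑ v₁ +ₑ lit 1))

index₃ : ℕ → ℕ → ℕ → ℕ
index₃ s x y = index s (index x y)

-- Tile x of the D-th instance is the base tile rem x D with counter quo x D. The base table is stored in
-- the bits of D, with the table for tiles of counter 1 at generator numbers shifted by 4. A counter above 1
-- decreases along b⁺, which is generator number 2.
test : ℕ → ℕ → ℕ → ℕ → ℕ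
test D x s y =
  bit (index₃ (s + 4 * eqN (quo x D) 1) (rem x D) (rem y D)) D *
  (1 ∸ eqN s 2 * (pred (quo x D) * dist (quo y D) (pred (quo x D))))

testF : Fun₄ test
testF = toFun₄ (
  call₂ bitF (call₂ indexF (v₂ +ₑ lit 4 *ₑ call₂ eqF qx (lit 1)) (call₂ indexF (call₂ remF v₁ v₀) (call₂ remF v₃ v₀))) v₀ *ₑ
  (lit 1 ∸ₑ call₂ eqF v₂ (lit 2) *ₑ ((predF $₁ qx) *ₑ call₂ distF (call₂ quoF v₃ v₀) (predF $₁ qx))))
  where
  qx = call₂ quoF v₁ v₀

-- The number whose binary digits, lowest first, consist of `n` words of length `l` with values
-- `F 0`, `F 1`, and so on.
blocks : ℕ → ℕ → (ℕ → ℕ) → ℕ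
blocks l zero F = 0
blocks l (suc n) F = blocks l n F + 2 ^ (l * n) * F n

lookups : ∀ {k m} (r : Fin m → Fin k) xs → EvalAll (Vec.tabulate (proj ∘ r)) xs (Vec.tabulate (Vec.lookup xs ∘ r))
lookups {m = zero} r xs = []
lookups {m = suc m} r xs = ev-proj ∷ lookups (r ∘ suc) xs

blocksE : ∀ {k} {l n : Vec ℕ k → ℕ} {F : Vec ℕ (suc k) → ℕ} → Exp l → Exp n → Exp F →
  Exp (λ xs → blocks (l xs) (n xs) (λ j → F (j ∷ xs)))
blocksE {k} {l} {n} {F} lE (expr c v) FE = expr (comp (codeₑ total) (c ∷ Vec.tabulate proj)) λ xs →
    ev-comp (v xs ∷ subst (EvalAll _ xs) (tabulate∘lookup xs) (lookups id xs)) (evₑ total (n xs ∷ xs))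
  where
  skip : Fin k → Fin (suc (suc k))
  skip i = suc (suc i)
  skipped : ∀ (j a : ℕ) xs → EvalAll (Vec.tabulate (proj ∘ skip)) (j ∷ a ∷ xs) xs
  skipped j a xs = subst (EvalAll _ _) (tabulate∘lookup xs) (lookups skip (j ∷ a ∷ xs))
  lE′ : Exp (λ xs → l (Vec.tail (Vec.tail xs)))
  lE′ = expr (comp (codeₑ lE) (Vec.tabulate (proj ∘ skip))) λ { (j ∷ a ∷ xs) → ev-comp (skipped j a xs) (evₑ lE xs) }
  FE′ : Exp (λ xs → F (Vec.head xs ∷ Vec.tail (Vec.tail xs)))
  FE′ = expr (comp (codeₑ FE) (proj zero ∷ Vec.tabulate (proj ∘ skip))) λ { (j ∷ a ∷ xs) → ev-comp (ev-proj ∷ skipped j a xs) (evₑ FE (j ∷ xs)) }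
  total : Exp (λ xs → blocks (l (Vec.tail xs)) (Vec.head xs) (λ j → F (j ∷ Vec.tail xs)))
  total = recursion (λ m xs → blocks (l xs) m (λ j → F (j ∷ xs))) (lit 0)
    (v₁ +ₑ (2^F $₁ (lE′ *ₑ v₀)) *ₑ FE′) (λ _ → refl) (λ _ _ → refl)

genAt : Fin 4 → Gen
genAt zero = a⁺
genAt (suc zero) = a⁻
genAt (suc (suc zero)) = b⁺
genAt (suc (suc (suc zero))) = b⁻

number : Gen → ℕ
number a⁺ = 0
number a⁻ = 1
number b⁺ = 2
number b⁻ = 3

-- Base tiles below `D` with counters 0 to D + 1 need (D + 2) D numbers. One more keeps the set
-- inhabited when `D` is 0.
tiles : ℕ → ℕ
tiles D = suc (suc (suc D) * D)

-- Base tile 0 with counter D + 1, so that the counter has come down to 1 exactly at b^D.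
seed : ∀ D → Fin (tiles D)
seed D = fromℕ< {suc D * D} (s≤s (ℕₚ.m≤n+m (suc D * D) D))

instanceOf : ℕ → Instance
instanceOf D = record
  { size = tiles D
  ; Π    = λ x s y → test D (toℕ x) (number s) (toℕ y) ≡ᵇ 1
  ; a₀   = seed D
  }

tableNumber : ℕ → ℕ
tableNumber D = blocks (4 * tiles D) (tiles D) λ x → blocks (tiles D) 4 λ s → blocks 1 (tiles D) λ y → eqN (test D x s y) 1

encoding : ℕ → ℕ
encoding D = pair (tiles D) (pair (suc D * D) (tableNumber D))

encodingF : Fun₁ encoding
encodingF = toFun₁ (call₂ pairF nE (call₂ pairF ((sucF $₁ v₀) *ₑ v₀)
    (blocksE (lit 4 *ₑ nE) nE (blocksE (toTiles v₁) (lit 4) (blocksE (lit 1) (toTiles v₂)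
      (call₂ eqF (call₄ testF v₃ v₂ v₁ v₀) (lit 1)))))))
  where
  pairF : Fun₂ pair
  pairF = toFun₂ ((2^F $₁ v₀) *ₑ (lit 2 *ₑ v₁ +ₑ lit 1) ∸ₑ lit 1)
  toTiles : ∀ {k} {e : Vec ℕ k → ℕ} → Exp e → Exp (λ xs → tiles (e xs))
  toTiles e = sucF $₁ ((sucF $₁ (sucF $₁ e)) *ₑ e)
  nE : Exp {1} (λ xs → tiles (Vec.lookup xs zero))
  nE = toTiles v₀

bitsToℕ-++ : ∀ xs ys → bitsToℕ (xs ++ ys) ≡ bitsToℕ xs + 2 ^ List.length xs * bitsToℕ ys
bitsToℕ-++ [] ys = sym (ℕₚ.+-identityʳ _)
bitsToℕ-++ (false ∷ xs) ys rewrite bitsToℕ-++ xs ys = lemma (bitsToℕ xs) (2 ^ List.length xs) (bitsToℕ ys)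
  where
  lemma : ∀ x p y → 2 * (x + p * y) ≡ 2 * x + 2 * p * y
  lemma = solve-∀
bitsToℕ-++ (true ∷ xs) ys rewrite bitsToℕ-++ xs ys = lemma (bitsToℕ xs) (2 ^ List.length xs) (bitsToℕ ys)
  where
  lemma : ∀ x p y → suc (2 * (x + p * y)) ≡ suc (2 * x) + 2 * p * y
  lemma = solve-∀

-- Recursion adds the last block, whereas `concatMap` begins with the first; this reconciles the two
-- orders.
blocks-suc : ∀ l n F → blocks l (suc n) F ≡ F 0 + 2 ^ l * blocks l n (F ∘ suc)
blocks-suc l zero F rewrite ℕₚ.*-zeroʳ l | ℕₚ.*-zeroʳ (2 ^ l) | ℕₚ.+-identityʳ (F 0) = refl
blocks-suc l (suc n) F = begin
  blocks l (suc n) F + 2 ^ (l * suc n) * F (suc n) ≡⟨ cong₂ _+_ (blocks-suc l n F) (cong (_* F (suc n)) power) ⟩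
  (F 0 + 2 ^ l * blocks l n (F ∘ suc)) + 2 ^ l * 2 ^ (l * n) * F (suc n)
    ≡⟨ lemma (F 0) (2 ^ l) (blocks l n (F ∘ suc)) (2 ^ (l * n)) (F (suc n)) ⟩
  F 0 + 2 ^ l * (blocks l n (F ∘ suc) + 2 ^ (l * n) * F (suc n)) ∎
  where
  open ≡-Reasoning
  power : 2 ^ (l * suc n) ≡ 2 ^ l * 2 ^ (l * n)
  power = trans (cong (2 ^_) (ℕₚ.*-suc l n)) (ℕₚ.^-distribˡ-+-* 2 l (l * n))
  lemma : ∀ a p b q c → (a + p * b) + p * q * c ≡ a + p * (b + q * c)
  lemma = solve-∀

concatMap-bits : ∀ {A : Set} l n (h : Fin n → A) (g : A → List Bool) F →
  (∀ i → List.length (g (h i)) ≡ l) → (∀ i → bitsToℕ (g (h i)) ≡ F (toℕ i)) →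
  bitsToℕ (concatMap g (tabulate h)) ≡ blocks l n F
concatMap-bits l zero h g F len val = refl
concatMap-bits l (suc n) h g F len val = trans (bitsToℕ-++ (g (h zero)) _)
  (trans (cong₂ _+_ (val zero) (cong₂ _*_ (cong (2 ^_) (len zero))
      (concatMap-bits l n (h ∘ suc) g (F ∘ suc) (len ∘ suc) (val ∘ suc))))
    (sym (blocks-suc l n F)))

concatMap-length : ∀ {A : Set} l n (h : Fin n → A) (g : A → List Bool) →
  (∀ i → List.length (g (h i)) ≡ l) → List.length (concatMap g (tabulate h)) ≡ n * l
concatMap-length l zero h g len = refl
concatMap-length l (suc n) h g len = trans (Listₚ.length-++ (g (h zero))) (cong₂ _+_ (len zero) (concatMap-length l n (h ∘ suc) g (len ∘ suc)))

map-bits : ∀ n (f : Fin n → Bool) F → (∀ i → bitsToℕ (f i ∷ []) ≡ F (toℕ i)) → bitsToℕ (map f (allFin n)) ≡ blocks 1 n F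
map-bits n f F val = trans (cong bitsToℕ (singletons (allFin n))) (concatMap-bits 1 n id (λ i → f i ∷ []) F (λ _ → refl) val)
  where
  singletons : ∀ xs → map f xs ≡ concatMap (λ i → f i ∷ []) xs
  singletons [] = refl
  singletons (x ∷ xs) = cong (f x ∷_) (singletons xs)

truth : ∀ t → bitsToℕ ((t ≡ᵇ 1) ∷ []) ≡ eqN t 1
truth zero = refl
truth (suc zero) = refl
truth (suc (suc t)) = sym (ℕₚ.0∸n≡0 (t + 0))

table-bits : ∀ D → bitsToℕ (table (tiles D) (Π (instanceOf D))) ≡ tableNumber D
table-bits D =
  concatMap-bits (4 * n) n id rows (λ x → blocks n 4 λ s → blocks 1 n λ y → eqN (test D x s y) 1)
    (λ x → concatMap-length n 4 genAt (row x) (row-length x))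
    λ x → concatMap-bits n 4 genAt (row x) (λ s → blocks 1 n λ y → eqN (test D (toℕ x) s y) 1) (row-length x) λ s →
      map-bits n (λ y → test D (toℕ x) (number (genAt s)) (toℕ y) ≡ᵇ 1) (λ y → eqN (test D (toℕ x) (toℕ s) y) 1)
        λ y → trans (truth (test D (toℕ x) (number (genAt s)) (toℕ y)))
          (cong (λ m → eqN (test D (toℕ x) m (toℕ y)) 1) (number-genAt s))
  where
  n = tiles D
  row : Fin n → Gen → List Bool
  row x s = map (λ y → test D (toℕ x) (number s) (toℕ y) ≡ᵇ 1) (allFin n)
  rows : Fin n → List Bool
  rows x = concatMap (row x) allGen
  row-length : ∀ x s → List.length (row x (genAt s)) ≡ n
  row-length x s = trans (Listₚ.length-map _ (allFin n)) (Listₚ.length-tabulate id)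
  number-genAt : ∀ s → number (genAt s) ≡ toℕ s
  number-genAt zero = refl
  number-genAt (suc zero) = refl
  number-genAt (suc (suc zero)) = refl
  number-genAt (suc (suc (suc zero))) = refl

toℕ-seed : ∀ D → toℕ (seed D) ≡ suc D * D
toℕ-seed D = Finₚ.toℕ-fromℕ< {suc D * D} (s≤s (ℕₚ.m≤n+m (suc D * D) D))

encode-instanceOf : ∀ D → encode (instanceOf D) ≡ encoding D
encode-instanceOf D = cong₂ (λ a t → pair (tiles D) (pair a t)) (toℕ-seed D) (table-bits D)

-- Finite relations as numbers

2*suc : ∀ n → 2 * suc n ≡ suc (suc (2 * n))
2*suc = solve-∀

parity-double : ∀ n → parity (2 * n) ≡ 0
parity-double zero = refl
parity-double (suc n) = trans (cong parity (2*suc n)) (cong (λ p → 1 ∸ (1 ∸ p)) (parity-double n))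

half-double : ∀ n → half (2 * n) ≡ n
half-double zero = refl
half-double (suc n) = trans (cong half (2*suc n)) (trans (cong₂ (λ h p → h + p + (1 ∸ p)) (half-double n) (parity-double n))
  (trans (cong (_+ 1) (ℕₚ.+-identityʳ n)) (ℕₚ.+-comm n 1)))

half-suc-double : ∀ n → half (suc (2 * n)) ≡ n
half-suc-double n = trans (cong₂ _+_ (half-double n) (parity-double n)) (ℕₚ.+-identityʳ n)

index-zero : ∀ y → index 0 y ≡ suc (2 * y)
index-zero y = trans (ℕₚ.*-identityˡ (2 * y + 1)) (ℕₚ.+-comm (2 * y) 1)

index-suc : ∀ x y → index (suc x) y ≡ 2 * index x y
index-suc x y = ℕₚ.*-assoc 2 (2 ^ x) (2 * y + 1)

index-zero≢suc : ∀ y x y′ → index 0 y ≢ index (suc x) y′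
index-zero≢suc y x y′ e = case trans (sym odd) (trans (cong parity e) even) of λ ()
  where
  odd : parity (index 0 y) ≡ 1
  odd = trans (cong parity (index-zero y)) (cong (1 ∸_) (parity-double y))
  even : parity (index (suc x) y′) ≡ 0
  even = trans (cong parity (index-suc x y′)) (parity-double (index x y′))

index-injective : ∀ x y x′ y′ → index x y ≡ index x′ y′ → x ≡ x′ × y ≡ y′
index-injective zero y zero y′ e = refl , trans (sym (half-suc-double y))
  (trans (cong half (trans (sym (index-zero y)) (trans e (index-zero y′)))) (half-suc-double y′))
index-injective zero y (suc x′) y′ e = ⊥-elim (index-zero≢suc y x′ y′ e)
index-injective (suc x) y zero y′ e = ⊥-elim (index-zero≢suc y′ x y (sym e))
index-injective (suc x) y (suc x′) y′ e with index-injective x y x′ y′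
    (trans (sym (half-double (index x y))) (trans (cong half (trans (sym (index-suc x y)) (trans e (index-suc x′ y′)))) (half-double (index x′ y′))))
... | refl , refl = refl , refl

index-mono : ∀ {x y x′ y′} → x ≤ x′ → y ≤ y′ → index x y ≤ index x′ y′
index-mono p q = ℕₚ.*-mono-≤ (ℕₚ.^-monoʳ-≤ 2 p) (ℕₚ.+-monoˡ-≤ 1 (ℕₚ.*-monoʳ-≤ 2 q))

x≤index : ∀ x y → x ≤ index x y
x≤index zero y = z≤n
x≤index (suc x) y = subst (suc x ≤_) (sym (index-suc x y))
  (ℕₚ.≤-trans (ℕₚ.+-mono-≤ (positive x y) (x≤index x y)) (ℕₚ.+-monoʳ-≤ (index x y) (ℕₚ.m≤m+n (index x y) 0)))
  where
  positive : ∀ x y → 1 ≤ index x y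
  positive x y = ℕₚ.*-mono-≤ (ℕₚ.^-monoʳ-≤ 2 {0} {x} z≤n) (ℕₚ.m≤n+m 1 (2 * y))

y≤index : ∀ x y → y ≤ index x y
y≤index x y = ℕₚ.≤-trans (ℕₚ.≤-trans (ℕₚ.m≤m+n y (y + 0)) (ℕₚ.m≤m+n (2 * y) 1))
  (ℕₚ.≤-trans (ℕₚ.≤-reflexive (sym (ℕₚ.*-identityˡ _))) (ℕₚ.*-monoˡ-≤ (2 * y + 1) (ℕₚ.^-monoʳ-≤ 2 {0} {x} z≤n)))

fromBits : (ℕ → Bool) → ℕ → ℕ
fromBits f zero = 0
fromBits f (suc K) = (if f 0 then 1 else 0) + 2 * fromBits (f ∘ suc) K

shift-suc : ∀ j D → shift (suc j) D ≡ shift j (half D)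
shift-suc zero D = refl
shift-suc (suc j) D = cong half (shift-suc j D)

bit-suc : ∀ j D → bit (suc j) D ≡ bit j (half D)
bit-suc j D = cong parity (shift-suc j D)

bit-0 : ∀ j → bit j 0 ≡ 0
bit-0 zero = refl
bit-0 (suc j) = trans (bit-suc j 0) (bit-0 j)

half-fromBits : ∀ b n → half ((if b then 1 else 0) + 2 * n) ≡ n
half-fromBits true n = half-suc-double n
half-fromBits false n = half-double n

bit-fromBits : ∀ f K j → j < K → bit j (fromBits f K) ≡ (if f j then 1 else 0)
bit-fromBits f (suc K) zero _ with f 0
... | true = cong (1 ∸_) (parity-double (fromBits (f ∘ suc) K))
... | false = parity-double (fromBits (f ∘ suc) K)
bit-fromBits f (suc K) (suc j) (s≤s lt) = trans (bit-suc j _)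
  (trans (cong (bit j) (half-fromBits (f 0) _)) (bit-fromBits (f ∘ suc) K j lt))

bit-fromBits-≥ : ∀ f K j → K ≤ j → bit j (fromBits f K) ≡ 0
bit-fromBits-≥ f zero j _ = bit-0 j
bit-fromBits-≥ f (suc K) (suc j) (s≤s le) = trans (bit-suc j _)
  (trans (cong (bit j) (half-fromBits (f 0) _)) (bit-fromBits-≥ (f ∘ suc) K j le))

-- Each halving lowers a positive number by at least one, so nothing is left after `D` of them.
bit-set⇒< : ∀ j D → bit j D ≡ 1 → j < D
bit-set⇒< j D e = ℕₚ.≰⇒> λ D≤j → case trans (sym e) (cong parity (ℕₚ.n≤0⇒n≡0 (ℕₚ.≤-trans (shift≤ j) (ℕₚ.≤-reflexive (ℕₚ.m≤n⇒m∸n≡0 D≤j))))) of λ ()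
  where
  parity≤1 : ∀ n → parity n ≤ 1
  parity≤1 zero = z≤n
  parity≤1 (suc n) = ℕₚ.m∸n≤m 1 (parity n)
  half≤pred : ∀ n → half n ≤ pred n
  half≤pred zero = z≤n
  half≤pred (suc zero) = z≤n
  half≤pred (suc (suc n)) = ℕₚ.≤-trans (ℕₚ.+-mono-≤ (half≤pred (suc n)) (parity≤1 (suc n))) (ℕₚ.≤-reflexive (ℕₚ.+-comm n 1))
  shift≤ : ∀ j → shift j D ≤ D ∸ j
  shift≤ zero = ℕₚ.≤-refl
  shift≤ (suc j) = ℕₚ.≤-trans (half≤pred (shift j D)) (ℕₚ.≤-trans (ℕₚ.pred-mono-≤ (shift≤ j)) (ℕₚ.≤-reflexive (ℕₚ.pred[m∸n]≡m∸[1+n] D j)))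

index₃-injective : ∀ s x y s′ x′ y′ → index₃ s x y ≡ index₃ s′ x′ y′ → s ≡ s′ × x ≡ x′ × y ≡ y′
index₃-injective s x y s′ x′ y′ e with index-injective s (index x y) s′ (index x′ y′) e
... | s≡ , e′ with index-injective x y x′ y′ e′
... | x≡ , y≡ = s≡ , x≡ , y≡

-- Only finitely many entries can be stored, hence the bounds in the first half. The second half has
-- none, because a tiling of the instance may use any base tile below `D`, not only those that
-- encode a label.
codeTable : ∀ M (R : ℕ → ℕ → ℕ → Bool) → ∃ λ D →
  (∀ s x y → s < M → x < M → y < M → R s x y ≡ true → bit (index₃ s x y) D ≡ 1) ×
  (∀ s x y → bit (index₃ s x y) D ≡ 1 → R s x y ≡ true)
codeTable M R = fromBits f K , set , unset
  where
  K : ℕ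
  K = suc (index₃ M M M)
  Entry : ℕ → Set
  Entry j = ∃ λ (s : Fin M) → ∃ λ (x : Fin M) → ∃ λ (y : Fin M) → index₃ (toℕ s) (toℕ x) (toℕ y) ≡ j × R (toℕ s) (toℕ x) (toℕ y) ≡ true
  entry? : ∀ j → Dec (Entry j)
  entry? j = Finₚ.any? λ s → Finₚ.any? λ x → Finₚ.any? λ y → (_ ℕ.≟ j) ×-dec (_ Boolₚ.≟ true)
  f : ℕ → Bool
  f j = does (entry? j)
  set : ∀ s x y → s < M → x < M → y < M → R s x y ≡ true → bit (index₃ s x y) (fromBits f K) ≡ 1
  set s x y s< x< y< r = trans
    (bit-fromBits f K (index₃ s x y) (s≤s (index-mono (ℕₚ.<⇒≤ s<) (index-mono (ℕₚ.<⇒≤ x<) (ℕₚ.<⇒≤ y<)))))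
    (cong (λ b → if b then 1 else 0) (dec-true (entry? (index₃ s x y)) (fromℕ< s< , fromℕ< x< , fromℕ< y< , found)))
    where
    found : index₃ (toℕ (fromℕ< s<)) (toℕ (fromℕ< x<)) (toℕ (fromℕ< y<)) ≡ index₃ s x y × R (toℕ (fromℕ< s<)) (toℕ (fromℕ< x<)) (toℕ (fromℕ< y<)) ≡ true
    found rewrite Finₚ.toℕ-fromℕ< s< | Finₚ.toℕ-fromℕ< x< | Finₚ.toℕ-fromℕ< y< = refl , r
  unset : ∀ s x y → bit (index₃ s x y) (fromBits f K) ≡ 1 → R s x y ≡ true
  unset s x y e with index₃ s x y ℕ.<? K
  ... | no ≮K = case trans (sym e) (bit-fromBits-≥ f K _ (ℕₚ.≮⇒≥ ≮K)) of λ ()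
  ... | yes <K with entry? (index₃ s x y) | trans (sym (bit-fromBits f K _ <K)) e
  ...   | no _ | ()
  ...   | yes (s′ , x′ , y′ , eq , r) | _ with index₃-injective (toℕ s′) (toℕ x′) (toℕ y′) s x y eq
  ...     | refl , refl , refl = r

eqN-refl : ∀ x → eqN x x ≡ 1
eqN-refl x rewrite ℕₚ.n∸n≡0 x = refl

dist≡0 : ∀ x y → dist x y ≡ 0 → x ≡ y
dist≡0 x y e = ℕₚ.≤-antisym (ℕₚ.m∸n≡0⇒m≤n (ℕₚ.m+n≡0⇒m≡0 (x ∸ y) e)) (ℕₚ.m∸n≡0⇒m≤n (ℕₚ.m+n≡0⇒n≡0 (x ∸ y) e))

eqN-≢ : ∀ {x y} → x ≢ y → eqN x y ≡ 0
eqN-≢ {x} {y} x≢y with dist x y in e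
... | zero = ⊥-elim (x≢y (dist≡0 x y e))
... | suc d = ℕₚ.0∸n≡0 d

rem-quo : ∀ c D x → x < D → rem (c * D + x) D ≡ x × quo (c * D + x) D ≡ c
rem-quo zero (suc D) zero lt = refl , refl
rem-quo (suc c) (suc D) zero lt = subst (λ z → rem z (suc D) ≡ 0 × quo z (suc D) ≡ suc c) (sym (shape c D)) wrap
  where
  shape : ∀ c D → suc c * suc D + 0 ≡ suc (c * suc D + D)
  shape = solve-∀
  previous = rem-quo c (suc D) D ℕₚ.≤-refl
  wrap : rem (suc (c * suc D + D)) (suc D) ≡ 0 × quo (suc (c * suc D + D)) (suc D) ≡ suc c
  wrap rewrite proj₁ previous | proj₂ previous | eqN-refl (suc D) = ℕₚ.*-zeroʳ (suc D) , ℕₚ.+-comm c 1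
rem-quo c D (suc x) lt rewrite ℕₚ.+-suc (c * D) x
  | proj₁ (rem-quo c D x (ℕₚ.<-trans (ℕₚ.n<1+n x) lt)) | proj₂ (rem-quo c D x (ℕₚ.<-trans (ℕₚ.n<1+n x) lt))
  | eqN-≢ (ℕₚ.<⇒≢ lt) = ℕₚ.*-identityʳ (suc x) , ℕₚ.+-identityʳ c

-- Tiles

infix 4 _≟ᵍ_
_≟ᵍ_ : (s t : Gen) → Dec (s ≡ t)
a⁺ ≟ᵍ a⁺ = yes refl
a⁺ ≟ᵍ a⁻ = no λ ()
a⁺ ≟ᵍ b⁺ = no λ ()
a⁺ ≟ᵍ b⁻ = no λ ()
a⁻ ≟ᵍ a⁺ = no λ ()
a⁻ ≟ᵍ a⁻ = yes refl
a⁻ ≟ᵍ b⁺ = no λ ()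
a⁻ ≟ᵍ b⁻ = no λ ()
b⁺ ≟ᵍ a⁺ = no λ ()
b⁺ ≟ᵍ a⁻ = no λ ()
b⁺ ≟ᵍ b⁺ = yes refl
b⁺ ≟ᵍ b⁻ = no λ ()
b⁻ ≟ᵍ a⁺ = no λ ()
b⁻ ≟ᵍ a⁻ = no λ ()
b⁻ ≟ᵍ b⁺ = no λ ()
b⁻ ≟ᵍ b⁻ = yes refl

fromBits-< : ∀ f K → fromBits f K < 2 ^ K
fromBits-< f zero = s≤s z≤n
fromBits-< f (suc K) = ℕₚ.≤-trans (s≤s (ℕₚ.+-monoˡ-≤ (2 * n) (at-most-one (f 0))))
  (ℕₚ.≤-trans (ℕₚ.≤-reflexive (sym (2*suc n))) (ℕₚ.*-monoʳ-≤ 2 (fromBits-< (f ∘ suc) K)))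
  where
  n = fromBits (f ∘ suc) K
  at-most-one : ∀ b → (if b then 1 else 0) ≤ 1
  at-most-one true = s≤s z≤n
  at-most-one false = z≤n

fromBits-cong : ∀ {f g} K → (∀ j → f j ≡ g j) → fromBits f K ≡ fromBits g K
fromBits-cong zero e = refl
fromBits-cong (suc K) e = cong₂ (λ b n → (if b then 1 else 0) + 2 * n) (e 0) (fromBits-cong K (λ j → e (suc j)))

fromBits-false : ∀ {f} K → (∀ j → f j ≡ false) → fromBits f K ≡ 0
fromBits-false K e = trans (fromBits-cong K e) (zeros K)
  where
  zeros : ∀ K → fromBits (λ _ → false) K ≡ 0
  zeros zero = refl
  zeros (suc K) = cong (2 *_) (zeros K)

does-true : ∀ {A : Set} {d : Dec A} → does d ≡ true → A
does-true {d = yes a} _ = a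

module Labels (w : Walker) where

  m : ℕ
  m = size′ w

  -- lampʳ is the lamp about to be crossed, belowʳ and aboveʳ count the lit lamps on either side modulo 3, rayʳ and
  -- rayˡ mark the powers of a with nonnegative and nonpositive exponent, present holds the states of the walker.
  record Label : Set where
    field
      lampʳ         : Bool
      belowʳ aboveʳ : Fin 3
      rayʳ rayˡ     : Bool
      present       : Fin m → Bool
  open Label public

  -- The inverse generators run along the same edges backwards, so the counts are compared only
  -- upwards; the left ray alone needs a rule for `a⁻`.
  Crossing : Label → Gen → Label → Set
  Crossing x a⁺ y = belowʳ y ≡ belowʳ x ⊕ lampʳ x × aboveʳ x ≡ aboveʳ y ⊕ lampʳ x × (rayʳ x ≡ true → rayʳ y ≡ true)
  Crossing x b⁺ y = belowʳ y ≡ belowʳ x ⊕ not (lampʳ x) × aboveʳ x ≡ aboveʳ y ⊕ lampʳ x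
  Crossing x a⁻ y = rayˡ x ≡ true → rayˡ y ≡ true
  Crossing x b⁻ y = ⊤

  Dark : Label → Set
  Dark x = (rayʳ x ≡ true → lampʳ x ≡ false) × (rayˡ x ≡ true → lampʳ x ≡ false)

  Arrives : Label → Maybe (Fin m) → Set
  Arrives y nothing = ⊥
  Arrives y (just j) = present y j ≡ true

  Walks : Label → Gen → Label → Set
  Walks x s y = ∀ i → present x i ≡ true → proj₁ (move w i (lampʳ x)) ≡ s → Arrives y (proj₂ (move w i (lampʳ x)))

  Starts : Bool → Label → Set
  Starts b x = b ≡ true → present x (entry w) ≡ true

  Compatible : Bool → Gen → Label → Label → Set
  Compatible b s x y = Crossing x s y × Dark x × Walks x s y × Starts b x

  crossing? : ∀ x s y → Dec (Crossing x s y)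
  crossing? x a⁺ y = (_ Finₚ.≟ _) ×-dec (_ Finₚ.≟ _) ×-dec ((_ Boolₚ.≟ _) →-dec (_ Boolₚ.≟ _))
  crossing? x b⁺ y = (_ Finₚ.≟ _) ×-dec (_ Finₚ.≟ _)
  crossing? x a⁻ y = (_ Boolₚ.≟ _) →-dec (_ Boolₚ.≟ _)
  crossing? x b⁻ y = yes tt

  arrives? : ∀ y t → Dec (Arrives y t)
  arrives? y nothing = no λ ()
  arrives? y (just j) = _ Boolₚ.≟ _

  compatible? : ∀ b s x y → Dec (Compatible b s x y)
  compatible? b s x y =
    crossing? x s y ×-dec
    (((_ Boolₚ.≟ _) →-dec (_ Boolₚ.≟ _)) ×-dec ((_ Boolₚ.≟ _) →-dec (_ Boolₚ.≟ _))) ×-dec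
    Finₚ.all? (λ i → (_ Boolₚ.≟ _) →-dec ((_ ≟ᵍ _) →-dec arrives? y (proj₂ (move w i (lampʳ x))))) ×-dec
    ((_ Boolₚ.≟ _) →-dec (_ Boolₚ.≟ _))

  trit : Bool → Bool → Fin 3
  trit true _ = suc zero
  trit false true = suc (suc zero)
  trit false false = zero

  on : ℕ → ℕ → Bool
  on j x = bit j x ≡ᵇ 1

  -- The ray bits are stored inverted, so that tile 0 is the blank tile on both rays.
  label : ℕ → Label
  label x = record
    { lampʳ = on 0 x
    ; belowʳ = trit (on 1 x) (on 2 x)
    ; aboveʳ = trit (on 3 x) (on 4 x)
    ; rayʳ = not (on 5 x)
    ; rayˡ = not (on 6 x)
    ; present = λ i → on (7 + toℕ i) x
    }

  is-one is-two : Fin 3 → Bool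
  is-one q = does (q Finₚ.≟ suc zero)
  is-two q = does (q Finₚ.≟ suc (suc zero))

  trit-inverse : ∀ q → trit (is-one q) (is-two q) ≡ q
  trit-inverse zero = refl
  trit-inverse (suc zero) = refl
  trit-inverse (suc (suc zero)) = refl

  extend : ∀ {n} → (Fin n → Bool) → ℕ → Bool
  extend {zero} f j = false
  extend {suc n} f zero = f zero
  extend {suc n} f (suc j) = extend (f ∘ suc) j

  extend-toℕ : ∀ {n} (f : Fin n → Bool) i → extend f (toℕ i) ≡ f i
  extend-toℕ f zero = refl
  extend-toℕ f (suc i) = extend-toℕ (f ∘ suc) i

  extend-cong : ∀ {n} {f g : Fin n → Bool} → (∀ i → f i ≡ g i) → ∀ j → extend f j ≡ extend g j
  extend-cong {zero} e j = refl
  extend-cong {suc n} e zero = e zero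
  extend-cong {suc n} e (suc j) = extend-cong (λ i → e (suc i)) j

  extend-false : ∀ {n} {f : Fin n → Bool} → (∀ i → f i ≡ false) → ∀ j → extend f j ≡ false
  extend-false {zero} e j = refl
  extend-false {suc n} e zero = e zero
  extend-false {suc n} e (suc j) = extend-false (λ i → e (suc i)) j

  bits : Label → ℕ → Bool
  bits l 0 = lampʳ l
  bits l 1 = is-one (belowʳ l)
  bits l 2 = is-two (belowʳ l)
  bits l 3 = is-one (aboveʳ l)
  bits l 4 = is-two (aboveʳ l)
  bits l 5 = not (rayʳ l)
  bits l 6 = not (rayˡ l)
  bits l (suc (suc (suc (suc (suc (suc (suc j))))))) = extend (present l) j

  opaque
    tile : Label → ℕ
    tile l = fromBits (bits l) (7 + m)

    -- Exponential in the number of states; opacity keeps it from being evaluated.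
    N : ℕ
    N = 2 ^ (7 + m)

    tile<N : ∀ l → tile l < N
    tile<N l = fromBits-< (bits l) (7 + m)

    N>0 : 0 < N
    N>0 = ℕₚ.^-monoʳ-≤ 2 {0} {7 + m} z≤n

    on-tile : ∀ l j → j < 7 + m → on j (tile l) ≡ bits l j
    on-tile l j lt = trans (cong (_≡ᵇ 1) (bit-fromBits (bits l) (7 + m) j lt)) (back (bits l j))
      where
      back : ∀ b → ((if b then 1 else 0) ≡ᵇ 1) ≡ b
      back true = refl
      back false = refl

    tile-pointwise : ∀ {l l′} → (∀ j → bits l j ≡ bits l′ j) → tile l ≡ tile l′
    tile-pointwise = fromBits-cong (7 + m)

    tile-zero : ∀ {l} → (∀ j → bits l j ≡ false) → tile l ≡ 0
    tile-zero = fromBits-false (7 + m)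

  -- Since `present` is a function, labels with the same content are compared pointwise instead of
  -- by `_≡_`.
  record _≐_ (l l′ : Label) : Set where
    field
      lamp≐    : lampʳ l ≡ lampʳ l′
      below≐   : belowʳ l ≡ belowʳ l′
      above≐   : aboveʳ l ≡ aboveʳ l′
      rayʳ≐    : rayʳ l ≡ rayʳ l′
      rayˡ≐    : rayˡ l ≡ rayˡ l′
      present≐ : ∀ i → present l i ≡ present l′ i
  open _≐_ public

  label-tile : ∀ l → l ≐ label (tile l)
  label-tile l = record
    { lamp≐ = sym (read 0 (s≤s z≤n))
    ; below≐ = sym (trans (cong₂ trit (read 1 (s≤s (s≤s z≤n))) (read 2 (s≤s (s≤s (s≤s z≤n))))) (trit-inverse (belowʳ l)))
    ; above≐ = sym (trans (cong₂ trit (read 3 (ℕₚ.m≤m+n 4 (3 + m))) (read 4 (ℕₚ.m≤m+n 5 (2 + m)))) (trit-inverse (aboveʳ l)))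
    ; rayʳ≐ = sym (trans (cong not (read 5 (ℕₚ.m≤m+n 6 (1 + m)))) (Boolₚ.not-involutive (rayʳ l)))
    ; rayˡ≐ = sym (trans (cong not (read 6 (ℕₚ.m≤m+n 7 m))) (Boolₚ.not-involutive (rayˡ l)))
    ; present≐ = λ i → sym (trans (read (7 + toℕ i) (ℕₚ.+-monoʳ-< 7 (Finₚ.toℕ<n i))) (extend-toℕ (present l) i))
    }
    where
    read : ∀ j → j < 7 + m → on j (tile l) ≡ bits l j
    read = on-tile l

  tile-cong : ∀ {l l′} → l ≐ l′ → tile l ≡ tile l′
  tile-cong {l} {l′} e = tile-pointwise same
    where
    same : ∀ j → bits l j ≡ bits l′ j
    same 0 = lamp≐ e
    same 1 = cong is-one (below≐ e)
    same 2 = cong is-two (below≐ e)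
    same 3 = cong is-one (above≐ e)
    same 4 = cong is-two (above≐ e)
    same 5 = cong not (rayʳ≐ e)
    same 6 = cong not (rayˡ≐ e)
    same (suc (suc (suc (suc (suc (suc (suc j))))))) = extend-cong (present≐ e) j

  compatible-≐ : ∀ {b s x y x′ y′} → x ≐ x′ → y ≐ y′ → Compatible b s x y → Compatible b s x′ y′
  compatible-≐ {b} {s} {x} {y} {x′} {y′} ex ey (cross , dark , walks , starts) =
    crossing s cross , dark′ , walks′ , λ e → trans (sym (present≐ ex (entry w))) (starts e)
    where
    crossing : ∀ s → Crossing x s y → Crossing x′ s y′
    crossing a⁺ (q , p , r) = trans (sym (below≐ ey)) (trans q (cong₂ _⊕_ (below≐ ex) (lamp≐ ex)))
      , trans (sym (above≐ ex)) (trans p (cong₂ _⊕_ (above≐ ey) (lamp≐ ex)))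
      , λ e → trans (sym (rayʳ≐ ey)) (r (trans (rayʳ≐ ex) e))
    crossing b⁺ (q , p) = trans (sym (below≐ ey)) (trans q (cong₂ (λ c d → c ⊕ not d) (below≐ ex) (lamp≐ ex)))
      , trans (sym (above≐ ex)) (trans p (cong₂ _⊕_ (above≐ ey) (lamp≐ ex)))
    crossing a⁻ r = λ e → trans (sym (rayˡ≐ ey)) (r (trans (rayˡ≐ ex) e))
    crossing b⁻ r = tt
    dark′ : Dark x′
    dark′ = (λ e → trans (sym (lamp≐ ex)) (proj₁ dark (trans (rayʳ≐ ex) e)))
          , (λ e → trans (sym (lamp≐ ex)) (proj₂ dark (trans (rayˡ≐ ex) e)))
    arrives : ∀ t → Arrives y t → Arrives y′ t
    arrives (just j) e = trans (sym (present≐ ey j)) e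
    walks′ : Walks x′ s y′
    walks′ i e rewrite sym (lamp≐ ex) = λ d → arrives (proj₂ (move w i (lampʳ x))) (walks i (trans (present≐ ex i) e) d)

  relation : ℕ → ℕ → ℕ → Bool
  relation 0 x y = does (compatible? false a⁺ (label x) (label y))
  relation 1 x y = does (compatible? false a⁻ (label x) (label y))
  relation 2 x y = does (compatible? false b⁺ (label x) (label y))
  relation 3 x y = does (compatible? false b⁻ (label x) (label y))
  relation 4 x y = does (compatible? true a⁺ (label x) (label y))
  relation 5 x y = does (compatible? true a⁻ (label x) (label y))
  relation 6 x y = does (compatible? true b⁺ (label x) (label y))
  relation 7 x y = does (compatible? true b⁻ (label x) (label y))
  relation 8 x y = x ≡ᵇ N
  relation _ x y = false

  row : Bool → Gen → ℕ
  row b s = number s + 4 * (if b then 1 else 0)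

  relation-row : ∀ b s x y → relation (row b s) x y ≡ does (compatible? b s (label x) (label y))
  relation-row false a⁺ x y = refl
  relation-row false a⁻ x y = refl
  relation-row false b⁺ x y = refl
  relation-row false b⁻ x y = refl
  relation-row true a⁺ x y = refl
  relation-row true a⁻ x y = refl
  relation-row true b⁺ x y = refl
  relation-row true b⁻ x y = refl

  row<8 : ∀ b s → row b s < 8
  row<8 b s = ℕₚ.<-≤-trans (ℕₚ.+-monoˡ-< _ (number<4 s)) (ℕₚ.+-monoʳ-≤ 4 (ℕₚ.*-monoʳ-≤ 4 (bit≤1 b)))
    where
    number<4 : ∀ s → number s < 4
    number<4 a⁺ = s≤s z≤n
    number<4 a⁻ = s≤s (s≤s z≤n)
    number<4 b⁺ = s≤s (s≤s (s≤s z≤n))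
    number<4 b⁻ = s≤s (s≤s (s≤s (s≤s z≤n)))
    bit≤1 : ∀ b → (if b then 1 else 0) ≤ 1
    bit≤1 true = s≤s z≤n
    bit≤1 false = z≤n

  record Coded (D : ℕ) : Set where
    field
      large  : N ≤ D
      coded  : ∀ {b s x y} → x < N → y < N → Compatible b s (label x) (label y) → bit (index₃ (row b s) x y) D ≡ 1
      decode : ∀ {b s x y} → bit (index₃ (row b s) x y) D ≡ 1 → Compatible b s (label x) (label y)
  open Coded public

  x≤code : ∀ s x y D → bit (index₃ s x y) D ≡ 1 → x ≤ D
  x≤code s x y D e = ℕₚ.≤-trans (ℕₚ.≤-trans (x≤index x y) (y≤index s (index x y))) (ℕₚ.<⇒≤ (bit-set⇒< (index₃ s x y) D e))

  -- Row 8 of the table only serves to make D larger than N.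
  coding : ∃ Coded
  coding = D , record
    { large = x≤code eight N 0 D marker
    ; coded = λ {b} {s} {x} {y} x< y< ok → proj₁ (proj₂ coded-by) (row b s) x y
        (ℕₚ.<-≤-trans (row<8 b s) (ℕₚ.m≤n⇒m≤1+n (ℕₚ.m≤m+n 8 N)))
        (ℕₚ.<-≤-trans x< (ℕₚ.m≤n+m N 9)) (ℕₚ.<-≤-trans y< (ℕₚ.m≤n+m N 9))
        (trans (relation-row b s x y) (dec-true (compatible? b s (label x) (label y)) ok))
    ; decode = λ {b} {s} {x} {y} e → does-true {d = compatible? b s (label x) (label y)}
        (trans (sym (relation-row b s x y)) (proj₂ (proj₂ coded-by) (row b s) x y e))
    }
    where
    coded-by = codeTable (9 + N) relation
    D = proj₁ coded-by
    eight = 8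
    marker : bit (index₃ eight N 0) D ≡ 1
    marker = proj₁ (proj₂ coded-by) eight N 0 (s≤s (ℕₚ.m≤m+n 8 N)) (s≤s (ℕₚ.m≤n+m N 8)) (s≤s z≤n) (dec-true (N ℕ.≟ N) refl)

-- A tiling forces the walk

≡ᵇ1⇒≡1 : ∀ n → (n ≡ᵇ 1) ≡ true → n ≡ 1
≡ᵇ1⇒≡1 (suc zero) e = refl

eqN-1 : ∀ n → eqN n 1 ≡ (if n ≡ᵇ 1 then 1 else 0)
eqN-1 zero = refl
eqN-1 (suc zero) = refl
eqN-1 (suc (suc n)) = ℕₚ.0∸n≡0 (n + 0)

1∸≡1 : ∀ v → 1 ∸ v ≡ 1 → v ≡ 0
1∸≡1 zero e = refl
1∸≡1 (suc v) e = case trans (sym e) (ℕₚ.0∸n≡0 v) of λ ()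

module Forced (w : Walker) {D} (C : Labels.Coded w D) (tiling : Tileable (instanceOf D)) where
  open Labels w

  φ : Elem → Fin (tiles D)
  φ = proj₁ tiling

  φ-cong : ∀ {g h} → g ≋ h → φ g ≡ φ h
  φ-cong e = proj₁ (proj₂ tiling) _ _ (≋⇒≈ e)

  base count : Elem → ℕ
  base g = rem (toℕ (φ g)) D
  count g = quo (toℕ (φ g)) D

  lab : Elem → Label
  lab g = label (base g)

  passes : ∀ g s → test D (toℕ (φ g)) (number s) (toℕ (φ (g ▸ s))) ≡ 1
  passes g s = ≡ᵇ1⇒≡1 _ (proj₂ (proj₂ (proj₂ tiling)) g s)

  compatible : ∀ g s → Compatible (count g ≡ᵇ 1) s (lab g) (lab (g ▸ s))
  compatible g s = decode C (subst (λ n → bit (index₃ (number s + 4 * n) (base g) (base (g ▸ s))) D ≡ 1) (eqN-1 (count g))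
    (ℕₚ.m*n≡1⇒m≡1 (bit (index₃ (number s + 4 * eqN (count g) 1) (base g) (base (g ▸ s))) D) _ (passes g s)))

  counts-down : ∀ g n → count g ≡ suc (suc n) → count (g ▸ b⁺) ≡ suc n
  counts-down g n e = subst (λ c → count (g ▸ b⁺) ≡ pred c) e (dist≡0 _ _ (no-distance (pred (count g)) (cong pred e) zero-product))
    where
    d = dist (count (g ▸ b⁺)) (pred (count g))
    zero-product : pred (count g) * d ≡ 0
    zero-product = trans (sym (ℕₚ.*-identityˡ (pred (count g) * d)))
      (1∸≡1 (1 * (pred (count g) * d)) (ℕₚ.m*n≡1⇒n≡1 (bit (index₃ (2 + 4 * eqN (count g) 1) (base g) (base (g ▸ b⁺))) D) _ (passes g b⁺)))
    no-distance : ∀ p {d} → p ≡ suc n → p * d ≡ 0 → d ≡ 0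
    no-distance p {d} refl z = ℕₚ.m+n≡0⇒m≡0 d z

  crossing : ∀ g s → Crossing (lab g) s (lab (g ▸ s))
  crossing g s = proj₁ (compatible g s)

  0<D : 0 < D
  0<D = ℕₚ.<-≤-trans N>0 (large C)

  seed-parts : base one ≡ 0 × count one ≡ suc D
  seed-parts = subst (λ n → rem n D ≡ 0 × quo n D ≡ suc D)
    (sym (trans (cong toℕ (proj₁ (proj₂ (proj₂ tiling)))) (trans (toℕ-seed D) (sym (ℕₚ.+-identityʳ (suc D * D))))))
    (rem-quo (suc D) D 0 0<D)

  label-0 : rayʳ (label 0) ≡ true × rayˡ (label 0) ≡ true
  label-0 rewrite bit-0 5 | bit-0 6 = refl , refl

  ray-right : ∀ n → rayʳ (lab ⟨ [] , + n ⟩) ≡ true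
  ray-right zero = trans (cong (rayʳ ∘ label) (proj₁ seed-parts)) (proj₁ label-0)
  ray-right (suc n) = trans (cong (λ k → rayʳ (lab ⟨ [] , + k ⟩)) (ℕₚ.+-comm 1 n))
    (proj₂ (proj₂ (crossing ⟨ [] , + n ⟩ a⁺)) (ray-right n))

  ray-left : ∀ n → rayˡ (lab ⟨ [] , -[1+ n ] ⟩) ≡ true
  ray-left zero = crossing one a⁻ (trans (cong (rayˡ ∘ label) (proj₁ seed-parts)) (proj₂ label-0))
  ray-left (suc n) = trans (cong (λ k → rayˡ (lab ⟨ [] , -[1+ suc k ] ⟩)) (sym (ℕₚ.+-identityʳ n))) (crossing ⟨ [] , -[1+ n ] ⟩ a⁻ (ray-left n))

  blank : ∀ n → lampʳ (lab ⟨ [] , n ⟩) ≡ false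
  blank (+ n) = proj₁ (proj₁ (proj₂ (compatible ⟨ [] , + n ⟩ a⁺))) (ray-right n)
  blank -[1+ n ] = proj₂ (proj₁ (proj₂ (compatible ⟨ [] , -[1+ n ] ⟩ a⁺))) (ray-left n)

  reads : ∀ g → lampʳ (lab g) ≡ at g
  reads g = Reading.reading (belowʳ ∘ lab) (aboveʳ ∘ lab) (lampʳ ∘ lab)
    (cong (belowʳ ∘ lab′) ∘ φ-cong) (cong (aboveʳ ∘ lab′) ∘ φ-cong) (cong (lampʳ ∘ lab′) ∘ φ-cong)
    (λ g → proj₁ (crossing g a⁺)) (λ g → proj₁ (crossing g b⁺))
    (λ g → proj₁ (proj₂ (crossing g a⁺))) (λ g → proj₂ (crossing g b⁺))
    blank (lamps g) (pos g)
    where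
    lab′ : Fin (tiles D) → Label
    lab′ x = label (rem (toℕ x) D)

  count-chain : ∀ d i → d + i ≡ D → count (chain i) ≡ suc d
  count-chain d zero e = trans (proj₂ seed-parts) (cong suc (trans (sym e) (ℕₚ.+-identityʳ d)))
  count-chain d (suc i) e = counts-down (chain i) d (count-chain (suc d) i (trans (sym (ℕₚ.+-suc d i)) e))

  starts : present (lab (chain D)) (entry w) ≡ true
  starts = proj₂ (proj₂ (proj₂ (compatible (chain D) a⁺))) (cong (_≡ᵇ 1) (count-chain 0 D refl))

  walks : ∀ g i → present (lab g) i ≡ true → Arrives (lab (g ▸ proj₁ (move w i (at g)))) (proj₂ (move w i (at g)))
  walks g i e = subst (λ b → Arrives (lab (g ▸ proj₁ (move w i b))) (proj₂ (move w i b))) (reads g)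
    (proj₁ (proj₂ (proj₂ (compatible g (proj₁ (move w i (lampʳ (lab g))))))) i e refl)

  -- States propagate along the path, and its last move would have to arrive at `nothing`, where
  -- `Arrives` is empty.
  never-exits : ∀ {i g h} → Path w i g nothing h → present (lab g) i ≡ true → ⊥
  never-exits {i} {g} (exit _ e) p = subst (λ m → Arrives (lab (g ▸ proj₁ m)) (proj₂ m)) e (walks g i p)
  never-exits {i} {g} (step _ e q) p = never-exits q (subst (λ m → Arrives (lab (g ▸ proj₁ m)) (proj₂ m)) e (walks g i p))

-- A walk through finitely many configurations gives a tiling

module Existence (w : Walker) {D} (C : Labels.Coded w D) {spin₁ spin₂ : Fin (size′ w)} {h : Elem}
  (path : Path w (entry w) (chain D) (just spin₁) h) (lit-h : Lit h)
  (spin₁-move : ∀ b → move w spin₁ b ≡ (a⁺ , just spin₂)) (spin₂-move : ∀ b → move w spin₂ b ≡ (a⁻ , just spin₁))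
  where
  open Labels w

  Visits : Set
  Visits = List (Fin m × Elem)

  Visited : Visits → Fin m → Elem → Set
  Visited V i g = Any (λ v → i ≡ proj₁ v × g ≋ proj₂ v) V

  visited? : ∀ V i g → Dec (Visited V i g)
  visited? V i g = Any.any? (λ v → (i Finₚ.≟ proj₁ v) ×-dec (g ≋? proj₂ v)) V

  visited-≋ : ∀ {V i g g′} → g ≋ g′ → Visited V i g′ → Visited V i g
  visited-≋ e = Any.map λ { (i≡ , g≋) → i≡ , ≋-trans e g≋ }

  trace : ∀ {i g t k} → Path w i g t k → Visits
  trace stop = []
  trace (exit _ _) = []
  trace (step {i} {g} _ _ p) = (i , g) ∷ trace p

  -- Closure under the moves is all that `Walks` demands, so the order and repetition of visits are
  -- immaterial.
  Continues : Visits → Fin m → Elem → Set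
  Continues V i g = ∃ λ s → ∃ λ j → move w i (at g) ≡ (s , just j) × Visited V j (g ▸ s)

  trace-first : ∀ {i g j k V} (p : Path w i g (just j) k) → Visited V j k → Visited (trace p ++ V) i g
  trace-first stop v = v
  trace-first (step _ _ p) v = here (refl , ≋-refl)

  trace-continues : ∀ {i g j k V} (p : Path w i g (just j) k) → Visited V j k →
    ∀ {i′ g′} → Visited (trace p) i′ g′ → Continues (trace p ++ V) i′ g′
  trace-continues (step {i} {g} {s} _ e p) v (here (refl , g′≋g)) =
    _ , _ , trans (cong (move w i) (at-cong g′≋g)) e , there (visited-≋ (▸-cong s g′≋g) (trace-first p v))
  trace-continues (step _ _ p) v (there q) with trace-continues p v q
  ... | s , j , e , u = s , j , e , there u

  trace-lit : ∀ {i g t k} (p : Path w i g t k) → ∀ {i′ g′} → Visited (trace p) i′ g′ → Lit g′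
  trace-lit (step (k , on) _ p) (here (refl , g′≋g)) = k , trans (lamp≡ g′≋g k) on
  trace-lit (step _ _ p) (there q) = trace-lit p q

  spinning V : Visits
  spinning = (spin₁ , h) ∷ (spin₂ , h ▸ a⁺) ∷ []
  V = trace path ++ spinning

  spin-here : Visited spinning spin₁ h
  spin-here = here (refl , ≋-refl)

  spinning-continues : ∀ {i g} → Visited spinning i g → Continues spinning i g
  spinning-continues {g = g} (here (refl , e)) = a⁺ , spin₂ , spin₁-move (at g) , there (here (refl , ▸-cong a⁺ e))
  spinning-continues {g = g} (there (here (refl , e))) = a⁻ , spin₁ , spin₂-move (at g) , here (refl , ≋-trans (▸-cong a⁻ e) (a⁺a⁻ h))

  V-continues : ∀ {i g} → Visited V i g → Continues V i g
  V-continues v with ++⁻ (trace path) v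
  ... | inj₁ u = trace-continues path spin-here u
  ... | inj₂ u with spinning-continues u
  ...   | s , j , e , u′ = s , j , e , ++⁺ʳ (trace path) u′

  V-lit : ∀ {i g} → Visited V i g → Lit g
  V-lit v with ++⁻ (trace path) v
  ... | inj₁ u = trace-lit path u
  ... | inj₂ (here (refl , e)) = proj₁ lit-h , trans (lamp≡ e (proj₁ lit-h)) (proj₂ lit-h)
  ... | inj₂ (there (here (refl , e))) = proj₁ lit-h ,
        trans (lamp≡ (≋-trans e (a⁺≋ h)) (proj₁ lit-h)) (proj₂ lit-h)

  -- Rays and chain are infinite sets, but the position of `g` leaves a single candidate to compare
  -- with.
  right? : ∀ g → Dec (g ≋ ⟨ [] , + ℤ.∣ pos g ∣ ⟩)
  right? g = g ≋? ⟨ [] , + ℤ.∣ pos g ∣ ⟩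

  left? : ∀ g → Dec (g ≋ ⟨ [] , ℤ.- + ℤ.∣ pos g ∣ ⟩)
  left? g = g ≋? ⟨ [] , ℤ.- + ℤ.∣ pos g ∣ ⟩

  chain? : ∀ g → Dec (g ≋ chain ℤ.∣ pos g ∣)
  chain? g = g ≋? chain ℤ.∣ pos g ∣

  lab : Elem → Label
  lab g = record
    { lampʳ = at g
    ; belowʳ = below (pos g) (lamps g)
    ; aboveʳ = above (pos g) (lamps g)
    ; rayʳ = does (right? g)
    ; rayˡ = does (left? g)
    ; present = λ i → does (visited? V i g)
    }

  count : Elem → ℕ
  count g = if does (chain? g) then suc D ∸ ℤ.∣ pos g ∣ else 0

  transport : ∀ {g g′} (f : ℕ → Elem) → g ≋ g′ → g ≋ f ℤ.∣ pos g ∣ → g′ ≋ f ℤ.∣ pos g′ ∣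
  transport f e q = subst (λ n → _ ≋ f ℤ.∣ n ∣) (pos≡ e) (≋-trans (≋-sym e) q)

  does-cong : ∀ {g g′} (f : ℕ → Elem) → g ≋ g′ → does (g ≋? f ℤ.∣ pos g ∣) ≡ does (g′ ≋? f ℤ.∣ pos g′ ∣)
  does-cong f e = does-⇔ (mk⇔ (transport f e) (transport f (≋-sym e))) (_ ≋? _) (_ ≋? _)

  lab-cong : ∀ {g g′} → g ≋ g′ → lab g ≐ lab g′
  lab-cong {g} {g′} e = record
    { lamp≐ = at-cong e
    ; below≐ = trans (cong (λ n → below n (lamps g)) (pos≡ e)) (below-cong (pos g′) {lamps g} {lamps g′} (lamp≡ e))
    ; above≐ = trans (cong (λ n → above n (lamps g)) (pos≡ e)) (above-cong (pos g′) {lamps g} {lamps g′} (lamp≡ e))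
    ; rayʳ≐ = does-cong (λ n → ⟨ [] , + n ⟩) e
    ; rayˡ≐ = does-cong (λ n → ⟨ [] , ℤ.- + n ⟩) e
    ; present≐ = λ i → does-⇔ (mk⇔ (visited-≋ (≋-sym e)) (visited-≋ e)) (visited? V i g) (visited? V i g′)
    }

  count-cong : ∀ {g g′} → g ≋ g′ → count g ≡ count g′
  count-cong {g} {g′} e = cong₂ (λ b n → if b then suc D ∸ ℤ.∣ n ∣ else 0) (does-cong chain e) (pos≡ e)

  count-chain : ∀ {g} n → g ≋ chain n → count g ≡ suc D ∸ n
  count-chain {g} n e = trans (cong (λ b → if b then suc D ∸ ℤ.∣ pos g ∣ else 0) (dec-true (chain? g) (subst (λ i → g ≋ chain i) (sym n≡) e)))
    (cong (suc D ∸_) n≡)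
    where
    n≡ : ℤ.∣ pos g ∣ ≡ n
    n≡ = cong ℤ.∣_∣ (trans (pos≡ e) (pos-chain n))

  data Counted (g : Elem) : Set where
    on-chain  : ∀ n → g ≋ chain n → Counted g
    off-chain : count g ≡ 0 → Counted g

  counted : ∀ g → Counted g
  counted g with chain? g in eq
  ... | yes e = on-chain _ e
  ... | no _ = off-chain (cong (λ d → if does d then suc D ∸ ℤ.∣ pos g ∣ else 0) eq)

  rayʳ-true : ∀ {g} n → g ≋ ⟨ [] , + n ⟩ → rayʳ (lab g) ≡ true
  rayʳ-true {g} n e = dec-true (right? g) (subst (λ k → g ≋ ⟨ [] , + k ⟩) (cong ℤ.∣_∣ (sym (pos≡ e))) e)

  rayˡ-true : ∀ {g} n → g ≋ ⟨ [] , ℤ.- + n ⟩ → rayˡ (lab g) ≡ true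
  rayˡ-true {g} n e = dec-true (left? g) (subst (λ k → g ≋ ⟨ [] , ℤ.- + k ⟩) (trans (sym (ℤₚ.∣-i∣≡∣i∣ (+ n))) (cong ℤ.∣_∣ (sym (pos≡ e)))) e)

  crossing : ∀ g s → Crossing (lab g) s (lab (g ▸ s))
  crossing g a⁺ =
    trans (below≐ (lab-cong (a⁺≋ g))) (below-up (pos g) (lamps g)) ,
    trans (above-up (pos g) (lamps g)) (cong (_⊕ at g) (sym (above≐ (lab-cong (a⁺≋ g))))) ,
    λ r → rayʳ-true {g ▸ a⁺} (ℤ.∣ pos g ∣ + 1) (▸-cong a⁺ (does-true {d = right? g} r))
  crossing g b⁺ =
    trans (below≐ (lab-cong (b⁺≋ g))) (trans (below-up n (n ∷ lamps g))
      (cong₂ _⊕_ (cong (λ b → if b then signed (lamp (lamps g) n) (below n (lamps g)) else below n (lamps g)) (dec-false (n ℤ.<? n) (ℤₚ.<-irrefl refl)))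
        (lamp-∷-≡ n (lamps g)))) ,
    trans (above-up n (lamps g)) (cong (_⊕ at g) (sym (trans (above≐ (lab-cong (b⁺≋ g)))
      (cong (λ b → if b then above (up n) (lamps g) else signed (lamp (lamps g) n) (above (up n) (lamps g))) (dec-true (n ℤ.<? up n) (n<up-n n))))))
    where n = pos g
  crossing g a⁻ = λ r → rayˡ-true {g ▸ a⁻} (suc ℤ.∣ pos g ∣)
    (≋-trans (▸-cong a⁻ (does-true {d = left? g} r)) (down-neg ℤ.∣ pos g ∣ & λ _ → refl))
    where
    down-neg : ∀ n → down (ℤ.- + n) ≡ ℤ.- + suc n
    down-neg zero = refl
    down-neg (suc n) = cong (λ k → -[1+ suc k ]) (ℕₚ.+-identityʳ n)
  crossing g b⁻ = tt

  walks : ∀ g s → Walks (lab g) s (lab (g ▸ s))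
  walks g s i p d with V-continues (does-true {d = visited? V i g} p)
  ... | s′ , j , e , v = subst (λ t → Arrives (lab (g ▸ s)) t) (sym (cong proj₂ e))
    (dec-true (visited? V j (g ▸ s)) (subst (λ s → Visited V j (g ▸ s)) (trans (sym (cong proj₁ e)) d) v))

  starts : ∀ g → Starts (count g ≡ᵇ 1) (lab g)
  starts g e with counted g
  ... | off-chain z = case trans (sym (cong (_≡ᵇ 1) z)) e of λ ()
  ... | on-chain n g≋ = dec-true (visited? V (entry w) g)
      (visited-≋ (subst (λ i → g ≋ chain i) n≡D g≋) (trace-first path spin-here))
    where
    gap : suc D ∸ n ≡ 1
    gap = trans (sym (count-chain n g≋)) (≡ᵇ1⇒≡1 (count g) e)
    n≡D : n ≡ D
    n≡D = ℕₚ.suc-injective (trans (ℕₚ.+-comm 1 n) (trans (cong (λ k → n + k) (sym gap)) (ℕₚ.m+[n∸m]≡n {n} {suc D} (ℕₚ.<⇒≤ (ℕₚ.m∸n≢0⇒n<m λ z → case trans (sym gap) z of λ ())))))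

  compatible : ∀ g s → Compatible (count g ≡ᵇ 1) s (lab g) (lab (g ▸ s))
  compatible g s = crossing g s
    , ((λ r → at-cong (does-true {d = right? g} r)) , (λ r → at-cong (does-true {d = left? g} r)))
    , walks g s , starts g

  base : Elem → ℕ
  base g = tile (lab g)

  base<D : ∀ g → base g < D
  base<D g = ℕₚ.<-≤-trans (tile<N (lab g)) (large C)

  code : Elem → ℕ
  code g = count g * D + base g

  count≤ : ∀ g → count g ≤ suc D
  count≤ g with counted g
  ... | on-chain n e = subst (_≤ suc D) (sym (count-chain n e)) (ℕₚ.m∸n≤m (suc D) n)
  ... | off-chain z = subst (_≤ suc D) (sym z) z≤n

  code< : ∀ g → code g < tiles D
  code< g = s≤s (ℕₚ.≤-trans (ℕₚ.+-mono-≤ (ℕₚ.*-monoˡ-≤ D (count≤ g)) (ℕₚ.<⇒≤ (base<D g))) (ℕₚ.≤-reflexive (ℕₚ.+-comm (suc D * D) D)))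

  code-cong : ∀ {g g′} → g ≋ g′ → code g ≡ code g′
  code-cong e = cong₂ (λ c x → c * D + x) (count-cong e) (tile-cong (lab-cong e))

  φ : Elem → Fin (tiles D)
  φ g = fromℕ< (code< g)

  φ-cong : ∀ g g′ → g ≈ g′ → φ g ≡ φ g′
  φ-cong g g′ (p , l) = Finₚ.toℕ-injective (trans (Finₚ.toℕ-fromℕ< (code< g)) (trans (code-cong (p & l)) (sym (Finₚ.toℕ-fromℕ< (code< g′)))))

  -- No state may be present here. Every visited element has a lit lamp, whereas the identity has
  -- none.
  base-one : base one ≡ 0
  base-one = tile-zero dark
    where
    unvisited : ∀ i → does (visited? V i one) ≡ false
    unvisited i = dec-false (visited? V i one) λ v → case proj₂ (V-lit v) of λ ()
    dark : ∀ j → bits (lab one) j ≡ false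
    dark 0 = refl
    dark 1 = refl
    dark 2 = refl
    dark 3 = refl
    dark 4 = refl
    dark 5 = cong not (rayʳ-true 0 ≋-refl)
    dark 6 = cong not (rayˡ-true 0 ≋-refl)
    dark (suc (suc (suc (suc (suc (suc (suc j))))))) = extend-false unvisited j

  φ-one : φ one ≡ seed D
  φ-one = Finₚ.toℕ-injective (trans (Finₚ.toℕ-fromℕ< (code< one)) (trans
    (trans (cong₂ (λ c x → c * D + x) (count-chain 0 ≋-refl) base-one) (ℕₚ.+-identityʳ (suc D * D))) (sym (toℕ-seed D))))

  entry-bit : ∀ g s → bit (index₃ (number s + 4 * eqN (count g) 1) (base g) (base (g ▸ s))) D ≡ 1
  entry-bit g s = subst (λ n → bit (index₃ (number s + 4 * n) (base g) (base (g ▸ s))) D ≡ 1) (sym (eqN-1 (count g)))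
    (coded C {count g ≡ᵇ 1} {s} (tile<N (lab g)) (tile<N (lab (g ▸ s)))
      (compatible-≐ {count g ≡ᵇ 1} {s} (label-tile (lab g)) (label-tile (lab (g ▸ s))) (compatible g s)))

  -- On the chain the predecessor of `suc D ∸ n` is `suc D ∸ suc n` even where the subtraction
  -- truncates; off the chain the counter is 0.
  counts-down : ∀ g → pred (count g) * dist (count (g ▸ b⁺)) (pred (count g)) ≡ 0
  counts-down g with counted g
  ... | off-chain z rewrite z = refl
  ... | on-chain n e rewrite count-chain n e | count-chain (suc n) (▸-cong b⁺ e) | ℕₚ.pred[m∸n]≡m∸[1+n] (suc D) n
      | ℕₚ.n∸n≡0 (D ∸ n) = ℕₚ.*-zeroʳ (D ∸ n)

  violation : ∀ g s → eqN (number s) 2 * (pred (count g) * dist (count (g ▸ s)) (pred (count g))) ≡ 0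
  violation g a⁺ = refl
  violation g a⁻ = refl
  violation g b⁺ = trans (ℕₚ.*-identityˡ _) (counts-down g)
  violation g b⁻ = refl

  passes : ∀ g s → test D (code g) (number s) (code (g ▸ s)) ≡ 1
  passes g s
    rewrite proj₁ (rem-quo (count g) D (base g) (base<D g)) | proj₂ (rem-quo (count g) D (base g) (base<D g))
          | proj₁ (rem-quo (count (g ▸ s)) D (base (g ▸ s)) (base<D (g ▸ s)))
          | proj₂ (rem-quo (count (g ▸ s)) D (base (g ▸ s)) (base<D (g ▸ s)))
          | entry-bit g s | violation g s = refl

  tileable : Tileable (instanceOf D)
  tileable = φ , φ-cong , φ-one , λ g s → cong (_≡ᵇ 1)
    (trans (cong₂ (λ x y → test D x (number s) y) (Finₚ.toℕ-fromℕ< (code< g)) (Finₚ.toℕ-fromℕ< (code< (g ▸ s)))) (passes g s))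

-- The diagonal argument

spinning⇒tileable : ∀ v {D} → Labels.Coded (v ⨾ while spin) D → ∀ {h} →
  Path (v ⨾ while spin) (entry (v ⨾ while spin)) (chain D) (just (size′ v ↑ʳ (3 ↑ʳ zero))) h → Lit h → Tileable (instanceOf D)
spinning⇒tileable v C path lit-h = Existence.tileable (v ⨾ while spin) C path lit-h
  (move-⨾ʳ v (while spin) (3 ↑ʳ zero)) (move-⨾ʳ v (while spin) (3 ↑ʳ suc zero))

module Simulation (P : Code 1) where

  -- The program is compiled above register 0, which holds the input; this is the one column added
  -- to `scratch P`.
  k : ℕ
  k = suc (scratch P)

  w : Walker
  w = program k P

  open Labels w using (Coded; coding; N>0; large)

  module Runs-on {D} (C : Coded D) = Program k P D (ℕₚ.<-≤-trans N>0 (large C)) (ℕₚ.≤-reflexive (ℕₚ.+-comm (scratch P) 1))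

  zero⇒untileable : ∀ {D} → Coded D → Eval P (D ∷ []) 0 → ¬ Tileable (instanceOf D)
  zero⇒untileable C e tiling = Forced.never-exits w C tiling (proj₂ (Runs-on.exits C e)) (Forced.starts w C tiling)

  one⇒tileable : ∀ {D} → Coded D → Eval P (D ∷ []) 1 → Tileable (instanceOf D)
  one⇒tileable C e = spinning⇒tileable (setup k P) C (proj₁ (proj₂ r)) (proj₂ (proj₂ r))
    where r = Runs-on.spins C e

-- The answer 1 becomes 0, which makes the walker halt. All other answers mean "no" and become 1,
-- which makes it spin.
not-one : ℕ → ℕ
not-one b = 1 ∸ eqN b 1

not-oneF : Fun₁ not-one
not-oneF = toFun₁ (lit 1 ∸ₑ call₂ eqF v₀ (lit 1))

diagonal : Code 1 → Code 1
diagonal c = comp (code₁ not-oneF) (comp c (code₁ encodingF ∷ []) ∷ [])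

eval-diagonal : ∀ c {D b} → Eval c (encode (instanceOf D) ∷ []) b → Eval (diagonal c) (D ∷ []) (not-one b)
eval-diagonal c {D} {b} e = ev-comp
  (ev-comp (subst (λ n → EvalAll (code₁ encodingF ∷ []) (D ∷ []) (n ∷ [])) (sym (encode-instanceOf D)) (ev₁ encodingF D ∷ [])) e ∷ [])
  (ev₁ not-oneF b)

theoremA : ¬ (Σ (Code 1) DecidesSeededTiling)
theoremA (c , decides) = refute (Labels.coding w)
  where
  open Simulation (diagonal c)
  refute : ∃ (Labels.Coded w) → ⊥
  refute (D , C) = split (decides (instanceOf D))
    where
    split : (∃ λ b → Eval c (encode (instanceOf D) ∷ []) b × (Tileable (instanceOf D) ⇔ (b ≡ 1))) → ⊥
    split (b , e , tileable⇔b≡1) = case b ℕ.≟ 1 of λ where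
      (yes refl) → zero⇒untileable C (eval-diagonal c e) (Equivalence.from tileable⇔b≡1 refl)
      (no b≢1) → b≢1 (Equivalence.to tileable⇔b≡1 (one⇒tileable C
        (subst (Eval (diagonal c) (D ∷ [])) (cong (1 ∸_) (eqN-≢ b≢1)) (eval-diagonal c e))))
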